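{- Let $H$ be a finite simple graph. If $H$ or its complement $\overline{H}$ contains a non-complete $3$-connected induced subgraph on at least five vertices, then $H$ has a finite deletion host.
   Context: All graphs are simple, undirected and finite. A $3$-connected graph has at least four vertices and remains connected after deletion of any set of at most two vertices. A finite deletion host for $H$ is a finite graph $G$ such that $E(G)\neq\varnothing$, $G$ contains no induced subgraph isomorphic to $H$, and for every $e\in E(G)$ the graph $G-e$ (edge deleted, vertices kept) contains an induced subgraph isomorphic to $H$. -}

module Defs where

open import Data.Bool.Base using (Bool; false; _∧_; _∨_; not; T)
open import Data.Bool.Properties using (∧-comm; ∨-comm)
open import Data.Fin.Base using (Fin)
open import Data.Fin.Properties using (_≟_)
open import Data.Fin.Subset using (Subset; ∣_∣; _∉_)
open import Data.Nat.Base using (ℕ; _≤_)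
open import Data.Product.Base using (∃₂; _×_)
open import Data.Refinement.Base using (Refinement; value)
open import Function.Bundles using (_↣_; Injection)
open import Relation.Binary.Construct.Closure.ReflexiveTransitive using (Star)
open import Relation.Binary.PropositionalEquality
open import Relation.Nullary.Decidable using (does; yes; no; dec-true)
open import Relation.Nullary.Negation using (¬_; contradiction)

-- Simple undirected graphs on a vertex type V.  Adjacency is Boolean-valued
-- because finite graphs have decidable adjacency; finite graphs are those
-- with V = Fin n.
record Graph (V : Set) : Set where
  field
    adj    : V → V → Bool
    symm   : ∀ x y → adj x y ≡ adj y x
    irrefl : ∀ x → adj x x ≡ false

  Adj : V → V → Set
  Adj x y = T (adj x y)

open Graph public

FinGraph : ℕ → Set
FinGraph n = Graph (Fin n)

eq? : ∀ {n} → Fin n → Fin n → Bool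
eq? x y = does (x ≟ y)

eq?-sym : ∀ {n} (x y : Fin n) → eq? x y ≡ eq? y x
eq?-sym x y with x ≟ y | y ≟ x
... | yes _ | yes _ = refl
... | no  _ | no  _ = refl
... | yes p | no ¬q = contradiction (sym p) ¬q
... | no ¬p | yes q = contradiction (sym q) ¬p

complement : ∀ {n} → FinGraph n → FinGraph n
complement G .adj x y = not (eq? x y) ∧ not (adj G x y)
complement G .symm x y =
  cong₂ (λ a b → not a ∧ not b) (eq?-sym x y) (symm G x y)
complement G .irrefl x rewrite dec-true (x ≟ x) refl = refl

sameEdge : ∀ {n} (u v x y : Fin n) → Bool
sameEdge u v x y =
  (eq? x u ∧ eq? y v) ∨ (eq? x v ∧ eq? y u)

deleteEdge : ∀ {n} → FinGraph n → (u v : Fin n) → FinGraph n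
deleteEdge G u v .adj x y = adj G x y ∧ not (sameEdge u v x y)
deleteEdge G u v .symm x y =
  cong₂ (λ a b → a ∧ not b) (symm G x y)
    (trans (∨-comm (eq? x u ∧ eq? y v) (eq? x v ∧ eq? y u))
           (cong₂ _∨_ (∧-comm (eq? x v) (eq? y u))
                      (∧-comm (eq? x u) (eq? y v))))
deleteEdge G u v .irrefl x rewrite irrefl G x = refl

-- The vertices outside S form a refinement type, whose membership proofs are
-- irrelevant, so each remaining vertex occurs exactly once.
deleteVertices : ∀ {n} → FinGraph n → (S : Subset n) →
                 Graph (Refinement (Fin n) (_∉ S))
deleteVertices G S .adj x y = adj G (value x) (value y)
deleteVertices G S .symm x y = symm G (value x) (value y)
deleteVertices G S .irrefl x = irrefl G (value x)

-- No nonemptiness clause: this is only applied to graphs obtained by deleting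
-- at most two vertices from a graph with at least four.
Connected : ∀ {V} → Graph V → Set
Connected G = ∀ x y → Star (Adj G) x y

ThreeConnected : ∀ {n} → FinGraph n → Set
ThreeConnected {n} G =
  4 ≤ n × (∀ (S : Subset n) → ∣ S ∣ ≤ 2 → Connected (deleteVertices G S))

Complete : ∀ {V} → Graph V → Set
Complete G = ∀ x y → x ≢ y → Adj G x y

-- F ⊑ G: G contains an induced subgraph isomorphic to F, given as an
-- injection of vertices preserving and reflecting adjacency.
infix 4 _⊑_
record _⊑_ {V W : Set} (F : Graph V) (G : Graph W) : Set where
  field
    embedding : V ↣ W
    induced   : ∀ x y → adj F x y ≡
                adj G (Injection.to embedding x) (Injection.to embedding y)

record IsDeletionHost {m n} (H : FinGraph m) (G : FinGraph n) : Set where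
  field
    hasEdge  : ∃₂ λ u v → Adj G u v
    H-free   : ¬ (H ⊑ G)
    deletion : ∀ u v → Adj G u v → H ⊑ deleteEdge G u v

HasFiniteDeletionHost : ∀ {m} → FinGraph m → Set
HasFiniteDeletionHost H = ∃₂ λ n (G : FinGraph n) → IsDeletionHost H G

HasNoncomplete3ConnectedInduced≥5 : ∀ {m} → FinGraph m → Set
HasNoncomplete3ConnectedInduced≥5 H =
  ∃₂ λ k (F : FinGraph k) → 5 ≤ k × ¬ Complete F × ThreeConnected F × F ⊑ H

{-# OPTIONS --safe #-}
-- Let J be H or its complement, and let s tell the two apart.  Choose a 3-connected
-- induced subgraph F of J that is as large as possible over both sides, and a pair
-- a b in F which is a non-edge of H.  Let B arise from J by flipping a b.  Then B
-- contains no copy of F: for a copy W ≠ F, either J[F ∪ W] is 3-connected, or some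
-- two vertices separate it, and then the complement of J contains the join of the
-- rest of F and the rest of W; both are larger than F.
--
-- Glue finitely many copies of B (blocks) so that every pair that is an edge on the
-- side of H is the pair a b of some block, blocks share at most two vertices, and
-- three consecutive vertices of any short cycle lie in a common block.  By the last
-- property a 3-connected subgraph lies inside one block, since the complement of a
-- block in it has at most two attachment vertices.  So the glued graph contains no F,
-- hence no J, while flipping any of those pairs creates a J.  Deleting further edges
-- of the host greedily, as long as it stays H-free, ends in a deletion host.
--
-- The gluing pattern is a finite group whose generators are the pairs of colours
-- (vertices of B); the blocks are its elements and the vertices of colour i are the
-- cosets of the subgroup generated by the pairs containing i.  Following Otto's
-- construction of acyclic groups, it acts on chains of such subgroups glued along
-- the one-generator subgroups, and a short cycle of cosets violating the condition
-- would act nontrivially on its chain.  The chains do not enlarge the subgroups,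
-- because these already act on all small sets.
module Submission where

open import Defs
open import Data.Bool.Base using (Bool; T; _xor_; _∧_; _∨_; false; if_then_else_; not; true)
open import Data.Bool.Properties as Bool using (not-involutive; not-¬; ∧-zeroʳ)
open import Data.Empty using (⊥; ⊥-elim; ⊥-elim-irr)
open import Data.Fin.Base as FB using (Fin; combine; finToFun; fromℕ<; funToFin; inject≤; join; punchIn; remQuot; splitAt; suc; toℕ; zero)
open import Data.Fin.Properties as F using (all?; any?; combine-remQuot; finToFun-funToFin; funToFin-finToFin; join-splitAt; punchIn-injective; punchInᵢ≢i; remQuot-combine; splitAt-join; toℕ<n)
open import Data.Fin.Subset using (Subset; _∉_; _∪_; ⁅_⁆; ∣_∣) renaming (⊥ to ∅; _∈_ to _∈ₛ_)
open import Data.Fin.Subset.Properties using (x∈p∪q⁺; x∈p∪q⁻; x∈⁅x⁆; x∈⁅y⁆⇒x≡y; ∉⊥; ∣⁅x⁆∣≡1; ∣⊥∣≡0)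
open import Data.Irrelevant using (Irrelevant; [_])
open import Data.List.Base using (List; []; _++_; _∷_; allFin; length; lookup; map; replicate; tabulate; upTo)
open import Data.List.Membership.Propositional using (_∈_)
open import Data.List.Membership.Propositional.Properties using (∈-++⁺ʳ; ∈-++⁺ˡ; ∈-++⁻; ∈-allFin; ∈-lookup; ∈-map⁺; ∈-map⁻; ∈-upTo⁺)
open import Data.List.Properties using (length-++; length-map; length-tabulate; length-upTo)
open import Data.List.Relation.Unary.All as All using (All; []; _∷_)
open import Data.List.Relation.Unary.All.Properties using (++⁺; replicate⁺; tabulate⁺; tabulate⁻)
open import Data.List.Relation.Unary.Any as Any using (index)
open import Data.List.Relation.Unary.Any.Properties using (lookup-index)
open import Data.Nat.Base using (_*_; _+_; _<_; _^_; _∸_; _≤_; suc; s≤s; zero; z≤n; ℕ)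
open import Data.Nat.DivMod using (%-distribˡ-+; [m+n]%n≡m%n; _%_; _/_; m%n%n≡m%n; m%n<n; m<n⇒m%n≡m; m≡m%n+[m/n]*n)
open import Data.Nat.Properties as ℕ using (<⇒≤; _<?_; ≤-refl; ≤-reflexive; ≤-trans; ≰⇒>)
open import Data.Product.Base using (_,_; _×_; proj₁; proj₂; ∃)
open import Data.Product.Properties using (≡-dec)
open import Data.Refinement.Base using (_,_; proof; value)
open import Data.Sum.Base as Sum using ([_,_]′; _⊎_; inj₁; inj₂)
open import Data.Sum.Properties using (inj₁-injective; inj₂-injective)
open import Data.Unit.Base using (tt)
open import Data.Vec.Base using ([]; _∷_)
open import Function.Base using (_∘_; case_of_; id)
open import Function.Bundles using (Injection; mk↣)
open import Relation.Binary.Construct.Closure.ReflexiveTransitive as Star using (Star; _◅_; _◅◅_; ε)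
open import Relation.Binary.Definitions using (DecidableEquality; tri<; tri>; tri≈)
open import Relation.Binary.PropositionalEquality using (_≡_; _≢_; cong; cong₂; refl; subst; subst₂; sym; trans)
open import Relation.Nullary.Decidable using (Dec; _×-dec_; _→-dec_; _⊎-dec_; dec-false; dec-true; decidable-stable; does; no; yes; ¬?)
open import Relation.Nullary.Negation using (contradiction; ¬_)

-- Actions of groups generated by elements of order m

-- The gluing has to meet two opposed demands: blocks sharing two vertices must agree on whether
-- these are adjacent, yet every pair that is an edge on the side of `H` must be the pair `a b` of
-- one of its blocks. Hence a block also carries a type, which matches colours with vertices of `B`,
-- and the generator of a pair moves blocks only between types that agree on this pair, reaching the
-- one in which it is `a b`. Groups are never formed: a finite action stands for its permutation
-- group, and tuples listing every point stand for group elements. One round of chains suffices,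
-- without induction on the generators, because two stars share a single generator: in a chain, a
-- component of one star lies in a layer of its own colour or has boundedly many points, and actions
-- on that few points were provided for in advance. Greedy deletion matters when the core lies in
-- the complement: vertices in no common block are then adjacent in the host, and no copy of `H` is
-- prepared for these edges.

iter : {A : Set} → ℕ → (A → A) → A → A
iter zero    f x = x
iter (suc n) f x = iter n f (f x)

module _ {A : Set} (f : A → A) where

  iter-+ : ∀ s t x → iter (s + t) f x ≡ iter t f (iter s f x)
  iter-+ zero    t x = refl
  iter-+ (suc s) t x = iter-+ s t (f x)

  iter-comm : ∀ s x → iter s f (f x) ≡ f (iter s f x)
  iter-comm zero    x = refl
  iter-comm (suc s) x = iter-comm s (f x)

  iter-fixed : ∀ s {x} → f x ≡ x → iter s f x ≡ x
  iter-fixed zero    p = refl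
  iter-fixed (suc s) p = trans (cong (iter s f) p) (iter-fixed s p)

  iter-* : ∀ s t {x} → iter t f x ≡ x → iter (s * t) f x ≡ x
  iter-* zero    t     p = refl
  iter-* (suc s) t {x} p =
    trans (iter-+ t (s * t) x) (trans (cong (iter (s * t) f) p) (iter-* s t p))

iter-cong : {A : Set} {f g : A → A} → (∀ x → f x ≡ g x) → ∀ s x → iter s f x ≡ iter s g x
iter-cong p zero    x = refl
iter-cong {f = f} p (suc s) x = trans (cong (iter s f) (p x)) (iter-cong p s _)

funToFin-cong : ∀ {m n} {f g : Fin m → Fin n} → (∀ i → f i ≡ g i) → funToFin f ≡ funToFin g
funToFin-cong {zero}  p = refl
funToFin-cong {suc m} p = cong₂ combine (p zero) (funToFin-cong (p ∘ suc))

finToFun-injective : ∀ {m n} (s t : Fin (n ^ m)) →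
                     (∀ i → finToFun {n} {m} s i ≡ finToFun t i) → s ≡ t
finToFun-injective {m} {n} s t p =
  trans (sym (funToFin-finToFin {m} {n} s))
        (trans (funToFin-cong p) (funToFin-finToFin {m} {n} t))

-- Actions of the group ⟨ e ∈ Fin r ∣ eᵐ = 1 ⟩, where m = suc m′; positive
-- words suffice because the generators have finite order.
module Actions (r m′ : ℕ) where

  m : ℕ
  m = suc m′

  E : Set
  E = Fin r

  record Action (A : Set) : Set where
    field
      act   : E → A → A
      order : ∀ e x → iter m (act e) x ≡ x

  open Action public

  run : {A : Set} → Action A → List E → A → A
  run X []      x = x
  run X (e ∷ w) x = run X w (act X e x)

  record Trivial {A : Set} (X : Action A) (w : List E) : Set where
    constructor trivial
    field fixes : ∀ x → run X w x ≡ x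

  open Trivial public

  inv : List E → List E
  inv []      = []
  inv (e ∷ w) = inv w ++ replicate m′ e

  module _ {A : Set} (X : Action A) where

    run-++ : ∀ u w x → run X (u ++ w) x ≡ run X w (run X u x)
    run-++ []      w x = refl
    run-++ (e ∷ u) w x = run-++ u w (act X e x)

    run-via : ∀ u w {x y z} → run X u x ≡ y → run X w y ≡ z → run X (u ++ w) x ≡ z
    run-via u w {x} p q = trans (run-++ u w x) (trans (cong (run X w) p) q)

    run-replicate : ∀ s e x → run X (replicate s e) x ≡ iter s (act X e) x
    run-replicate zero    e x = refl
    run-replicate (suc s) e x = run-replicate s e (act X e x)

    run-inv : ∀ w x → run X (inv w) (run X w x) ≡ x
    run-inv []      x = refl
    run-inv (e ∷ w) x =
      trans (run-++ (inv w) (replicate m′ e) _)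
        (trans (cong (run X (replicate m′ e)) (run-inv w (act X e x)))
          (trans (run-replicate m′ e _) (order X e x)))

    OnLine : E → A → A → Set
    OnLine e z z′ = ∃ λ s → z′ ≡ iter s (act X e) z

    line-refl : ∀ {e z} → OnLine e z z
    line-refl = 0 , refl

    line-step : ∀ {e z z′} → OnLine e z z′ → OnLine e z (act X e z′)
    line-step {e} {z} (s , p) = suc s , trans (cong (act X e) p) (sym (iter-comm (act X e) s z))

    line-trans : ∀ {e x y z} → OnLine e x y → OnLine e y z → OnLine e x z
    line-trans {e} {x} (s , p) (t , q) =
      s + t , trans q (trans (cong (iter t (act X e)) p) (sym (iter-+ (act X e) s t x)))

    line-sym : ∀ {e x y} → OnLine e x y → OnLine e y x
    line-sym {e} {x} (s , refl) = s * m′ ,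
      sym (trans (sym (iter-+ f s (s * m′) x))
            (trans (cong (λ t → iter t f x) (sym (*-suc s m′))) (iter-* f s m (order X e x))))
      where
      open import Data.Nat.Properties using (*-suc)
      f = act X e

    line-word : ∀ {e x y} → OnLine e x y → ∃ λ s → y ≡ run X (replicate s e) x
    line-word {e} {x} (s , p) = s , trans p (sym (run-replicate s e x))

    line-bounded : ∀ {e x y} → OnLine e x y → ∃ λ s → s < m × y ≡ iter s (act X e) x
    line-bounded {e} {x} (s , p) = s % m , m%n<n s m ,
      trans p (trans (cong (λ t → iter t f x) (trans (m≡m%n+[m/n]*n s m) (+-comm (s % m) _)))
        (trans (iter-+ f (s / m * m) (s % m) x) (cong (iter (s % m) f) (iter-* f (s / m) m (order X e x)))))
      where
      open import Data.Nat.DivMod using (_%_; _/_; m%n<n; m≡m%n+[m/n]*n)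
      open import Data.Nat.Properties using (+-comm)
      f = act X e

    line? : DecidableEquality A → ∀ e x y → Dec (OnLine e x y)
    line? _≟_ e x y with any? {n = m} (λ s → y ≟ iter (toℕ s) (act X e) x)
    ... | yes (s , p) = yes (toℕ s , p)
    ... | no  ¬p      = no λ q → case line-bounded q of λ where
      (s , s<m , p) → ¬p (fromℕ< s<m ,
        trans p (cong (λ t → iter t (act X e) x) (sym (F.toℕ-fromℕ< s<m))))

  prefix : (ℕ → List E) → ℕ → List E
  prefix ws zero    = []
  prefix ws (suc l) = prefix ws l ++ ws l

  traverse : (ws : ℕ → List E) (P : ℕ) {C : Set} (X : Action C) (in′ out : ℕ → C) →
             (∀ l → suc l < P → out l ≡ in′ (suc l)) → (∀ l → l < P → run X (ws l) (in′ l) ≡ out l) →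
             ∀ l → l < P → run X (prefix ws (suc l)) (in′ 0) ≡ out l
  traverse ws P X in′ out level advance zero    lt = advance 0 lt
  traverse ws P X in′ out level advance (suc l) lt = run-via X (prefix ws (suc l)) (ws (suc l))
    (trans (traverse ws P X in′ out level advance l (<⇒≤ lt)) (level l lt)) (advance (suc l) lt)

  -- The action on tuples; a good tuple has every point as a coordinate, so a
  -- word fixing it acts trivially.
  module Pow {n : ℕ} (X : Action (Fin n)) where

    pow-act : E → Fin (n ^ n) → Fin (n ^ n)
    pow-act e t = funToFin (λ c → act X e (finToFun {n} {n} t c))

    pow-iter : ∀ s e t c → finToFun {n} {n} (iter s (pow-act e) t) c ≡ iter s (act X e) (finToFun {n} {n} t c)
    pow-iter zero    e t c = refl
    pow-iter (suc s) e t c =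
      trans (pow-iter s e _ c) (cong (iter s (act X e)) (finToFun-funToFin {n} {n} _ c))

    pow : Action (Fin (n ^ n))
    pow .act     = pow-act
    pow .order e t = finToFun-injective {n} {n} _ _ λ c → trans (pow-iter m e t c) (order X e _)

    pow-run : ∀ w t c → finToFun {n} {n} (run pow w t) c ≡ run X w (finToFun {n} {n} t c)
    pow-run []      t c = refl
    pow-run (e ∷ w) t c = trans (pow-run w _ c) (cong (run X w) (finToFun-funToFin {n} {n} _ c))

    Good : Fin (n ^ n) → Set
    Good t = ∀ z → ∃ λ c → finToFun {n} {n} t c ≡ z

    good? : ∀ t → Dec (Good t)
    good? t = F.all? λ z → any? λ c → finToFun {n} {n} t c F.≟ z

    good-act : ∀ e {t} → Good t → Good (pow-act e t)
    good-act e {t} g z with g (iter m′ (act X e) z)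
    ... | c , p = c , trans (finToFun-funToFin {n} {n} _ c)
            (trans (cong (act X e) p) (trans (sym (iter-comm (act X e) m′ z)) (order X e z)))

    good-run : ∀ w {t} → Good t → Good (run pow w t)
    good-run []      g = g
    good-run (e ∷ w) g = good-run w (good-act e g)

    good-fix : ∀ w {t} → Good t → run pow w t ≡ t → Trivial X w
    good-fix w {t} g p .fixes z with g z
    ... | c , refl = trans (sym (pow-run w t c)) (cong (λ u → finToFun {n} {n} u c) p)

    trivial-pow : ∀ {w} → Trivial X w → Trivial pow w
    trivial-pow {w} p .fixes t = finToFun-injective {n} {n} _ _ λ c → trans (pow-run w t c) (fixes p _)

    ident : Fin (n ^ n)
    ident = funToFin {n} {n} id

    good-ident : Good ident
    good-ident z = z , finToFun-funToFin {n} {n} id z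

  -- Every self-map becomes a permutation of order dividing m once it is
  -- replaced by the identity off its m-periodic points.
  module _ {M : ℕ} where

    periodic : (Fin M → Fin M) → Fin M → Fin M
    periodic f x = if does (iter m f x F.≟ x) then f x else x

    periodic-yes : ∀ f {x} → iter m f x ≡ x → periodic f x ≡ f x
    periodic-yes f {x} p rewrite dec-true (iter m f x F.≟ x) p = refl

    periodic-iter : ∀ f s {x} → iter m f x ≡ x → iter s (periodic f) x ≡ iter s f x
    periodic-iter f zero    p = refl
    periodic-iter f (suc s) {x} p = trans (cong (iter s (periodic f)) (periodic-yes f p))
      (periodic-iter f s (trans (iter-comm f m x) (cong f p)))

    periodic-order : ∀ f x → iter m (periodic f) x ≡ x
    periodic-order f x = helper (iter m f x F.≟ x)
      where
      helper : Dec (iter m f x ≡ x) → iter m (periodic f) x ≡ x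
      helper (yes p) = trans (periodic-iter f m p) p
      helper (no ¬p) = iter-fixed (periodic f) m
        (cong (if_then f x else x) (dec-false (iter m f x F.≟ x) ¬p))

  -- Every code yields an action once `periodic` has repaired its self-maps. So the actions on `M`
  -- points form a family with a finite index set, whose disjoint sum is again finite.
  Code : ℕ → Set
  Code M = Fin ((M ^ M) ^ r)

  raw : ∀ M → Code M → E → Fin M → Fin M
  raw M s e = finToFun {M} {M} (finToFun {M ^ M} {r} s e)

  structure : ∀ M → Code M → Action (Fin M)
  structure M s .act e     = periodic (raw M s e)
  structure M s .order e x = periodic-order (raw M s e) x

  -- The relations common to all actions on `M` points. By `Transport` such a word also fixes every
  -- point of a large set whose orbit under the generators of the word has at most `M` points.
  record Universal (M : ℕ) (w : List E) : Set where
    constructor universal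
    field trivialises : ∀ (s : Code M) → Trivial (structure M s) w

  open Universal public

  -- An orbit with at most M points is one of the actions on Fin M.
  module Transport {M : ℕ} {B : Set} (_≟_ : DecidableEquality B) (Y : Action B) (γ : E → Bool)
                   (L : Fin M → B)
                   (closed : ∀ e → γ e ≡ true → ∀ c → ∃ λ c′ → act Y e (L c) ≡ L c′) where

    Im : B → Set
    Im b = ∃ λ c → L c ≡ b

    idx : B → Fin M → Fin M
    idx b d with any? (λ c → L c ≟ b)
    ... | yes (c , _) = c
    ... | no  _       = d

    L-idx : ∀ {b} d → Im b → L (idx b d) ≡ b
    L-idx {b} d i with any? (λ c → L c ≟ b)
    ... | yes (c , p) = p
    ... | no  ¬p      = contradiction i ¬p

    idx-irr : ∀ {b} d d′ → Im b → idx b d ≡ idx b d′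
    idx-irr {b} d d′ i with any? (λ c → L c ≟ b)
    ... | yes (c , p) = refl
    ... | no  ¬p      = contradiction i ¬p

    -- `L` may list a point several times; `idx` always selects the same preimage, and on selected
    -- preimages `f` copies `Y`. Elsewhere, and for generators outside `γ`, any value will do, since
    -- `periodic` corrects it.
    f : E → Fin M → Fin M
    f e c = idx (act Y e (L c)) c

    im-act : ∀ {e b} → γ e ≡ true → Im b → Im (act Y e b)
    im-act {e} ge (c , refl) with closed e ge c
    ... | c′ , p = c′ , sym p

    f-idx : ∀ {e b} d → γ e ≡ true → Im b → f e (idx b d) ≡ idx (act Y e b) d
    f-idx {e} {b} d ge i rewrite L-idx d i = idx-irr _ d (im-act ge i)

    f-iter : ∀ {e b} s d → γ e ≡ true → Im b → iter s (f e) (idx b d) ≡ idx (iter s (act Y e) b) d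
    f-iter zero    d ge i = refl
    f-iter {e} (suc s) d ge i =
      trans (cong (iter s (f e)) (f-idx d ge i)) (f-iter s d ge (im-act ge i))

    code : Code M
    code = funToFin {r} {M ^ M} λ e → funToFin {M} {M} (f e)

    raw-code : ∀ e c → raw M code e c ≡ f e c
    raw-code e c = trans (cong (λ g → finToFun {M} {M} g c) (finToFun-funToFin {r} {M ^ M} _ e))
                         (finToFun-funToFin {M} {M} (f e) c)

    act-code : ∀ {e b} d → γ e ≡ true → Im b → act (structure M code) e (idx b d) ≡ idx (act Y e b) d
    act-code {e} {b} d ge i =
      trans (periodic-yes (raw M code e)
              (trans (iter-cong (raw-code e) m _)
                (trans (f-iter m d ge i) (cong (λ b → idx b d) (order Y e b)))))
            (trans (raw-code e _) (f-idx d ge i))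

    run-code : ∀ {w b} d → All (λ e → γ e ≡ true) w → Im b →
               run (structure M code) w (idx b d) ≡ idx (run Y w b) d × Im (run Y w b)
    run-code d []         i = refl , i
    run-code {e ∷ w} d (ge ∷ gw) i with run-code {w} d gw (im-act ge i)
    ... | p , q = trans (cong (run (structure M code) w) (act-code d ge i)) p , q

    transport : ∀ {w} → All (λ e → γ e ≡ true) w → Universal M w → ∀ c → run Y w (L c) ≡ L c
    transport {w} gw u c with run-code {w} {L c} c gw (c , refl)
    ... | p , q = trans (sym (L-idx c q))
                    (trans (cong L (trans (sym p) (fixes (trivialises u code) _))) (L-idx c (c , refl)))

-- Chains of layers

-- Colour i names the set {e ∣ mem i e ≡ true} of generators; two of these sets
-- share exactly one generator and three of them share none.
record Stars (k r : ℕ) : Set where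
  field
    mem   : Fin k → Fin r → Bool
    ln    : Fin k → Fin k → Fin r
    ln-∈ˡ : ∀ {i j} → i ≢ j → mem i (ln i j) ≡ true
    ln-∈ʳ : ∀ {i j} → i ≢ j → mem j (ln i j) ≡ true
    ln-!  : ∀ {i j e} → i ≢ j → mem i e ≡ true → mem j e ≡ true → e ≡ ln i j
    three : ∀ {i j l e} → i ≢ j → i ≢ l → j ≢ l →
            mem i e ≡ true → mem j e ≡ true → mem l e ≡ true → ⊥

not-false : ∀ {b} → (b ≡ true → ⊥) → b ≡ false
not-false {false} _ = refl
not-false {true}  p = ⊥-elim (p refl)

clash : ∀ {b} → b ≡ true → b ≡ false → ⊥
clash refl ()

does-true : ∀ {P : Set} (d : Dec P) → does d ≡ true → P
does-true (yes p) _ = p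

module Chains {k r : ℕ} (S : Stars k r) (m′ : ℕ) where

  open Stars S public
  open Actions r m′ public

  Over : Fin k → List E → Set
  Over i = All (λ e → mem i e ≡ true)

  -- Layer l of a chain is a copy of X on which only the generators of colour
  -- j l act; layers l and l + 1 are glued along D l.  Gluing is expressed by
  -- conjugation: a generator of colour j (l + 1) but not j l acts on the points
  -- of D l in layer l through the exchange of D l × {l} and D l × {l + 1}.
  module Chain {A : Set} (X : Action A) (j : ℕ → Fin k) (D : ℕ → A → Bool) where

    β : ℕ → E → Bool
    β l e = mem (j l) e

    switch : ℕ → E → A → Bool
    switch l e x = β (suc l) e ∧ not (β l e) ∧ D l x

    κ↓ : E → A → ℕ → A × ℕ
    κ↓ e x zero    = x , zero
    κ↓ e x (suc l) = if switch l e x then (x , l) else (x , suc l)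

    κ ρ chain-act : E → A × ℕ → A × ℕ
    κ e (x , l) = if switch l e x then (x , suc l) else κ↓ e x l
    ρ e (x , l) = if β l e then (act X e x , l) else (x , l)
    chain-act e y = κ e (ρ e (κ e y))

    -- The copy that represents the point `x` of a layer after gluing: a point glued to the layer
    -- below is represented there.
    real : ℕ → A → A × ℕ
    real zero    x = x , zero
    real (suc l) x = if D l x then (x , l) else (x , suc l)

    switch-true : ∀ {l e x} → switch l e x ≡ true → β (suc l) e ≡ true × β l e ≡ false × D l x ≡ true
    switch-true {l} {e} {x} p with β (suc l) e | β l e | D l x
    ... | true | false | true = refl , refl , refl

    switch-in : ∀ {l e x} → β (suc l) e ≡ true → β l e ≡ false → D l x ≡ true → switch l e x ≡ true
    switch-in p q s rewrite p | q | s = refl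

    switch-β : ∀ {l e x} → β l e ≡ true → switch l e x ≡ false
    switch-β {l} {e} p rewrite p = ∧-zeroʳ (β (suc l) e)

    switch-β⁺ : ∀ {l e x} → β (suc l) e ≡ false → switch l e x ≡ false
    switch-β⁺ p rewrite p = refl

    switch-D : ∀ {l e x} → D l x ≡ false → switch l e x ≡ false
    switch-D {l} {e} p rewrite p | ∧-zeroʳ (not (β l e)) = ∧-zeroʳ (β (suc l) e)

    κ-up : ∀ {l e x} → switch l e x ≡ true → κ e (x , l) ≡ (x , suc l)
    κ-up p rewrite p = refl

    κ-down : ∀ {l e x} → switch l e x ≡ true → κ e (x , suc l) ≡ (x , l)
    κ-down {l} {e} {x} p
      rewrite switch-β {suc l} {e} {x} (proj₁ (switch-true {l} p)) | p = refl

    κ-stay₀ : ∀ {e x} → switch 0 e x ≡ false → κ e (x , 0) ≡ (x , 0)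
    κ-stay₀ p rewrite p = refl

    κ-stay : ∀ {l e x} → switch (suc l) e x ≡ false → switch l e x ≡ false → κ e (x , suc l) ≡ (x , suc l)
    κ-stay p q rewrite p | q = refl

    ρ-in : ∀ {l e x} → β l e ≡ true → ρ e (x , l) ≡ (act X e x , l)
    ρ-in p rewrite p = refl

    ρ-out : ∀ {l e x} → β l e ≡ false → ρ e (x , l) ≡ (x , l)
    ρ-out p rewrite p = refl

    via : ∀ {e y z z′ u} → κ e y ≡ z → ρ e z ≡ z′ → κ e z′ ≡ u → chain-act e y ≡ u
    via {e} p q s = trans (cong (λ y → κ e (ρ e y)) p) (trans (cong (κ e) q) s)

    -- A generator exchanges a point with at most one neighbouring layer: going up from layer `l`
    -- needs `e` outside colour `j l`, going down needs it inside. As `κ` is an involution,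
    -- conjugating by it keeps the order of `ρ`.
    κ-invol : ∀ e y → κ e (κ e y) ≡ y
    κ-invol e (x , l) with switch l e x in p
    ... | true = κ-down p
    κ-invol e (x , zero) | false = κ-stay₀ p
    κ-invol e (x , suc l) | false with switch l e x in q
    ... | true  = κ-up q
    ... | false = κ-stay p q

    ρ-iter : ∀ s e x l → iter s (ρ e) (x , l) ≡ (if β l e then (iter s (act X e) x , l) else (x , l))
    ρ-iter zero e x l with β l e
    ... | true  = refl
    ... | false = refl
    ρ-iter (suc s) e x l with β l e in p
    ... | true  rewrite ρ-iter s e (act X e x) l | p = refl
    ... | false rewrite ρ-iter s e x l | p = refl

    ρ-order : ∀ e y → iter m (ρ e) y ≡ y
    ρ-order e (x , l) = trans (ρ-iter m e x l) helper
      where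
      helper : (if β l e then (iter m (act X e) x , l) else (x , l)) ≡ (x , l)
      helper with β l e
      ... | true  = cong (_, l) (order X e x)
      ... | false = refl

    chain-iter : ∀ s e y → iter s (chain-act e) y ≡ κ e (iter s (ρ e) (κ e y))
    chain-iter zero    e y = sym (κ-invol e y)
    chain-iter (suc s) e y = trans (chain-iter s e _)
      (cong (λ z → κ e (iter s (ρ e) z)) (κ-invol e (ρ e (κ e y))))

    chain : Action (A × ℕ)
    chain .act         = chain-act
    chain .order e y = trans (chain-iter m e y)
      (trans (cong (κ e) (ρ-order e (κ e y))) (κ-invol e y))

    -- By `closed`, gluing sets are unions of lines of the common generator. By `disj`, no point is
    -- glued both up and down, so one step finds its representative. By `uniq`, a line in any other
    -- direction meets a gluing set at most once; this keeps the components of a star from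
    -- branching.
    record Valid (N : ℕ) : Set where
      field
        closed  : ∀ l e x → β l e ≡ true → β (suc l) e ≡ true → D l (act X e x) ≡ D l x
        disj    : ∀ l x → D l x ≡ true → D (suc l) x ≡ false
        uniq    : ∀ l e s x → D l x ≡ true → D l (iter s (act X e) x) ≡ true →
                  ¬ (β l e ≡ true × β (suc l) e ≡ true) → iter s (act X e) x ≡ x
        colours : ∀ l x → D l x ≡ true → j l ≢ j (suc l)
        bounded : ∀ l x → D l x ≡ true → suc l < N

    module Walk {N : ℕ} (V : Valid N) where

      open Valid V

      disj′ : ∀ l x → D (suc l) x ≡ true → D l x ≡ false
      disj′ l x p = not-false λ q → clash p (disj l x q)

      pos : ∀ {l e x} → β l e ≡ true → (∀ {l′} → l ≡ suc l′ → switch l′ e x ≡ false) →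
            κ e (x , l) ≡ (x , l)
      pos {zero}  p q = κ-stay₀ (switch-β {0} p)
      pos {suc l} p q = κ-stay (switch-β {suc l} p) (q refl)

      low : ∀ {l e x} → D l x ≡ true → ∀ {l′} → l ≡ suc l′ → switch l′ e x ≡ false
      low d {l′} refl = switch-D {l′} (disj′ l′ _ d)

      real-up : ∀ l {x} → D l x ≡ true → real (suc l) x ≡ (x , l)
      real-up l d rewrite d = refl

      real-own : ∀ l {x} → D l x ≡ false → real (suc l) x ≡ (x , suc l)
      real-own l d rewrite d = refl

      landing : ∀ l {e} x → β (suc l) e ≡ true → β l e ≡ false → κ e (x , suc l) ≡ real (suc l) x
      landing l {e} x b c = go (D l x) refl
        where
        go : ∀ t → D l x ≡ t → κ e (x , suc l) ≡ real (suc l) x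
        go true  d = trans (κ-down (switch-in {l} b c d)) (sym (real-up l d))
        go false d = trans (κ-stay (switch-β {suc l} b) (switch-D {l} d)) (sym (real-own l d))

      -- For a point glued down, a common generator acts in the lower layer and `closed` keeps the
      -- point glued. A generator of the upper colour alone first lifts it to its own layer, acts
      -- there, and the second `κ` moves the result to its representative.
      act-real : ∀ l e x → β l e ≡ true → chain-act e (real l x) ≡ real l (act X e x)
      act-real zero e x b = via (κ-stay₀ (switch-β {0} b)) (ρ-in {0} b) (κ-stay₀ (switch-β {0} b))
      act-real (suc l) e x b = go (D l x) (β l e) refl refl
        where
        go : ∀ s t → D l x ≡ s → β l e ≡ t → chain-act e (real (suc l) x) ≡ real (suc l) (act X e x)
        go true true d c = trans (cong (chain-act e) (real-up l d))
          (trans (via (pos c (low d)) (ρ-in c) (pos c (low d′))) (sym (real-up l d′)))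
          where
          d′ = trans (closed l e x c b) d
        go true false d c = trans (cong (chain-act e) (real-up l d))
          (via (κ-up (switch-in b c d)) (ρ-in b) (landing l _ b c))
        go false true d c = trans (cong (chain-act e) (real-own l d))
          (trans (via (κ-stay (switch-β {suc l} b) (switch-D {l} d)) (ρ-in b)
                      (κ-stay (switch-β {suc l} b) (switch-β {l} c)))
                 (sym (real-own l (trans (closed l e x c b) d))))
        go false false d c = trans (cong (chain-act e) (real-own l d))
          (via (κ-stay (switch-β {suc l} b) (switch-D {l} d)) (ρ-in b) (landing l _ b c))

      run-real : ∀ l {w} x → Over (j l) w → run chain w (real l x) ≡ real l (run X w x)
      run-real l x []      = refl
      run-real l {e ∷ w} x (b ∷ ov) =
        trans (cong (run chain w) (act-real l e x b)) (run-real l (act X e x) ov)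

      real-stay : ∀ {l x} → (∀ {l′} → l ≡ suc l′ → D l′ x ≡ false) → real l x ≡ (x , l)
      real-stay {zero}  p = refl
      real-stay {suc l} p rewrite p refl = refl

      real-low : ∀ {l x} → D l x ≡ true → real l x ≡ (x , l)
      real-low {l} {x} d = real-stay {l} {x} λ { {l′} refl → disj′ l′ x d }

      act-inactive : ∀ {l e x} → (∀ {l′} → l ≡ suc l′ → D l′ x ≡ false) → β l e ≡ false →
                     (D l x ≡ true → β (suc l) e ≡ false) → chain-act e (x , l) ≡ (x , l)
      act-inactive {l} {e} {x} p b q = via stay (ρ-out b) stay
        where
        sw : switch l e x ≡ false
        sw with D l x in d
        ... | true  = trans (cong (λ c → c ∧ not (β l e) ∧ true) (q refl)) refl
        ... | false = trans (cong (β (suc l) e ∧_) (∧-zeroʳ (not (β l e)))) (∧-zeroʳ (β (suc l) e))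
        go : ∀ l → (∀ {l′} → l ≡ suc l′ → D l′ x ≡ false) → switch l e x ≡ false → κ e (x , l) ≡ (x , l)
        go zero    p s = κ-stay₀ s
        go (suc l) p s = κ-stay s (switch-D {l} (p refl))
        stay = go l p sw

      -- The upper copy of a glued point is left over. A generator of the upper colour alone carries
      -- it down, where that generator is idle, and back up; only the generator common to both
      -- colours moves it, along other such copies.
      act-upper : ∀ {l e x} → D l x ≡ true →
                  chain-act e (x , suc l) ≡ (x , suc l) ⊎
                  (β l e ≡ true × β (suc l) e ≡ true × chain-act e (x , suc l) ≡ (act X e x , suc l))
      act-upper {l} {e} {x} d = go (β l e) (β (suc l) e) refl refl
        where
        go : ∀ s t → β l e ≡ s → β (suc l) e ≡ t →
             chain-act e (x , suc l) ≡ (x , suc l) ⊎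
             (β l e ≡ true × β (suc l) e ≡ true × chain-act e (x , suc l) ≡ (act X e x , suc l))
        go true true b c = inj₂ (b , c , via (stay x) (ρ-in c) (stay _))
          where
          stay : ∀ x → κ e (x , suc l) ≡ (x , suc l)
          stay x = κ-stay (switch-β {suc l} c) (switch-β {l} b)
        go true false b c = inj₁ (via stay (ρ-out c) stay)
          where
          stay = κ-stay {l} {e} {x} (switch-D {suc l} (disj l x d)) (switch-β {l} b)
        go false true b c = inj₁ (via (κ-down sw) (ρ-out b) (κ-up sw))
          where
          sw = switch-in {l} {e} {x} c b d
        go false false b c = inj₁ (via stay (ρ-out c) stay)
          where
          stay = κ-stay {l} {e} {x} (switch-D {suc l} (disj l x d)) (switch-β⁺ {l} c)

-- Components of a chain under the generators of one star

module Components {k r : ℕ} (S : Stars k r) (m′ : ℕ) where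

  open Chains S m′ public

  transport-list : ∀ {M B} → DecidableEquality B → (Y : Action B) (γ : E → Bool) (xs : List B) →
                   length xs ≤ M → (∀ e → γ e ≡ true → ∀ {y} → y ∈ xs → act Y e y ∈ xs) →
                   ∀ {w} → All (λ e → γ e ≡ true) w → Universal M w →
                   ∀ {y} → y ∈ xs → run Y w y ≡ y
  transport-list {M} {B} _≟_ Y γ xs len closed {w} ov u {y} y∈ =
    subst (λ y → run Y w y ≡ y) (proj₂ (hit y∈))
      (Transport.transport _≟_ Y γ L closed′ ov u (proj₁ (hit y∈)))
    where
    L : Fin M → B
    L c with toℕ c <? length xs
    ... | yes p = lookup xs (fromℕ< p)
    -- Surplus indices repeat the base point, so the enumeration stays inside the list.
    ... | no  _ = y
    inside : ∀ c → L c ∈ xs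
    inside c with toℕ c <? length xs
    ... | yes p = ∈-lookup (fromℕ< p)
    ... | no  _ = y∈
    hit : ∀ {y′} → y′ ∈ xs → ∃ λ c → L c ≡ y′
    hit {y′} p = c , eq
      where
      i = index p
      i<M = ≤-trans (F.toℕ<n i) len
      c = fromℕ< i<M
      eq : L c ≡ y′
      eq with toℕ c <? length xs
      ... | yes q = trans (cong (lookup xs) (F.toℕ-injective (trans (F.toℕ-fromℕ< q) (F.toℕ-fromℕ< i<M))))
                          (sym (lookup-index p))
      ... | no ¬q = contradiction (subst (_< length xs) (sym (F.toℕ-fromℕ< i<M)) (F.toℕ<n i)) ¬q
    closed′ : ∀ e → γ e ≡ true → ∀ c → ∃ λ c′ → act Y e (L c) ≡ L c′
    closed′ e ge c with hit (closed e ge (inside c))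
    ... | c′ , p = c′ , sym p

  module Component {A : Set} (_≟_ : DecidableEquality A) (X : Action A) (j : ℕ → Fin k) (D : ℕ → A → Bool)
                   {N : ℕ} (V : Chain.Valid X j D N) (i : Fin k) where

    open Chain X j D
    open Valid V
    open Walk V

    -- For `i ≢ j l` this is the only generator of star `i` that acts on layer `l`, so the star
    -- moves points of that layer along lines.
    dir : ℕ → E
    dir l = ln i (j l)

    On : ℕ → A → A → Set
    On l = OnLine X (dir l)

    line : ℕ → A → List (A × ℕ)
    line l z = map (λ s → real l (iter s (act X (dir l)) z)) (upTo m)

    ∈-line : ∀ {l z z′} → On l z z′ → real l z′ ∈ line l z
    ∈-line {l} {z} o with line-bounded X o
    ... | s , s<m , refl = ∈-map⁺ (λ s → real l (iter s (act X (dir l)) z)) (∈-upTo⁺ s<m)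

    line-∈ : ∀ {l z y} → y ∈ line l z → ∃ λ z′ → On l z z′ × y ≡ real l z′
    line-∈ {l} {z} p with ∈-map⁻ (λ s → real l (iter s (act X (dir l)) z)) {xs = upTo m} p
    ... | s , _ , refl = iter s (act X (dir l)) z , (s , refl) , refl

    length-line : ∀ l z → length (line l z) ≡ m
    length-line l z = trans (length-map _ (upTo m)) (length-upTo m)

    -- The part of a component of the star-i generators in layers ≥ l: a line in
    -- layer l, continued in layer l + 1 if it meets D l.
    data Up : ℕ → A → Set where
      stop : ∀ {l z} → i ≢ j l → (∀ z′ → On l z z′ → D l z′ ≡ false) → Up l z
      step : ∀ {l z} → i ≢ j l → ∀ z′ → On l z z′ → D l z′ ≡ true → Up (suc l) z′ → Up l z

    other : ∀ {l z} → Up l z → i ≢ j l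
    other (stop p _)       = p
    other (step p _ _ _ _) = p

    nodes : ∀ {l z} → Up l z → List (A × ℕ)
    nodes {l} {z} (stop _ _)       = line l z
    nodes {l} {z} (step _ _ _ _ u) = line l z ++ nodes u

    line⊆ : ∀ {l z y} (u : Up l z) → y ∈ line l z → y ∈ nodes u
    line⊆ (stop _ _)       p = p
    line⊆ (step _ _ _ _ _) p = ∈-++⁺ˡ p

    length-nodes : ∀ {l z} (u : Up l z) → length (nodes u) ≤ m * suc (N ∸ l)
    length-nodes {l} {z} (stop _ _) = ≤-trans (≤-reflexive (length-line l z))
      (≤-trans (≤-reflexive (sym (ℕ.*-identityʳ m))) (ℕ.*-monoʳ-≤ m (s≤s z≤n)))
    length-nodes {l} {z} (step _ z′ _ d u) =
      ≤-trans (≤-reflexive (trans (length-++ (line l z) {nodes u}) (cong (_+ length (nodes u)) (length-line l z))))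
        (≤-trans (ℕ.+-monoʳ-≤ m (length-nodes u))
          (≤-reflexive (trans (sym (ℕ.*-suc m (suc (N ∸ suc l))))
            (cong (λ t → m * suc t) (suc∸ (ℕ.<⇒≤ (bounded l z′ d)))))))
      where
      suc∸ : ∀ {a b} → suc b ≤ a → suc (a ∸ suc b) ≡ a ∸ b
      suc∸ (s≤s p) = sym (ℕ.+-∸-assoc 1 p)

    closed-line : ∀ {l z z′} → i ≢ j l → i ≡ j (suc l) → On l z z′ → D l z′ ≡ D l z
    closed-line {l} {z} p q (s , refl) = go s z
      where
      go : ∀ s z → D l (iter s (act X (dir l)) z) ≡ D l z
      go zero    z = refl
      go (suc s) z = trans (go s _) (closed l (dir l) z (ln-∈ʳ p)
        (subst (λ c → mem c (dir l) ≡ true) q (ln-∈ˡ p)))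

    closed-line↓ : ∀ {l z z′} → i ≢ j (suc l) → i ≡ j l → On (suc l) z z′ → D l z′ ≡ D l z
    closed-line↓ {l} {z} p q (s , refl) = go s z
      where
      go : ∀ s z → D l (iter s (act X (dir (suc l))) z) ≡ D l z
      go zero    z = refl
      go (suc s) z = trans (go s _) (closed l (dir (suc l)) z
        (subst (λ c → mem c (dir (suc l)) ≡ true) q (ln-∈ˡ p)) (ln-∈ʳ p))

    search : ∀ (D : A → Bool) l z → (∃ λ z′ → On l z z′ × D z′ ≡ true) ⊎ (∀ z′ → On l z z′ → D z′ ≡ false)
    search D l z with any? {n = m} (λ s → D (iter (toℕ s) (act X (dir l)) z) Data.Bool.Properties.≟ true)
      where import Data.Bool.Properties
    ... | yes (s , p) = inj₁ (_ , (toℕ s , refl) , p)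
    ... | no ¬p = inj₂ λ z′ o → not-false λ d → case line-bounded X o of λ where
      (s , s<m , refl) → ¬p (fromℕ< s<m , trans (cong (λ t → D (iter t (act X (dir l)) z)) (F.toℕ-fromℕ< s<m)) d)

    mkUp : ∀ fuel l z → N ≤ l + fuel → i ≢ j l → (i ≡ j (suc l) → D l z ≡ false) → Up l z
    mkUp zero l z le p q = stop p λ z′ _ → not-false λ d →
      ℕ.<-irrefl refl (≤-trans (ℕ.<⇒≤ (bounded l z′ d)) (≤-trans le (≤-reflexive (ℕ.+-identityʳ l))))
    mkUp (suc fuel) l z le p q with search (D l) l z
    ... | inj₂ none = stop p none
    ... | inj₁ (z′ , o , d) = step p z′ o d
          (mkUp fuel (suc l) z′ (≤-trans le (≤-reflexive (ℕ.+-suc l fuel)))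
            -- If `i` were the next colour, `dir l` would be common to both colours and `D l`
            -- constant along the line, against the premise on `z`.
            (λ r → clash (trans (sym (closed-line p r o)) d) (q r)) (λ _ → disj l z′ d))

    -- `step` wants the upper line listed from the glued point, but when a path is extended
    -- downwards that point is found only after the upper line has been built.
    rebase : ∀ {l z z′} (u : Up l z) → On l z z′ → ∃ λ (u′ : Up l z′) → ∀ {y} → y ∈ nodes u → y ∈ nodes u′
    rebase {l} {z} {z′} u o = go u
      where
      line⊆′ : ∀ {y} → y ∈ line l z → y ∈ line l z′
      line⊆′ p with line-∈ {l} {z} p
      ... | z″ , o″ , refl = ∈-line {l} {z′} (line-trans X (line-sym X o) o″)
      go : (u : Up l z) → ∃ λ (u′ : Up l z′) → ∀ {y} → y ∈ nodes u → y ∈ nodes u′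
      go (stop p none) = stop p (λ z″ o″ → none z″ (line-trans X o o″)) , line⊆′
      go (step p z″ o″ d u) = step p z″ (line-trans X (line-sym X o) o″) d u , λ q →
        [ (λ r → ∈-++⁺ˡ (line⊆′ r)) , ∈-++⁺ʳ (line l z′) ]′ (∈-++⁻ (line l z) q)

    Bottom : ℕ → A → Set
    Bottom l z = ∀ {l′} → l ≡ suc l′ → ∀ z′ → On l z z′ → D l′ z′ ≡ false

    goDown : ∀ l z (u : Up l z) → (∀ {l′} → l ≡ suc l′ → D l′ z ≡ false) →
             ∃ λ l₀ → ∃ λ z₀ → ∃ λ (u₀ : Up l₀ z₀) → Bottom l₀ z₀ × (∀ {y} → y ∈ nodes u → y ∈ nodes u₀)
    goDown zero z u _ = zero , z , u , (λ ()) , id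
    goDown (suc l) z u q with search (D l) (suc l) z
    ... | inj₂ none = suc l , z , u , (λ { refl → none }) , id
    ... | inj₁ (z′ , o , d) with rebase u o
    ...   | u′ , sub with goDown l z′ (step (λ r → clash (trans (sym (closed-line↓ (other u) r o)) d) (q refl))
                                           z′ (line-refl X) d u′) (λ { {l′} refl → disj′ l′ z′ d })
    ...     | l₀ , z₀ , u₀ , bot , sub′ = l₀ , z₀ , u₀ , bot , λ p → sub′ (∈-++⁺ʳ (line l z′) (sub p))

    meet : ∀ {l z z₁ z₂ e} → D l z₁ ≡ true → D l z₂ ≡ true → ¬ (β l e ≡ true × β (suc l) e ≡ true) →
           OnLine X e z z₁ → OnLine X e z z₂ → z₂ ≡ z₁
    meet {l} {e = e} d₁ d₂ ¬b o₁ o₂ with line-trans X (line-sym X o₁) o₂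
    ... | s , refl = uniq l e s _ d₁ d₂ ¬b

    -- `P` stays fixed while the recursion climbs, so that closure is shown for the whole path at
    -- once. Star `i` moves along the line by `dir l` and can leave it upwards only at the glued
    -- point, which `meet` makes unique; leaving downwards is delegated to `down`.
    closedUp : ∀ {l z} (u : Up l z) (P : A × ℕ → Set) → (∀ {y} → y ∈ nodes u → P y) →
               (∀ {l′} → l ≡ suc l′ → ∀ z′ → On l z z′ → D l′ z′ ≡ true → ∀ e → mem i e ≡ true →
                 P (chain-act e (real l z′))) →
               ∀ {y} → y ∈ nodes u → ∀ e → mem i e ≡ true → P (chain-act e y)
    closedUp {l} {z} u P all down {y} y∈ e γe = main u refl y∈
      where
      Exit : Set
      Exit = ∀ z′ → On l z z′ → D l z′ ≡ true → ∀ e → mem i e ≡ true → β l e ≡ false → P (chain-act e (z′ , l))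

      onLine : Exit → ∀ z′ → On l z z′ → ∀ e → mem i e ≡ true → P (chain-act e (real l z′))
      onLine exit z′ o e γe = go (β l e) refl
        where
        lowest : Bool → Set
        lowest b = ∀ {l′} → l ≡ suc l′ → D l′ z′ ≡ b
        inner : β l e ≡ false → lowest false → P (chain-act e (real l z′))
        inner b low = subst (λ y → P (chain-act e y)) (sym (real-stay low)) (go (D l z′) refl)
          where
          go : ∀ t → D l z′ ≡ t → P (chain-act e (z′ , l))
          go true  d = exit z′ o d e γe b
          go false d = subst P (sym (act-inactive low b (λ d′ → ⊥-elim (clash d′ d))))
                         (subst P (real-stay low) (all (line⊆ u (∈-line {l} {z} o))))
        below : ∀ l′ → l ≡ suc l′ → β l e ≡ false → ∀ t → D l′ z′ ≡ t → P (chain-act e (real l z′))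
        below l′ q b true  d = down q z′ o d e γe
        below l′ q b false d = inner b λ q′ → trans (cong (λ t → D t z′) (ℕ.suc-injective (trans (sym q′) q))) d
        split : ∀ t → l ≡ t → β l e ≡ false → P (chain-act e (real l z′))
        split zero     q b = inner b λ q′ → contradiction (trans (sym q) q′) λ ()
        split (suc l′) q b = below l′ q b (D l′ z′) refl
        go : ∀ t → β l e ≡ t → P (chain-act e (real l z′))
        go true b = subst P (sym (act-real l e z′ b))
          (all (line⊆ u (∈-line {l} {z} (subst (λ g → On l z (act X g z′)) (sym (ln-! (other u) γe b)) (line-step X o)))))
        go false b = split l refl b

      main : (u′ : Up l z) → u ≡ u′ → y ∈ nodes u′ → P (chain-act e y)
      main (stop p none) eq q with line-∈ {l} {z} q
      ... | z′ , o , refl = onLine (λ z″ o″ d → ⊥-elim (clash d (none z″ o″))) z′ o e γe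
      main (step p z₁ o₁ d₁ u₁) refl q = [ first , rest ]′ (∈-++⁻ (line l z) q)
        where
        -- The colours `i`, `j l` and `j (suc l)` are distinct, and three stars share no generator;
        -- so `uniq` applies to `dir l`.
        notBoth : ¬ (β l (dir l) ≡ true × β (suc l) (dir l) ≡ true)
        notBoth (b , c) = three p (other u₁) (colours l z₁ d₁) (ln-∈ˡ p) b c
        notBoth⁺ : ¬ (β l (dir (suc l)) ≡ true × β (suc l) (dir (suc l)) ≡ true)
        notBoth⁺ (b , c) = three p (other u₁) (colours l z₁ d₁) (ln-∈ˡ (other u₁)) b c
        exit : Exit
        exit z′ o d e γe b = subst (λ x → P (chain-act e (x , l))) (sym (meet {l} d₁ d notBoth o₁ o)) (go (β (suc l) e) refl)
          where
          go : ∀ t → β (suc l) e ≡ t → P (chain-act e (z₁ , l))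
          go true c = subst P (sym (trans (cong (chain-act e) (sym (real-up l d₁))) (act-real (suc l) e z₁ c)))
            (all (∈-++⁺ʳ (line l z) (line⊆ u₁ (∈-line {suc l} {z₁}
              (subst (λ g → On (suc l) z₁ (act X g z₁)) (sym (ln-! (other u₁) γe c)) (line-step X (line-refl X)))))))
          go false c = subst P (sym (act-inactive (λ { {l′} refl → disj′ l′ z₁ d₁ }) b (λ _ → c)))
            (subst P (real-low d₁) (all (line⊆ u (∈-line {l} {z} o₁))))
        first : y ∈ line l z → P (chain-act e y)
        first q with line-∈ {l} {z} q
        ... | z′ , o , refl = onLine exit z′ o e γe
        rest : y ∈ nodes u₁ → P (chain-act e y)
        rest q = closedUp u₁ P (λ r → all (∈-++⁺ʳ (line l z) r)) down₁ q e γe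
          where
          down₁ : ∀ {l′} → suc l ≡ suc l′ → ∀ z′ → On (suc l) z₁ z′ → D l′ z′ ≡ true → ∀ e → mem i e ≡ true →
                  P (chain-act e (real (suc l) z′))
          down₁ refl z′ o d e γe = subst (λ x → P (chain-act e x))
            (trans (real-low d₁) (trans (sym (real-up l d₁)) (cong (real (suc l)) (sym (meet {l} d₁ d notBoth⁺ (line-refl X) o)))))
            (onLine exit z₁ o₁ e γe)

    -- A component of the star-i generators is contained in a layer of colour i,
    -- or in the upper copy of a glued line, or it is a path of lines.
    star-trivial : ∀ {M w} → m * suc N ≤ M → Over i w → Universal M w → Trivial X w → Trivial chain w
    star-trivial {M} {w} le ov u tr .fixes (x , a) = layer a refl
      where
      dec = ≡-dec _≟_ ℕ._≟_

      inside : ∀ l → i ≡ j l → run chain w (real l x) ≡ real l x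
      inside l q = trans (run-real l x (subst (λ c → Over c w) q ov)) (cong (real l) (fixes tr x))

      path : i ≢ j a → (i ≡ j (suc a) → D a x ≡ false) → (∀ {l′} → a ≡ suc l′ → D l′ x ≡ false) →
             run chain w (x , a) ≡ (x , a)
      path p q low with mkUp N a x (ℕ.m≤n+m N a) p q
      ... | u₁ with goDown a x u₁ low
      ...   | l₀ , z₀ , u₀ , bot , sub = transport-list dec chain (mem i) (nodes u₀)
              (≤-trans (length-nodes u₀) (≤-trans (ℕ.*-monoʳ-≤ m (s≤s (ℕ.m∸n≤m N l₀))) le))
              (λ e γe y∈ → closedUp u₀ (_∈ nodes u₀) id
                (λ q′ z′ o d → ⊥-elim (clash d (bot q′ z′ o))) y∈ e γe)
              ov u
              (sub (line⊆ u₁ (subst (_∈ line a x) (real-stay low) (∈-line {a} {x} (line-refl X)))))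

      realCase : (∀ {l′} → a ≡ suc l′ → D l′ x ≡ false) → run chain w (x , a) ≡ (x , a)
      realCase low with i F.≟ j a
      ... | yes q = subst (λ y → run chain w y ≡ y) (real-stay low) (inside a q)
      ... | no  p with i F.≟ j (suc a)
      ...   | no  q = path p (λ r → contradiction r q) low
      ...   | yes q = go (D a x) refl
        where
        go : ∀ t → D a x ≡ t → run chain w (x , a) ≡ (x , a)
        go true  d = subst (λ y → run chain w y ≡ y) (real-up a d) (inside (suc a) q)
        go false d = path p (λ _ → d) low

      -- A left-over copy stays on one line of the generator `f` common to the two layers, by
      -- `act-upper`.
      upper : ∀ a′ → D a′ x ≡ true → run chain w (x , suc a′) ≡ (x , suc a′)
      upper a′ d = transport-list dec chain (mem i) xs
          (≤-trans (≤-reflexive (trans (length-map _ (upTo m)) (length-upTo m)))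
            (≤-trans (≤-trans (≤-reflexive (sym (ℕ.*-identityʳ m))) (ℕ.*-monoʳ-≤ m (s≤s z≤n))) le))
          closed′ ov u (∈xs (line-refl X))
        where
        f = ln (j a′) (j (suc a′))
        xs = map (λ s → iter s (act X f) x , suc a′) (upTo m)
        ∈xs : ∀ {z} → OnLine X f x z → (z , suc a′) ∈ xs
        ∈xs o with line-bounded X o
        ... | s , s<m , refl = ∈-map⁺ (λ s → iter s (act X f) x , suc a′) (∈-upTo⁺ s<m)
        ne = colours a′ x d
        stays : ∀ s z → D a′ z ≡ true → D a′ (iter s (act X f) z) ≡ true
        stays zero    z d = d
        stays (suc s) z d = stays s _ (trans (closed a′ f z (ln-∈ˡ ne) (ln-∈ʳ ne)) d)
        closed′ : ∀ e → mem i e ≡ true → ∀ {y} → y ∈ xs → chain-act e y ∈ xs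
        closed′ e _ y∈ with ∈-map⁻ (λ s → iter s (act X f) x , suc a′) {xs = upTo m} y∈
        ... | s , s∈ , refl with act-upper {a′} {e} (stays s x d)
        ...   | inj₁ p = subst (_∈ xs) (sym p) y∈
        ...   | inj₂ (b , c , p) = subst (_∈ xs) (sym p)
                  (∈xs (subst (λ g → OnLine X f x (act X g (iter s (act X f) x))) (sym (ln-! ne b c)) (line-step X (s , refl))))

      layer : ∀ t → a ≡ t → run chain w (x , a) ≡ (x , a)
      layer zero     refl = realCase λ ()
      layer (suc a′) refl = go (D a′ x) refl
        where
        go : ∀ t → D a′ x ≡ t → run chain w (x , suc a′) ≡ (x , suc a′)
        go true  d = upper a′ d
        go false d = realCase λ { refl → d }

-- Sums and restrictions of actions on finite sets

module Constructions (r m′ : ℕ) where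

  open Actions r m′

  fixed : (A : Set) → Action A
  fixed A .act     _ x = x
  fixed A .order e x = iter-fixed (λ y → y) m refl

  module Coded {A B : Set} (dec : B → A) (enc : A → B) (dec-enc : ∀ x → dec (enc x) ≡ x)
               (enc-dec : ∀ y → enc (dec y) ≡ y) (X : Action A) where

    step : E → B → B
    step e y = enc (act X e (dec y))

    dec-iter : ∀ s e y → dec (iter s (step e) y) ≡ iter s (act X e) (dec y)
    dec-iter zero    e y = refl
    dec-iter (suc s) e y = trans (dec-iter s e (step e y)) (cong (iter s (act X e)) (dec-enc _))

    dec-injective : ∀ {y y′} → dec y ≡ dec y′ → y ≡ y′
    dec-injective p = trans (sym (enc-dec _)) (trans (cong enc p) (enc-dec _))

    coded : Action B
    coded .act       = step
    coded .order e y = dec-injective (trans (dec-iter m e y) (order X e (dec y)))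

    dec-run : ∀ w y → dec (run coded w y) ≡ run X w (dec y)
    dec-run []      y = refl
    dec-run (e ∷ w) y = trans (dec-run w (step e y)) (cong (run X w) (dec-enc _))

    coded-trivial : ∀ {w} → Trivial X w → Trivial coded w
    coded-trivial {w} t .fixes y = dec-injective (trans (dec-run w y) (fixes t (dec y)))

    trivial-coded : ∀ {w} → Trivial coded w → Trivial X w
    trivial-coded {w} t .fixes x = subst (λ x → run X w x ≡ x) (dec-enc x)
      (trans (sym (dec-run w (enc x))) (cong dec (fixes t (enc x))))

  fibred : {I A : Set} → (I → Action A) → Action (I × A)
  fibred X .act   e (s , i) = s , act (X s) e i
  fibred X .order e (s , i) = trans (iterate m i) (cong (s ,_) (order (X s) e i))
    where
    iterate : ∀ t i → iter t (act (fibred X) e) (s , i) ≡ (s , iter t (act (X s) e) i)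
    iterate zero    i = refl
    iterate (suc t) i = iterate t (act (X s) e i)

  fibred-run : ∀ {I A : Set} (X : I → Action A) w s i → run (fibred X) w (s , i) ≡ (s , run (X s) w i)
  fibred-run X []      s i = refl
  fibred-run X (e ∷ w) s i = fibred-run X w s (act (X s) e i)

  sum : {A B : Set} → Action A → Action B → Action (A ⊎ B)
  sum X Y .act e = Sum.map (act X e) (act Y e)
  sum X Y .order e (inj₁ x) = trans (iterate m x) (cong inj₁ (order X e x))
    where
    iterate : ∀ t x → iter t (act (sum X Y) e) (inj₁ x) ≡ inj₁ (iter t (act X e) x)
    iterate zero    x = refl
    iterate (suc t) x = iterate t (act X e x)
  sum X Y .order e (inj₂ y) = trans (iterate m y) (cong inj₂ (order Y e y))
    where
    iterate : ∀ t y → iter t (act (sum X Y) e) (inj₂ y) ≡ inj₂ (iter t (act Y e) y)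
    iterate zero    y = refl
    iterate (suc t) y = iterate t (act Y e y)

  module _ {A B : Set} (X : Action A) (Y : Action B) where

    sum-run₁ : ∀ w x → run (sum X Y) w (inj₁ x) ≡ inj₁ (run X w x)
    sum-run₁ []      x = refl
    sum-run₁ (e ∷ w) x = sum-run₁ w (act X e x)

    sum-run₂ : ∀ w y → run (sum X Y) w (inj₂ y) ≡ inj₂ (run Y w y)
    sum-run₂ []      y = refl
    sum-run₂ (e ∷ w) y = sum-run₂ w (act Y e y)

  family : ∀ {c n} → (Fin c → Action (Fin n)) → Action (Fin (c * n))
  family {c} {n} X = Coded.coded (remQuot {c} n) (λ z → combine (proj₁ z) (proj₂ z))
    (λ z → remQuot-combine (proj₁ z) (proj₂ z)) (combine-remQuot {c} n) (fibred X)

  module _ {c n : ℕ} (X : Fin c → Action (Fin n)) where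

    private module C = Coded (remQuot {c} n) (λ z → combine (proj₁ z) (proj₂ z))
                         (λ z → remQuot-combine (proj₁ z) (proj₂ z)) (combine-remQuot {c} n) (fibred X)

    family-trivial : ∀ {w} → (∀ s → Trivial (X s) w) → Trivial (family X) w
    family-trivial {w} t = C.coded-trivial (trivial λ (s , i) → trans (fibred-run X w s i) (cong (s ,_) (fixes (t s) i)))

    family-member : ∀ {w} → Trivial (family X) w → ∀ s → Trivial (X s) w
    family-member {w} t s .fixes i = cong proj₂ (trans (sym (fibred-run X w s i)) (fixes (C.trivial-coded t) (s , i)))

  family₃ : ∀ {a b c n} → (Fin a → Fin b → Fin c → Action (Fin n)) → Action (Fin (a * (b * (c * n))))
  family₃ X = family λ x → family λ y → family λ z → X x y z

  module _ {a b c n : ℕ} (X : Fin a → Fin b → Fin c → Action (Fin n)) where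

    family₃-trivial : ∀ {w} → (∀ x y z → Trivial (X x y z) w) → Trivial (family₃ X) w
    family₃-trivial t = family-trivial _ λ x → family-trivial _ λ y → family-trivial _ λ z → t x y z

    family₃-member : ∀ {w} → Trivial (family₃ X) w → ∀ x y z → Trivial (X x y z) w
    family₃-member t x y z = family-member _ (family-member _ (family-member _ t x) y) z

  infixr 5 _⊕_
  _⊕_ : ∀ {a b} → Action (Fin a) → Action (Fin b) → Action (Fin (a + b))
  _⊕_ {a} {b} X Y = Coded.coded (splitAt a) (join a b) (splitAt-join a b) (join-splitAt a b) (sum X Y)

  module _ {a b : ℕ} (X : Action (Fin a)) (Y : Action (Fin b)) where

    private module C = Coded (splitAt a) (join a b) (splitAt-join a b) (join-splitAt a b) (sum X Y)

    ⊕-trivial : ∀ {w} → Trivial X w → Trivial Y w → Trivial (X ⊕ Y) w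
    ⊕-trivial {w} t u = C.coded-trivial (trivial λ where
      (inj₁ x) → trans (sum-run₁ X Y w x) (cong inj₁ (fixes t x))
      (inj₂ y) → trans (sum-run₂ X Y w y) (cong inj₂ (fixes u y)))

    ⊕-left : ∀ {w} → Trivial (X ⊕ Y) w → Trivial X w
    ⊕-left {w} t .fixes x = inj₁-injective (trans (sym (sum-run₁ X Y w x)) (fixes (C.trivial-coded t) (inj₁ x)))

    ⊕-right : ∀ {w} → Trivial (X ⊕ Y) w → Trivial Y w
    ⊕-right {w} t .fixes y = inj₂-injective (trans (sym (sum-run₂ X Y w y)) (fixes (C.trivial-coded t) (inj₂ y)))

  clamp : ∀ {N} → ℕ → Fin (suc N)
  clamp {N} l with l <? suc N
  ... | yes p = fromℕ< p
  ... | no  _ = zero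

  toℕ-clamp : ∀ {N l} → l < suc N → toℕ (clamp {N} l) ≡ l
  toℕ-clamp {N} {l} q with l <? suc N
  ... | yes p = F.toℕ-fromℕ< p
  ... | no ¬p = contradiction q ¬p

  clamp-toℕ : ∀ {N} (l : Fin (suc N)) → clamp (toℕ l) ≡ l
  clamp-toℕ l = F.toℕ-injective (toℕ-clamp (F.toℕ<n l))

  -- A valid chain glues only finitely many layers, so an initial segment of them is invariant;
  -- cutting off the rest makes the set finite.
  module Layers {a N : ℕ} (C : Action (Fin a × ℕ))
                (stable : ∀ e x l → l < suc N → proj₂ (act C e (x , l)) < suc N) where

    emb : Fin (a * suc N) → Fin a × ℕ
    emb z = let x , l = remQuot {a} (suc N) z in x , toℕ l

    unemb : Fin a × ℕ → Fin (a * suc N)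
    unemb (x , l) = combine x (clamp {N} l)

    emb-unemb : ∀ y → proj₂ y < suc N → emb (unemb y) ≡ y
    emb-unemb (x , l) p = trans (cong (λ u → proj₁ u , toℕ (proj₂ u)) (remQuot-combine {a} {suc N} x (clamp l)))
                                (cong (x ,_) (toℕ-clamp p))

    unemb-emb : ∀ z → unemb (emb z) ≡ z
    unemb-emb z = trans (cong (combine (proj₁ (remQuot {a} (suc N) z))) (clamp-toℕ (proj₂ (remQuot {a} (suc N) z)))) (combine-remQuot {a} (suc N) z)

    step : E → Fin (a * suc N) → Fin (a * suc N)
    step e z = unemb (act C e (emb z))

    emb-step : ∀ e z → emb (step e z) ≡ act C e (emb z)
    emb-step e z = emb-unemb _ (stable e _ _ (F.toℕ<n (proj₂ (remQuot {a} (suc N) z))))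

    emb-iter : ∀ s e z → emb (iter s (step e) z) ≡ iter s (act C e) (emb z)
    emb-iter zero    e z = refl
    emb-iter (suc s) e z = trans (emb-iter s e (step e z)) (cong (iter s (act C e)) (emb-step e z))

    emb-injective : ∀ {z z′} → emb z ≡ emb z′ → z ≡ z′
    emb-injective {z} {z′} p = trans (sym (unemb-emb z)) (trans (cong unemb p) (unemb-emb z′))

    layered : Action (Fin (a * suc N))
    layered .act       = step
    layered .order e z = emb-injective (trans (emb-iter m e z) (order C e (emb z)))

    emb-run : ∀ w z → emb (run layered w z) ≡ run C w (emb z)
    emb-run []      z = refl
    emb-run (e ∷ w) z = trans (emb-run w (step e z)) (cong (run C w) (emb-step e z))

    layered-trivial : ∀ {w} → Trivial C w → Trivial layered w
    layered-trivial {w} t .fixes z = emb-injective (trans (emb-run w z) (fixes t (emb z)))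

    trivial-layered : ∀ {w} → Trivial layered w → ∀ x l → l < suc N → run C w (x , l) ≡ (x , l)
    trivial-layered {w} t x l p = subst (λ y → run C w y ≡ y) (emb-unemb (x , l) p)
      (trans (sym (emb-run w (unemb (x , l)))) (cong emb (fixes t _)))

  rotate : Fin m → Fin m
  rotate c = fromℕ< (m%n<n (suc (toℕ c)) m)

  rotate-iter : ∀ s c → toℕ (iter s rotate c) ≡ (toℕ c + s) % m
  rotate-iter zero c = sym (trans (cong (_% m) (ℕ.+-identityʳ (toℕ c))) (m<n⇒m%n≡m (F.toℕ<n c)))
  rotate-iter (suc s) c = trans (rotate-iter s (rotate c))
    (trans (cong (λ t → (t + s) % m) (F.toℕ-fromℕ< (m%n<n (suc (toℕ c)) m)))
      (trans (%-distribˡ-+ (suc (toℕ c) % m) s m)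
        (trans (cong (λ t → (t + s % m) % m) (m%n%n≡m%n (suc (toℕ c)) m))
          (trans (sym (%-distribˡ-+ (suc (toℕ c)) s m)) (cong (_% m) (sym (ℕ.+-suc (toℕ c) s)))))))

  rotate-order : ∀ c → iter m rotate c ≡ c
  rotate-order c = F.toℕ-injective
    (trans (rotate-iter m c) (trans ([m+n]%n≡m%n (toℕ c) m) (m<n⇒m%n≡m (F.toℕ<n c))))

  -- Measures the exponent sum of `e` in a word modulo `m`.
  cyclic : E → Action (Fin m)
  cyclic e .act e′ c = if does (e′ F.≟ e) then rotate c else c
  cyclic e .order e′ c = helper (e′ F.≟ e)
    where
    helper : (d : Dec (e′ ≡ e)) → iter m (λ c → if does d then rotate c else c) c ≡ c
    helper (yes _) = rotate-order c
    helper (no _)  = iter-fixed (λ c → c) m refl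

  cyclic-self : ∀ e c → act (cyclic e) e c ≡ rotate c
  cyclic-self e c rewrite dec-true (e F.≟ e) refl = refl

  cyclic-other : ∀ {e e′} → e′ ≢ e → ∀ c → act (cyclic e) e′ c ≡ c
  cyclic-other {e} {e′} p c rewrite dec-false (e′ F.≟ e) p = refl

-- The finite family of all chains

module Base {k r : ℕ} (S : Stars k r) (m′ N M : ℕ) (len : suc m′ * suc (suc N) ≤ M) where

  open Components S m′ public
  open Constructions r m′ public

  -- Also the bound in `Valid`: a path of lines has at most `m * suc levels` points, which is the
  -- left side of `len`.
  levels : ℕ
  levels = suc N

  m≤M : m ≤ M
  m≤M = ≤-trans (≤-reflexive (sym (ℕ.*-identityʳ m))) (≤-trans (ℕ.*-monoʳ-≤ m (s≤s z≤n)) len)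

  universal-small : ∀ {n w} → n ≤ M → (Y : Action (Fin n)) → Universal M w → Trivial Y w
  universal-small {n} {w} le Y u .fixes x = transport-list F._≟_ Y (λ _ → true) (allFin n)
    (≤-trans (≤-reflexive (length-tabulate {n = n} id)) le) (λ _ _ _ → ∈-allFin _)
    (All.universal (λ _ → refl) w) u (∈-allFin x)

  run-fixed : ∀ {A} (X : Action A) {w} → All (λ e → ∀ x → act X e x ≡ x) w → Trivial X w
  run-fixed X []               .fixes x = refl
  run-fixed X {_ ∷ w} (p ∷ ps) .fixes x = trans (cong (run X w) (p x)) (fixes (run-fixed X ps) x)

  -- The word holds in `cyclic e`, where only its middle part moves anything; hence `m` divides `s`.
  independent : ∀ {e u v} s → All (_≢ e) u → All (_≢ e) v → Universal M (u ++ replicate s e ++ v) →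
                ∀ {A} (X : Action A) x → iter s (act X e) x ≡ x
  independent {e} {u} {v} s pu pv univ X x =
    trans (cong (λ t → iter t (act X e) x) (m≡m%n+[m/n]*n s m))
      (trans (cong (λ t → iter (t + s / m * m) (act X e) x) s%m≡0) (iter-* (act X e) (s / m) m (order X e x)))
    where
    C = cyclic e
    s%m≡0 : s % m ≡ 0
    s%m≡0 = trans (sym (rotate-iter s zero)) (cong toℕ (trans (sym (iter-cong (cyclic-self e) s zero))
      (trans (sym (run-replicate C s e zero))
      (trans (sym (fixes (run-fixed C (All.map cyclic-other pv)) _))
      (trans (sym (run-++ C (replicate s e) v zero))
      (trans (cong (run C (replicate s e ++ v)) (sym (fixes (run-fixed C (All.map cyclic-other pu)) zero)))
      (trans (sym (run-++ C u (replicate s e ++ v) zero)) (fixes (universal-small m≤M C univ) zero))))))))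

  -- Good points behave like group elements under multiplication: a word fixing one of them is a
  -- relation of the whole action.
  module Gluing {a : ℕ} (X : Action (Fin a)) (Good : Fin a → Set) (good? : ∀ x → Dec (Good x))
                (good-universal : ∀ w {x} → Good x → run X w x ≡ x → Universal M w)
                (universal-trivial : ∀ {w} → Universal M w → Trivial X w) where

    module Datum (P : ℕ) (c : Fin levels → Fin k) (d : Fin levels → Fin a) where

      -- Outside the range `clamp` falls back to index 0. For `P ≤ levels` the condition `suc l < P`
      -- in `Glue` ensures that nothing is glued there.
      j : ℕ → Fin k
      j l = c (clamp l)

      δ : ℕ → Fin a
      δ l = d (clamp l)

      f : ℕ → E
      f l = ln (j l) (j (suc l))

      Glue : ℕ → Fin a → Set
      Glue l x = suc l < P × OnLine X (f l) (δ l) x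

      abstract
        glue? : ∀ l x → Dec (Glue l x)
        glue? l x = (suc l <? P) ×-dec line? X F._≟_ (f l) (δ l) x

      D : ℕ → Fin a → Bool
      D l x = does (glue? l x)

      D-true : ∀ l x → D l x ≡ true → Glue l x
      D-true l x = does-true (glue? l x)

      Coherent : Set
      Coherent = ∀ (l : Fin levels) → suc (toℕ l) < P →
        (Good (δ (toℕ l)) × ¬ (j (toℕ l) ≡ j (suc (toℕ l)))) ×
        (∀ x → ¬ (Glue (toℕ l) x × Glue (suc (toℕ l)) x))

      abstract
        coherent? : Dec Coherent
        coherent? = all? λ l → (suc (toℕ l) <? P) →-dec
         ((good? (δ (toℕ l)) ×-dec ¬? (j (toℕ l) F.≟ j (suc (toℕ l)))) ×-dec
          all? (λ x → ¬? (glue? (toℕ l) x ×-dec glue? (suc (toℕ l)) x)))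

      open Chain X j D

      module _ (P≤ : P ≤ levels) (coh : Coherent) where

        at : ∀ l → suc l < P → (Good (δ l) × j l ≢ j (suc l)) × (∀ x → ¬ (Glue l x × Glue (suc l) x))
        at l p = subst (λ t → suc t < P → (Good (δ t) × j t ≢ j (suc t)) × (∀ x → ¬ (Glue t x × Glue (suc t) x)))
          (F.toℕ-fromℕ< l<) (coh (fromℕ< l<)) p
          where
          l< : l < levels
          l< = ≤-trans (ℕ.<⇒≤ p) P≤

        valid : Valid levels
        valid .Valid.closed l e x b b′ = go (D l x) (D l (act X e x)) refl refl
          where
          to : Glue l x → Glue l (act X e x)
          to (p , o) = p , subst (λ g → OnLine X (f l) (δ l) (act X g x))
            (sym (ln-! (proj₂ (proj₁ (at l p))) b b′)) (line-step X o)
          from : Glue l (act X e x) → Glue l x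
          from (p , o) = p , line-trans X o (line-sym X (subst (λ g → OnLine X g x (act X e x))
            (ln-! (proj₂ (proj₁ (at l p))) b b′) (1 , refl)))
          go : ∀ s t → D l x ≡ s → D l (act X e x) ≡ t → D l (act X e x) ≡ D l x
          go true  _     p q = trans (dec-true (glue? l (act X e x)) (to (D-true l x p))) (sym p)
          go false true  p q = trans q (sym (dec-true (glue? l x) (from (D-true l _ q))))
          go false false p q = trans q (sym p)
        valid .Valid.disj l x p = dec-false (glue? (suc l) x) λ g →
          proj₂ (at l (proj₁ (D-true l x p))) x (D-true l x p , g)
        valid .Valid.uniq l e s x p q ¬b with D-true l x p | D-true l _ q
        ... | lt , o | _ , o′ with line-word X o | line-word X (line-sym X o′)
        ...   | α , p′ | β′ , q′ = independent s (replicate⁺ α f≢e) (replicate⁺ β′ f≢e) univ X x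
          where
          good = proj₁ (proj₁ (at l lt))
          ne = proj₂ (proj₁ (at l lt))
          f≢e : f l ≢ e
          f≢e refl = ¬b (ln-∈ˡ ne , ln-∈ʳ ne)
          -- Two points of the glued line joined by a power of `e` close up to a word that fixes the
          -- good point `δ l` and contains `e` only in that power.
          univ : Universal M (replicate α (f l) ++ replicate s e ++ replicate β′ (f l))
          univ = good-universal (replicate α (f l) ++ replicate s e ++ replicate β′ (f l)) good
            (trans (run-++ X (replicate α (f l)) _ _)
            (trans (cong (run X (replicate s e ++ replicate β′ (f l))) (sym p′))
            (trans (run-++ X (replicate s e) _ x)
            (trans (cong (run X (replicate β′ (f l))) (run-replicate X s e x)) (sym q′)))))
        valid .Valid.colours l x p = proj₂ (proj₁ (at l (proj₁ (D-true l x p))))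
        valid .Valid.bounded l x p = ≤-trans (proj₁ (D-true l x p)) P≤

        stable : ∀ e x l → l < levels → proj₂ (chain-act e (x , l)) < levels
        stable e x l p = κ-stable (ρ e (κ e (x , l))) (ρ-stable (κ e (x , l)) (κ-stable (x , l) p))
          where
          κ-stable : ∀ y → proj₂ y < levels → proj₂ (κ e y) < levels
          κ-stable (x , l) p with switch l e x in q
          ... | true = Valid.bounded valid l x (proj₂ (proj₂ (switch-true {l} {e} {x} q)))
          κ-stable (x , zero) p | false = p
          κ-stable (x , suc l) p | false with switch l e x
          ... | true  = ℕ.<-trans (ℕ.n<1+n l) p
          ... | false = p
          ρ-stable : ∀ y → proj₂ y < levels → proj₂ (ρ e y) < levels
          ρ-stable (x , l) p with β l e
          ... | true  = p
          ... | false = p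

        module L = Layers {a} {N} chain stable

      -- Incoherent data receive the trivial action, so that the family can range over all
      -- colourings and base points.
      finite : P ≤ levels → Dec Coherent → Action (Fin (a * levels))
      finite P≤ (yes coh) = L.layered P≤ coh
      finite P≤ (no  _)   = fixed _

      finite-star : ∀ (P≤ : P ≤ levels) c {i w} → Over i w → Universal M w → Trivial (finite P≤ c) w
      finite-star P≤ (yes coh) {i} {w} ov u = L.layered-trivial P≤ coh
            (Component.star-trivial F._≟_ X j D (valid P≤ coh) i len ov u (universal-trivial u))
      finite-star P≤ (no  _) {i} {w} ov u = run-fixed (fixed _) (All.universal (λ _ _ → refl) w)

      finite-chain : ∀ (P≤ : P ≤ levels) (coh : Coherent) c {w} → Trivial (finite P≤ c) w →
                     ∀ x → run chain w (x , 0) ≡ (x , 0)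
      finite-chain P≤ coh (yes coh′) t x = L.trivial-layered P≤ coh′ t x 0 (s≤s z≤n)
      finite-chain P≤ coh (no ¬coh)  t x = contradiction coh ¬coh

    member : (p : Fin levels) (c : Fin (k ^ levels)) (d : Fin (a ^ levels)) → Action (Fin (a * levels))
    member p c d = Datum.finite (suc (toℕ p)) (finToFun {k} {levels} c) (finToFun {a} {levels} d) (F.toℕ<n p)
      (Datum.coherent? (suc (toℕ p)) (finToFun {k} {levels} c) (finToFun {a} {levels} d))

    chains : Action (Fin (levels * (k ^ levels * (a ^ levels * (a * levels)))))
    chains = family₃ member

    -- Adding the chains leaves the relations inside one star unchanged; therefore what happens
    -- within a star can be checked in `X` and lifted.
    chains-star : ∀ {i w} → Over i w → Universal M w → Trivial chains w
    chains-star ov u = family₃-trivial member λ p c d →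
      Datum.finite-star (suc (toℕ p)) (finToFun {k} {levels} c) (finToFun {a} {levels} d) (F.toℕ<n p)
        (Datum.coherent? (suc (toℕ p)) (finToFun {k} {levels} c) (finToFun {a} {levels} d)) ov u

-- Short closed walks through stars

module Cycles {k r : ℕ} (S : Stars k r) (m′ N M : ℕ) (len : suc m′ * suc (suc N) ≤ M) where

  open Base S m′ N M len public

  -- A closed walk x 0, x 1, …, x P through the stars j 0, …, j (P − 1): if no three
  -- consecutive stars had a common point, the chain glued along the lines in
  -- which consecutive stars meet would unwind it.
  module Cycle {a : ℕ} (X : Action (Fin a)) (Good : Fin a → Set) (good? : ∀ x → Dec (Good x))
               (good-universal : ∀ w {x} → Good x → run X w x ≡ x → Universal M w)
               (universal-trivial : ∀ {w} → Universal M w → Trivial X w)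
               (good-run : ∀ w {x} → Good x → Good (run X w x)) (ι : Fin a) (good-ι : Good ι)
               {B : Set} (Y : Action B) (star-Y : ∀ {i w} → Over i w → Universal M w → Trivial Y w) (y : B)
               (faithful : ∀ w → run Y w y ≡ y →
                  Trivial (Gluing.chains X Good good? good-universal universal-trivial) w)
               (q : ℕ) (P≤ : suc (suc q) ≤ levels) (j : ℕ → Fin k) (ws : ℕ → List E)
               (over : ∀ l → l < suc (suc q) → Over (j l) (ws l))
               (distinct : ∀ l → suc l < suc (suc q) → j l ≢ j (suc l)) where

    open Gluing X Good good? good-universal universal-trivial

    P : ℕ
    P = suc (suc q)

    wd : ℕ → List E
    wd = prefix ws

    f : ℕ → E
    f l = ln (j l) (j (suc l))

    ξ : ℕ → Fin a
    ξ l = run X (wd l) ι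

    ξ-good : ∀ l → Good (ξ l)
    ξ-good l = good-run (wd l) good-ι

    ξ-suc : ∀ l → ξ (suc l) ≡ run X (ws l) (ξ l)
    ξ-suc l = run-++ X (wd l) (ws l) ι

    lift : ∀ {i} l w → Over i w → run X w (ξ l) ≡ ξ l → Trivial Y w
    lift l w ov p = star-Y ov (good-universal w (ξ-good l) p)

    Meet : ℕ → Fin a → Set
    Meet l z = suc (suc l) < P × OnLine X (f l) (ξ (suc l)) z × OnLine X (f (suc l)) (ξ (suc (suc l))) z

    Conclusion : Set
    Conclusion = (∃ λ l → suc (suc l) < P × ∃ λ z → OnLine Y (f l) (run Y (wd (suc l)) y) z ×
                                                    OnLine Y (f (suc l)) (run Y (wd (suc (suc l))) y) z)
               ⊎ (q ≡ 0 × OnLine Y (f 0) (run Y (wd 1) y) y)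

    abstract
      meet? : Dec (∃ λ (l : Fin levels) → ∃ λ z → Meet (toℕ l) z)
      meet? = any? λ l → any? λ z → (suc (suc (toℕ l)) <? P) ×-dec
        (line? X F._≟_ (f (toℕ l)) (ξ (suc (toℕ l))) z ×-dec
         line? X F._≟_ (f (suc (toℕ l))) (ξ (suc (suc (toℕ l)))) z)

    -- Crossing the star `j (suc l)`, going to `z` along the second line and back along the first is
    -- a closed walk whose word lies over that single star. So the word acts trivially on `Y` too,
    -- and the two lines also meet there.
    lift-meet : ∀ {l z} → Meet l z → Conclusion
    lift-meet {l} {z} (lt , o , o′) with line-word X (line-sym X o) | line-word X o′
    ... | s , p | t , p′ = inj₁ (l , lt , z′ , line-sym Y (s , sym back) , t , run-cong)
      where
      u = ws (suc l) ++ replicate t (f (suc l)) ++ replicate s (f l)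
      y₁ = run Y (wd (suc l)) y
      ov : Over (j (suc l)) u
      ov = ++⁺ (over (suc l) (ℕ.<⇒≤ lt)) (++⁺ (replicate⁺ t (ln-∈ˡ (distinct (suc l) lt)))
                                              (replicate⁺ s (ln-∈ʳ (distinct l (ℕ.<⇒≤ lt)))))
      fix : run X u (ξ (suc l)) ≡ ξ (suc l)
      fix = trans (run-++ X (ws (suc l)) _ _)
        (trans (cong (run X (replicate t (f (suc l)) ++ replicate s (f l))) (sym (ξ-suc (suc l))))
        (trans (run-++ X (replicate t (f (suc l))) _ _)
        (trans (cong (run X (replicate s (f l))) (sym p′)) (sym p))))
      z′ = iter t (act Y (f (suc l))) (run Y (ws (suc l)) y₁)
      run-cong : z′ ≡ iter t (act Y (f (suc l))) (run Y (wd (suc (suc l))) y)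
      run-cong = cong (iter t (act Y (f (suc l)))) (sym (run-++ Y (wd (suc l)) (ws (suc l)) y))
      back : iter s (act Y (f l)) z′ ≡ y₁
      back = trans (cong (iter s (act Y (f l))) (sym (run-replicate Y t (f (suc l)) _)))
        (trans (sym (run-replicate Y s (f l) _))
        (trans (sym (run-++ Y (replicate t (f (suc l))) _ _))
        (trans (sym (run-++ Y (ws (suc l)) _ y₁)) (fixes (lift (suc l) u ov fix) y₁))))

    lift-end : q ≡ 0 → OnLine X (f 0) (ξ 1) (ξ 0) → Conclusion
    lift-end q≡0 o with line-word X o
    ... | s , p = inj₂ (q≡0 , s , sym eq)
      where
      u = ws 0 ++ replicate s (f 0)
      eq : iter s (act Y (f 0)) (run Y (wd 1) y) ≡ y
      eq = trans (sym (run-replicate Y s (f 0) _)) (trans (sym (run-++ Y (ws 0) _ y))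
        (fixes (lift 0 u (++⁺ (over 0 (s≤s z≤n)) (replicate⁺ s (ln-∈ˡ (distinct 0 (s≤s (s≤s z≤n))))))
          (trans (run-++ X (ws 0) _ _) (sym p))) y))

    p : Fin levels
    p = fromℕ< P≤

    P′≡P : suc (toℕ p) ≡ P
    P′≡P = cong suc (F.toℕ-fromℕ< P≤)

    c : Fin (k ^ levels)
    c = funToFin {levels} {k} λ l → j (toℕ l)

    d : Fin (a ^ levels)
    d = funToFin {levels} {a} λ l → ξ (suc (toℕ l))

    module T = Datum (suc (toℕ p)) (finToFun {k} {levels} c) (finToFun {a} {levels} d)

    T-j : ∀ {l} → l < levels → T.j l ≡ j l
    T-j {l} lt = trans (finToFun-funToFin {levels} {k} (λ l → j (toℕ l)) (clamp l)) (cong j (toℕ-clamp lt))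

    T-δ : ∀ {l} → l < levels → T.δ l ≡ ξ (suc l)
    T-δ {l} lt = trans (finToFun-funToFin {levels} {a} (λ l → ξ (suc (toℕ l))) (clamp l)) (cong (λ t → ξ (suc t)) (toℕ-clamp lt))

    small : ∀ {l} → l < suc (toℕ p) → l < levels
    small lt = ≤-trans lt (F.toℕ<n p)

    T-f : ∀ {l} → suc l < suc (toℕ p) → T.f l ≡ f l
    T-f lt = cong₂ ln (T-j (ℕ.<⇒≤ (small lt))) (T-j (small lt))

    glue-line : ∀ {l x} → T.Glue l x → OnLine X (f l) (ξ (suc l)) x
    glue-line {l} {x} (lt , o) = subst₂ (λ g z → OnLine X g z x) (T-f lt) (T-δ (ℕ.<⇒≤ (small lt))) o

    coherent : ¬ (∃ λ (l : Fin levels) → ∃ λ z → Meet (toℕ l) z) → T.Coherent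
    coherent none l lt = (subst Good (sym (T-δ (F.toℕ<n l))) (ξ-good (suc (toℕ l))) ,
        λ e → distinct (toℕ l) (subst (suc (toℕ l) <_) P′≡P lt)
                (trans (sym (T-j (F.toℕ<n l))) (trans e (T-j (small lt))))) ,
      λ x (g , g′) → none (l , x , subst (suc (suc (toℕ l)) <_) P′≡P (proj₁ g′) , glue-line g , glue-line g′)

    module Unwind (coh : T.Coherent) (closed : run Y (wd P) y ≡ y) where

      open Chain X T.j T.D
      open Walk (T.valid (F.toℕ<n p) coh)


      D-ξ : ∀ {l} → suc l < P → T.D l (ξ (suc l)) ≡ true
      D-ξ {l} lt = dec-true (T.glue? l (ξ (suc l)))
        (lt′ , subst (λ z → OnLine X (T.f l) z (ξ (suc l))) (sym (T-δ (ℕ.<⇒≤ (small lt′)))) (line-refl X))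
        where
        lt′ = subst (suc l <_) (sym P′≡P) lt

      over′ : ∀ l → l < P → Over (T.j l) (ws l)
      over′ l lt = subst (λ i → Over i (ws l)) (sym (T-j (≤-trans lt P≤))) (over l lt)

      level : ∀ l → suc l < P → real l (ξ (suc l)) ≡ real (suc l) (ξ (suc l))
      level l lt = trans (real-low {l} {ξ (suc l)} (D-ξ lt)) (sym (real-up l {ξ (suc l)} (D-ξ lt)))

      advance : ∀ l → l < P → run chain (ws l) (real l (ξ l)) ≡ real l (ξ (suc l))
      advance l lt = trans (run-real l (ξ l) (over′ l lt)) (cong (real l) (sym (ξ-suc l)))

      walk : ∀ l → l < P → run chain (wd (suc l)) (ξ 0 , 0) ≡ real l (ξ (suc l))
      walk = traverse ws P chain (λ l → real l (ξ l)) (λ l → real l (ξ (suc l))) level advance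

      returns : real (suc q) (ξ P) ≡ (ξ 0 , 0)
      returns = trans (sym (walk (suc q) ≤-refl))
        (T.finite-chain (F.toℕ<n p) coh T.coherent?
          (family₃-member member (faithful (wd P) closed) p c d) (ξ 0))

      -- The walk ends at a point of layer `suc q`, represented in layer `suc q` or `q`. As it must
      -- return to layer 0, the end is glued down and `q` is 0.
      conclusion : ∀ t → T.D q (ξ P) ≡ t → Conclusion
      conclusion true  e with trans (sym (real-up q {ξ P} e)) returns
      ... | r = finish (cong proj₂ r) (cong proj₁ r)
        where
        finish : q ≡ 0 → ξ P ≡ ξ 0 → Conclusion
        finish refl s = lift-end refl (subst (OnLine X (f 0) (ξ 1)) s (glue-line (T.D-true 0 (ξ P) e)))
      conclusion false e = contradiction (cong proj₂ (trans (sym (real-own q {ξ P} e)) returns)) λ ()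

    cycle : run Y (wd P) y ≡ y → Conclusion
    cycle closed with meet?
    ... | yes (l , z , mt) = lift-meet mt
    ... | no none = Unwind.conclusion (coherent none) closed (T.D q (ξ P)) refl

module Acyclic {k r : ℕ} (S : Stars k r) (m′ N M : ℕ) (len : suc m′ * suc (suc N) ≤ M) where

  open Cycles S m′ N M len public

  n₁ : ℕ
  n₁ = (M ^ M) ^ r * M

  Z₁ : Action (Fin n₁)
  Z₁ = family (structure M)

  module P₁ = Pow Z₁

  x₁ : ℕ
  x₁ = n₁ ^ n₁

  X₁ : Action (Fin x₁)
  X₁ = P₁.pow

  good-universal : ∀ w {x} → P₁.Good x → run X₁ w x ≡ x → Universal M w
  good-universal w g p .trivialises = family-member (structure M) (P₁.good-fix w g p)

  universal-X₁ : ∀ {w} → Universal M w → Trivial X₁ w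
  universal-X₁ u = P₁.trivial-pow (family-trivial (structure M) (trivialises u))

  open Gluing X₁ P₁.Good P₁.good? good-universal universal-X₁ using (chains; chains-star) public

  n₂ : ℕ
  n₂ = n₁ + levels * (k ^ levels * (x₁ ^ levels * (x₁ * levels)))

  -- The summand `Z₁` makes every word that is trivial here universal; the other summand makes it
  -- trivial on all chains.
  Z₂ : Action (Fin n₂)
  Z₂ = Z₁ ⊕ chains

  star-Z₂ : ∀ {i w} → Over i w → Universal M w → Trivial Z₂ w
  star-Z₂ ov u = ⊕-trivial Z₁ chains (family-trivial (structure M) (trivialises u)) (chains-star ov u)

  Z₂-universal : ∀ {w} → Trivial Z₂ w → Universal M w
  Z₂-universal t .trivialises = family-member (structure M) (⊕-left Z₁ chains t)

-- All that the gluing uses of the group: `cycle` controls short closed walks through several stars,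
-- `rigid` walks along lines, and the equivariant map `type` attaches data to blocks.
record Blocks {k r : ℕ} (S : Stars k r) (m′ N : ℕ) {t : ℕ} (T : Actions.Action r m′ (Fin t)) : Set₁ where
  open Chains S m′
  field
    size     : ℕ
    Y        : Action (Fin size)
    Good     : Fin size → Set
    good?    : ∀ y → Dec (Good y)
    good-act : ∀ e {y} → Good y → Good (act Y e y)
    origin   : Fin t → Fin size
    good-origin : ∀ τ → Good (origin τ)
    type     : Fin size → Fin t
    type-origin : ∀ τ → type (origin τ) ≡ τ
    type-act : ∀ e y → type (act Y e y) ≡ act T e (type y)
    rigid    : ∀ {e u v} s {y} → All (_≢ e) u → All (_≢ e) v → Good y →
               run Y (u ++ replicate s e ++ v) y ≡ y → iter s (act Y e) y ≡ y
    cycle    : ∀ {y} → Good y → ∀ q → suc (suc q) ≤ suc N → (j : ℕ → Fin k) (ws : ℕ → List E) →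
               (∀ l → l < suc (suc q) → Over (j l) (ws l)) →
               (∀ l → suc l < suc (suc q) → j l ≢ j (suc l)) →
               run Y (prefix ws (suc (suc q))) y ≡ y →
               (∃ λ l → suc (suc l) < suc (suc q) × ∃ λ z →
                  OnLine Y (ln (j l) (j (suc l))) (run Y (prefix ws (suc l)) y) z ×
                  OnLine Y (ln (j (suc l)) (j (suc (suc l)))) (run Y (prefix ws (suc (suc l))) y) z)
               ⊎ (q ≡ 0 × OnLine Y (ln (j 0) (j 1)) (run Y (prefix ws 1) y) y)

module Typing {k r : ℕ} (S : Stars k r) (m′ N M t : ℕ) (len : suc m′ * suc (suc N) ≤ M) (t≤M : t ≤ M) where

  open Cycles S m′ N M len

  module Typed (T : Action (Fin t))
               {a : ℕ} (X : Action (Fin a)) (Good₁ : Fin a → Set) (good₁? : ∀ x → Dec (Good₁ x))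
               (good-universal : ∀ w {x} → Good₁ x → run X w x ≡ x → Universal M w)
               (universal-trivial : ∀ {w} → Universal M w → Trivial X w)
               (good-run : ∀ w {x} → Good₁ x → Good₁ (run X w x)) (ι : Fin a) (good-ι : Good₁ ι)
               {z : ℕ} (Z : Action (Fin z)) (star-Z : ∀ {i w} → Over i w → Universal M w → Trivial Z w)
               (Z-universal : ∀ {w} → Trivial Z w → Universal M w)
               (Z-chains : ∀ {w} → Trivial Z w →
                  Trivial (Gluing.chains X Good₁ good₁? good-universal universal-trivial) w) where

    module P = Pow Z

    product : Action (Fin (z ^ z) × Fin t)
    product .act   e (x , τ) = act P.pow e x , act T e τ
    product .order e (x , τ) = trans (iterate m x τ) (cong₂ _,_ (order P.pow e x) (order T e τ))
      where
      iterate : ∀ s x τ → iter s (act product e) (x , τ) ≡ (iter s (act P.pow e) x , iter s (act T e) τ)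
      iterate zero    x τ = refl
      iterate (suc s) x τ = iterate s (act P.pow e x) (act T e τ)

    product-run : ∀ w x τ → run product w (x , τ) ≡ (run P.pow w x , run T w τ)
    product-run []      x τ = refl
    product-run (e ∷ w) x τ = product-run w (act P.pow e x) (act T e τ)

    dec : Fin (z ^ z * t) → Fin (z ^ z) × Fin t
    dec = remQuot {z ^ z} t

    enc : Fin (z ^ z) × Fin t → Fin (z ^ z * t)
    enc (x , τ) = combine x τ

    dec-enc : ∀ u → dec (enc u) ≡ u
    dec-enc (x , τ) = F.remQuot-combine x τ

    module C = Coded dec enc dec-enc (F.combine-remQuot {z ^ z} t) product

    Y : Action (Fin (z ^ z * t))
    Y = C.coded

    Good : Fin (z ^ z * t) → Set
    Good y = P.Good (proj₁ (dec y))

    dec-act : ∀ e y → dec (act Y e y) ≡ act product e (dec y)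
    dec-act e y = dec-enc (act product e (dec y))

    faithful : ∀ w {y} → Good y → run Y w y ≡ y → Trivial Z w
    faithful w {y} g p = P.good-fix w g
      (cong proj₁ (trans (sym (product-run w _ _)) (trans (sym (C.dec-run w y)) (cong dec p))))

    star-Y : ∀ {i w} → Over i w → Universal M w → Trivial Y w
    star-Y {w = w} ov u = C.coded-trivial (trivial λ (x , τ) → trans (product-run w x τ)
      (cong₂ _,_ (fixes (P.trivial-pow (star-Z ov u)) x) (fixes (universal-small t≤M T u) τ)))

    blocks : Blocks S m′ N T
    blocks .Blocks.size = z ^ z * t
    blocks .Blocks.Y = Y
    blocks .Blocks.Good = Good
    blocks .Blocks.good? y = P.good? (proj₁ (dec y))
    blocks .Blocks.good-act e {y} g = subst P.Good (sym (cong proj₁ (dec-act e y))) (P.good-act e g)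
    blocks .Blocks.origin τ = enc (P.ident , τ)
    blocks .Blocks.good-origin τ = subst P.Good (sym (cong proj₁ (dec-enc (P.ident , τ)))) P.good-ident
    blocks .Blocks.type y = proj₂ (dec y)
    blocks .Blocks.type-origin τ = cong proj₂ (dec-enc (P.ident , τ))
    blocks .Blocks.type-act e y = cong proj₂ (dec-act e y)
    blocks .Blocks.rigid {e} {u} {v} s {y} pu pv g p =
      independent s pu pv (Z-universal (faithful (u ++ replicate s e ++ v) g p)) Y y
    blocks .Blocks.cycle {y} g q le j ws over distinct closed =
      Cycle.cycle X Good₁ good₁? good-universal universal-trivial good-run ι good-ι Y star-Y y
        (λ w p → Z-chains (faithful w g p)) q le j ws over distinct closed

blocks : {k r : ℕ} (S : Stars k r) (m′ N : ℕ) {t : ℕ} (T : Actions.Action r m′ (Fin t)) → Blocks S m′ N T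
blocks S m′ N {t} T = Typing.Typed.blocks S m′ N M t len (ℕ.m≤n+m t _) T
    X₁ P₁.Good P₁.good? good-universal universal-X₁ P₁.good-run P₁.ident P₁.good-ident
    Z₂ star-Z₂ Z₂-universal (⊕-right Z₁ chains)
  where
  -- The first summand covers the components in the chains, the second lets universal words fix all
  -- types.
  M = suc m′ * suc (suc N) + t
  len : suc m′ * suc (suc N) ≤ M
  len = ℕ.m≤m+n _ t
  open Acyclic S m′ N M len

-- Vertices as stars of blocks

-- Computes class representatives by merging the listed pairs one at a time, so that `R` itself need
-- not be decidable. Here cosets of a star become the fibres of a function.
classify : ∀ {n} {R : Fin n → Fin n → Set} → (∀ x → R x x) → (∀ {x y} → R x y → R y x) →
           (∀ {x y z} → R x y → R y z → R x z) → (L : List (Fin n × Fin n)) →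
           All (λ p → R (proj₁ p) (proj₂ p)) L →
           ∃ λ (q : Fin n → Fin n) → All (λ p → q (proj₁ p) ≡ q (proj₂ p)) L × (∀ x y → q x ≡ q y → R x y)
classify {R = R} rf sy tr []            []       = id , [] , λ x y p → subst (R x) p (rf x)
classify {n} {R} rf sy tr ((a , b) ∷ L) (ab ∷ L′) with classify {R = R} rf sy tr L L′
... | q , joined , sound = (λ x → g (q x)) , trans g-a (sym g-b) ∷ All.map (cong g) joined ,
                           λ x y → merged x y (q x F.≟ q b) (q y F.≟ q b)
  where
  g : Fin n → Fin n
  g v = if does (v F.≟ q b) then q a else v
  g-a : g (q a) ≡ q a
  g-a with does (q a F.≟ q b)
  ... | true  = refl
  ... | false = refl
  g-b : g (q b) ≡ q a
  g-b rewrite dec-true (q b F.≟ q b) refl = refl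
  merged : ∀ x y (dx : Dec (q x ≡ q b)) (dy : Dec (q y ≡ q b)) →
           (if does dx then q a else q x) ≡ (if does dy then q a else q y) → R x y
  merged x y (yes p) (yes p′) _ = tr (sound x b p) (sy (sound y b p′))
  merged x y (yes p) (no  _)  e = tr (sound x b p) (tr (sy ab) (sound a y e))
  merged x y (no  _) (yes p′) e = sy (tr (sound y b p′) (tr (sy ab) (sound a x (sym e))))
  merged x y (no  _) (no  _)  e = sound x y e

module Vertices {k r : ℕ} {S : Stars k r} {m′ N t : ℕ} {T : Actions.Action r m′ (Fin t)}
                (𝔅 : Blocks S m′ (suc N) T) where

  open Chains S m′ public
  open Blocks 𝔅 public

  Conn : Fin k → Fin size → Fin size → Set
  Conn i x y = ∃ λ w → Over i w × run Y w x ≡ y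

  over-inv : ∀ {i w} → Over i w → Over i (inv w)
  over-inv []       = []
  over-inv (p ∷ ps) = ++⁺ (over-inv ps) (replicate⁺ m′ p)

  moved : Fin k → E → Fin size → Fin size
  moved i e x = if mem i e then act Y e x else x

  conn-moved : ∀ i e x → Conn i x (moved i e x)
  conn-moved i e x with mem i e in p
  ... | true  = e ∷ [] , p ∷ [] , refl
  ... | false = [] , [] , refl

  pairs : Fin k → List (Fin size × Fin size)
  pairs i = tabulate {n = r * size} λ z → let e , x = remQuot {r} size z in x , moved i e x

  abstract
    classes : ∀ i → ∃ λ (q : Fin size → Fin size) →
              All (λ p → q (proj₁ p) ≡ q (proj₂ p)) (pairs i) × (∀ x y → q x ≡ q y → Conn i x y)
    classes i = classify {R = Conn i} (λ x → [] , [] , refl)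
      (λ {x} (w , ov , p) → inv w , over-inv ov , trans (cong (run Y (inv w)) (sym p)) (run-inv Y w x))
      (λ {x} (w , ov , p) (w′ , ov′ , p′) → w ++ w′ , ++⁺ ov ov′ , run-via Y w w′ p p′)
      (pairs i) (tabulate⁺ {n = r * size} λ z → conn-moved i _ _)

  cls : Fin k → Fin size → Fin size
  cls i = proj₁ (classes i)

  cls-act : ∀ {i e} x → mem i e ≡ true → cls i (act Y e x) ≡ cls i x
  cls-act {i} {e} x p = sym (trans
    (subst (λ u → cls i (proj₂ u) ≡ cls i (moved i (proj₁ u) (proj₂ u))) (F.remQuot-combine {r} {size} e x)
      (tabulate⁻ {n = r * size} (proj₁ (proj₂ (classes i))) (combine e x)))
    (cong (λ b → cls i (if b then act Y e x else x)) p))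

  V : Set
  V = Fin k × Fin size

  infix 4 _∋_ _∋?_
  _∋_ : Fin size → V → Set
  y ∋ (i , c) = cls i y ≡ c

  _∋?_ : ∀ y v → Dec (y ∋ v)
  y ∋? (i , c) = cls i y F.≟ c

  vert : Fin size → Fin k → V
  vert y i = i , cls i y

  ∋-same : ∀ {y u v} → y ∋ u → y ∋ v → proj₁ u ≡ proj₁ v → u ≡ v
  ∋-same p q refl = cong (_ ,_) (trans (sym p) q)

  connect : ∀ {y y′ u} → y ∋ u → y′ ∋ u → Conn (proj₁ u) y y′
  connect {y} {y′} {i , c} p p′ = proj₂ (proj₂ (classes i)) y y′ (trans p (sym p′))

  line-∋ : ∀ {e y y′ u} → mem (proj₁ u) e ≡ true → OnLine Y e y y′ → y ∋ u → y′ ∋ u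
  line-∋ {e} {u = u} p (s , refl) = go s
    where
    go : ∀ s {y} → y ∋ u → iter s (act Y e) y ∋ u
    go zero    q = q
    go (suc s) {y} q = go s (trans (cls-act y p) q)

  line-good : ∀ {e y y′} → OnLine Y e y y′ → Good y → Good y′
  line-good {e} (s , refl) = go s
    where
    go : ∀ s {y} → Good y → Good (iter s (act Y e) y)
    go zero    g = g
    go (suc s) g = go s (good-act e g)

  run-good : ∀ w {y} → Good y → Good (run Y w y)
  run-good []      g = g
  run-good (e ∷ w) g = run-good w (good-act e g)

  -- Going from `y` to `y′` inside one star and back inside the other is a closed walk through two
  -- stars, where only the second alternative of `cycle` is possible.
  two-meet : ∀ {y y′ u v} → proj₁ u ≢ proj₁ v → Good y → y ∋ u → y ∋ v → y′ ∋ u → y′ ∋ v →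
             OnLine Y (ln (proj₁ u) (proj₁ v)) y′ y
  two-meet {y} {y′} {u} {v} ne g yu yv y′u y′v with connect {y} {y′} {u} yu y′u | connect {y′} {y} {v} y′v yv
  ... | w , ov , p | w′ , ov′ , p′ with cycle g 0 (s≤s (s≤s z≤n)) j ws over (λ { zero _ → ne ; (suc _) (s≤s (s≤s ())) })
                                          (run-via Y w w′ p p′)
    where
    j : ℕ → Fin k
    j zero    = proj₁ u
    j (suc _) = proj₁ v
    ws : ℕ → List E
    ws zero    = w
    ws (suc _) = w′
    over : ∀ l → l < 2 → Over (j l) (ws l)
    over zero    _ = ov
    over (suc _) _ = ov′
  ...   | inj₁ (l , s≤s (s≤s ()) , _)
  ...   | inj₂ (_ , o) = subst (λ x → OnLine Y (ln (proj₁ u) (proj₁ v)) x y) p o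

  Share : V → V → Set
  Share u v = ∃ λ y → Good y × y ∋ u × y ∋ v

  -- The common blocks of neighbours turn the sequence into a closed walk through stars, based at
  -- the block that closes it. The triple never wraps around this base, which `shorten` relies on.
  triple : ∀ q → suc (suc (suc q)) ≤ suc (suc N) → (s : ℕ → V) →
           (∀ l → l < suc (suc q) → Share (s l) (s (suc l))) → Share (s 0) (s (suc (suc q))) →
           ∃ λ l → l < suc q × ∃ λ y → Good y × y ∋ s l × y ∋ s (suc l) × y ∋ s (suc (suc l))
  triple q le s link (z , gz , z0 , zp) with any? {n = suc (suc q)} (λ l → proj₁ (s (toℕ l)) F.≟ proj₁ (s (suc (toℕ l))))
  ... | yes (l , e) = repeated (toℕ l) (F.toℕ<n l) e
    where
    repeated : ∀ l → l < suc (suc q) → proj₁ (s l) ≡ proj₁ (s (suc l)) → _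
    repeated zero    lt e with link 0 lt | link 1 (s≤s (s≤s z≤n))
    ... | y , g , a , b | y′ , g′ , a′ , b′ = 0 , s≤s z≤n , y′ , g′ , subst (y′ ∋_) (sym (∋-same a b e)) a′ , a′ , b′
    repeated (suc l) lt e with link l (ℕ.<⇒≤ lt) | link (suc l) lt
    ... | y , g , a , b | _ , _ , a′ , b′ = l , ℕ.≤-pred lt , y , g , a , b , subst (y ∋_) (∋-same a′ b′ e) b
  ... | no distinct = answer (cycle gz (suc q) le j ws over
          unequal (trans (at p ≤-refl) x-end))
    where
    p = suc (suc (suc q))
    j : ℕ → Fin k
    j l = proj₁ (s l)
    b : ℕ → Fin size
    b l with l <? suc (suc q)
    ... | yes lt = proj₁ (link l lt)
    ... | no  _  = z
    x : ℕ → Fin size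
    x zero    = z
    x (suc l) = b l
    b-∋ : ∀ l → l < p → b l ∋ s l
    b-∋ l lt with l <? suc (suc q)
    ... | yes lt′ = proj₁ (proj₂ (proj₂ (link l lt′)))
    ... | no ¬lt = subst (λ t → z ∋ s t) (ℕ.≤-antisym (ℕ.≮⇒≥ ¬lt) (ℕ.≤-pred lt)) zp
    x-∋ : ∀ l → l < p → x l ∋ s l
    x-∋ zero    _  = z0
    x-∋ (suc l) lt with l <? suc (suc q)
    ... | yes lt′ = proj₂ (proj₂ (proj₂ (link l lt′)))
    ... | no ¬lt  = contradiction (ℕ.≤-pred lt) ¬lt
    x-end : x p ≡ z
    x-end with suc (suc q) <? suc (suc q)
    ... | yes lt = contradiction lt (ℕ.<-irrefl refl)
    ... | no  _  = refl
    conn : ∀ l → l < p → Conn (j l) (x l) (x (suc l))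
    conn l lt = connect {u = s l} (x-∋ l lt) (b-∋ l lt)
    ws : ℕ → List E
    ws l with l <? p
    ... | yes lt = proj₁ (conn l lt)
    ... | no  _  = []
    over : ∀ l → l < p → Over (j l) (ws l)
    over l lt with l <? p
    ... | yes lt′ = proj₁ (proj₂ (conn l lt′))
    ... | no ¬lt  = contradiction lt ¬lt
    step : ∀ l → l < p → run Y (ws l) (x l) ≡ x (suc l)
    step l lt with l <? p
    ... | yes lt′ = proj₂ (proj₂ (conn l lt′))
    ... | no ¬lt  = contradiction lt ¬lt
    at : ∀ l → l ≤ p → run Y (prefix ws l) z ≡ x l
    at zero    _  = refl
    at (suc l) le = run-via Y (prefix ws l) (ws l) (at l (ℕ.<⇒≤ le)) (step l le)
    unequal : ∀ l → suc l < p → j l ≢ j (suc l)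
    unequal l lt e = distinct (fromℕ< (ℕ.≤-pred lt) ,
      subst (λ t → proj₁ (s t) ≡ proj₁ (s (suc t))) (sym (F.toℕ-fromℕ< (ℕ.≤-pred lt))) e)
    answer : _ → ∃ λ l → l < suc q × ∃ λ y → Good y × y ∋ s l × y ∋ s (suc l) × y ∋ s (suc (suc l))
    answer (inj₂ (() , _))
    answer (inj₁ (l , lt , z′ , o , o′)) = l , ℕ.≤-pred (ℕ.≤-pred lt) , z′ ,
        line-good o (run-good (prefix ws (suc l)) gz) ,
        line-∋ {u = s l} (ln-∈ˡ ne) on (b-∋ l (ℕ.<⇒≤ (ℕ.<⇒≤ lt))) ,
        line-∋ {u = s (suc l)} (ln-∈ʳ ne) on (x-∋ (suc l) (ℕ.<⇒≤ lt)) ,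
        line-∋ {u = s (suc (suc l))} (ln-∈ʳ ne′) on′ (x-∋ (suc (suc l)) lt)
      where
      ne = unequal l (ℕ.<⇒≤ lt)
      ne′ = unequal (suc l) lt
      on = subst (λ x → OnLine Y (ln (j l) (j (suc l))) x z′) (at (suc l) (ℕ.<⇒≤ (ℕ.<⇒≤ lt))) o
      on′ = subst (λ x → OnLine Y (ln (j (suc l)) (j (suc (suc l)))) x z′) (at (suc (suc l)) (ℕ.<⇒≤ lt)) o′

  -- Blocks meeting pairwise in the lines u v₁, u v₂ and u c: three lines through
  -- one star in distinct directions cannot form a triangle.
  helly : ∀ {z y₁ y₂ u v₁ v₂ c} → Good z → z ∋ u → z ∋ v₁ → z ∋ v₂ → y₁ ∋ u → y₁ ∋ v₁ → y₁ ∋ c →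
          y₂ ∋ u → y₂ ∋ v₂ → y₂ ∋ c → Good y₁ → Good y₂ → u ≢ v₁ → u ≢ v₂ → v₁ ≢ v₂ →
          c ≢ u → c ≢ v₁ → c ≢ v₂ → z ∋ c
  helly {z} {y₁} {y₂} {u} {v₁} {v₂} {c} gz zu z₁ z₂ y₁u y₁₁ y₁c y₂u y₂₂ y₂c g₁ g₂ u≢v₁ u≢v₂ v₁≢v₂ c≢u c≢v₁ c≢v₂
    = subst (_∋ c) (trans y₁≡ fix) y₁c
    where
    a≢b₁ : proj₁ u ≢ proj₁ v₁
    a≢b₁ e = u≢v₁ (∋-same zu z₁ e)
    a≢b₂ : proj₁ u ≢ proj₁ v₂
    a≢b₂ e = u≢v₂ (∋-same zu z₂ e)
    a≢c : proj₁ u ≢ proj₁ c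
    a≢c e = c≢u (∋-same y₁c y₁u (sym e))
    b₁≢b₂ : proj₁ v₁ ≢ proj₁ v₂
    b₁≢b₂ e = v₁≢v₂ (∋-same z₁ z₂ e)
    b₁≢c : proj₁ v₁ ≢ proj₁ c
    b₁≢c e = c≢v₁ (∋-same y₁c y₁₁ (sym e))
    o₁ : OnLine Y (ln (proj₁ u) (proj₁ v₁)) z y₁
    o₁ = two-meet {u = u} {v₁} a≢b₁ g₁ y₁u y₁₁ zu z₁
    o₂ : OnLine Y (ln (proj₁ u) (proj₁ c)) y₁ y₂
    o₂ = two-meet {u = u} {c} a≢c g₂ y₂u y₂c y₁u y₁c
    o₃ : OnLine Y (ln (proj₁ u) (proj₁ v₂)) y₂ z
    o₃ = two-meet {u = u} {v₂} a≢b₂ gz zu z₂ y₂u y₂₂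
    s₁ = proj₁ o₁
    s₂ = proj₁ (line-word Y o₂)
    s₃ = proj₁ (line-word Y o₃)
    e₁ = ln (proj₁ u) (proj₁ v₁)
    other : ∀ {i} → proj₁ u ≢ i → proj₁ v₁ ≢ i → ln (proj₁ u) i ≢ e₁
    other ne ne′ e = three a≢b₁ ne ne′ (ln-∈ˡ a≢b₁) (ln-∈ʳ a≢b₁) (subst (λ g → mem _ g ≡ true) e (ln-∈ʳ ne))
    y₁≡ : y₁ ≡ iter s₁ (act Y e₁) z
    y₁≡ = proj₂ o₁
    fix : iter s₁ (act Y e₁) z ≡ z
    fix = rigid {u = []} s₁ [] (++⁺ (replicate⁺ s₂ (other a≢c b₁≢c)) (replicate⁺ s₃ (other a≢b₂ b₁≢b₂))) gz
      (run-via Y (replicate s₁ e₁) _ (trans (run-replicate Y s₁ e₁ z) (sym y₁≡))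
        (run-via Y (replicate s₂ (ln (proj₁ u) (proj₁ c))) (replicate s₃ (ln (proj₁ u) (proj₁ v₂)))
          (sym (proj₂ (line-word Y o₂))) (sym (proj₂ (line-word Y o₃)))))

-- ThreeConn is 3-connectivity of A on a large enough set In: s and t may coincide
-- or lie outside In, so the removal of fewer vertices is covered.
Step : ∀ {K} → (Fin K → Fin K → Set) → (Fin K → Bool) → Fin K → Fin K → Fin K → Fin K → Set
Step A In s t x y = A x y × In y ≡ true × y ≢ s × y ≢ t

ThreeConn : ∀ {K} → (Fin K → Fin K → Set) → (Fin K → Bool) → Set
ThreeConn A In = ∀ s t x y → In x ≡ true → In y ≡ true → x ≢ s → x ≢ t → y ≢ s → y ≢ t →
                            Star (Step A In s t) x y

Big : ∀ {K} → ℕ → (Fin K → Bool) → Set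
Big {K} n In = ∃ λ (h : Fin n → Fin K) → (∀ {i j} → h i ≡ h j → i ≡ j) × (∀ i → In (h i) ≡ true)

avoid : ∀ {K n p} {In : Fin K → Bool} → p < n → Big n In → (f : Fin p → Fin K) →
        ∃ λ x → In x ≡ true × (∀ i → x ≢ f i)
avoid {K} {n} {p} {In} p<n (h , inj , sub) f with any? (λ i → all? (λ j → ¬? (h i F.≟ f j)))
... | yes (i , ne) = h i , sub i , ne
... | no none = contradiction (inj (trans (proj₂ (hit i)) (trans (cong f gi≡gj) (sym (proj₂ (hit j)))))) λ e → F.<-irrefl e i<j
  where
  hit : ∀ i → ∃ λ j → h i ≡ f j
  hit i with any? (λ j → h i F.≟ f j)
  ... | yes p = p
  ... | no ¬p = contradiction (i , λ j e → ¬p (j , e)) none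
  clash′ = F.pigeonhole p<n (λ i → proj₁ (hit i))
  i = proj₁ clash′
  j = proj₁ (proj₂ clash′)
  i<j = proj₁ (proj₂ (proj₂ clash′))
  gi≡gj = proj₂ (proj₂ (proj₂ clash′))

third : ∀ {n} {P : Fin n → Set} {a₁ a₂ a₃} b₁ b₂ → a₁ ≢ a₂ → a₁ ≢ a₃ → a₂ ≢ a₃ → P a₁ → P a₂ → P a₃ →
        ∃ λ u → P u × u ≢ b₁ × u ≢ b₂
third {a₁ = a₁} {a₂} {a₃} b₁ b₂ ne₁₂ ne₁₃ ne₂₃ p₁ p₂ p₃ with a₁ F.≟ b₁ | a₁ F.≟ b₂ | a₂ F.≟ b₁ | a₂ F.≟ b₂
... | no p  | no q  | _     | _     = a₁ , p₁ , p , q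
... | yes p | _     | _     | no q  = a₂ , p₂ , (λ e → ne₁₂ (trans p (sym e))) , q
... | yes p | _     | _     | yes q = a₃ , p₃ , (λ e → ne₁₃ (trans p (sym e))) , (λ e → ne₂₃ (trans q (sym e)))
... | no _  | yes p | no q  | _     = a₂ , p₂ , q , (λ e → ne₁₂ (trans p (sym e)))
... | no _  | yes p | yes q | _     = a₃ , p₃ , (λ e → ne₂₃ (trans q (sym e))) , (λ e → ne₁₃ (trans p (sym e)))

-- Confinement of 3-connected subgraphs to one block

module Confinement {K r : ℕ} {S : Stars K r} {m′ τ : ℕ} {T : Actions.Action r m′ (Fin τ)}
                   (𝔅 : Blocks S m′ (suc K) T) (A : Fin K → Fin K → Set) (irr : ∀ x → ¬ A x x)
                   (In : Fin K → Bool) (big : Big 5 In) (conn : ThreeConn A In)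
                   (φ : Fin K → Vertices.V 𝔅) (φ-inj : ∀ {x y} → φ x ≡ φ y → x ≡ y)
                   (share : ∀ {x y} → A x y → Vertices.Share 𝔅 (φ x) (φ y)) where

  open Vertices 𝔅

  share-sym : ∀ {u v} → Share u v → Share v u
  share-sym (y , g , p , q) = y , g , q , p

  pick : ∀ a b → ∃ λ x → In x ≡ true × x ≢ a × x ≢ b
  pick a b with avoid (s≤s (s≤s (s≤s z≤n))) big f
    where
    f : Fin 2 → Fin K
    f zero    = a
    f (suc _) = b
  ... | x , p , ne = x , p , ne zero , ne (suc zero)

  -- A walk outside the block `z` up to its last vertex `b`. Its links are common blocks rather than
  -- adjacencies, because a shortcut provides no more than that.
  record Walk (z : Fin size) (x b : Fin K) (n : ℕ) : Set where
    field
      c     : ℕ → Fin K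
      first : c 0 ≡ x
      last  : c (suc n) ≡ b
      inn   : ∀ t → t ≤ n → In (c t) ≡ true
      out   : ∀ t → t ≤ n → ¬ (z ∋ φ (c t))
      link  : ∀ t → t ≤ n → Share (φ (c t)) (φ (c (suc t)))

  single : ∀ {z x b} → In x ≡ true → ¬ (z ∋ φ x) → Share (φ x) (φ b) → Walk z x b 0
  single {z} {x} {b} i o sh = record
    { c = λ { zero → x ; (suc _) → b } ; first = refl ; last = refl
    ; inn = λ { zero _ → i } ; out = λ { zero _ → o } ; link = λ { zero _ → sh } }

  cons : ∀ {z x y b n} → In x ≡ true → ¬ (z ∋ φ x) → Share (φ x) (φ y) → Walk z y b n → Walk z x b (suc n)
  cons {z} {x} {y} i o sh W = record
    { c = λ { zero → x ; (suc t) → c t } ; first = refl ; last = last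
    ; inn = λ { zero _ → i ; (suc t) (s≤s le) → inn t le }
    ; out = λ { zero _ → o ; (suc t) (s≤s le) → out t le }
    ; link = λ { zero _ → subst (λ v → Share (φ x) (φ v)) (sym first) sh ; (suc t) (s≤s le) → link t le } }
    where open Walk W

  tail : ∀ {z x b n} (W : Walk z x b (suc n)) → Walk z (Walk.c W 1) b n
  tail W = record
    { c = λ t → c (suc t) ; first = refl ; last = last ; inn = λ t le → inn (suc t) (s≤s le)
    ; out = λ t le → out (suc t) (s≤s le) ; link = λ t le → link (suc t) (s≤s le) }
    where open Walk W

  splice : ∀ {z x b} n d (W : Walk z x b (n + d)) t → t ≤ n →
           Share (φ (Walk.c W t)) (φ (Walk.c W (suc (t + d)))) → Walk z x b n
  splice {z} {x} {b} n d W t t≤n sh = record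
    { c = c′ ; first = trans (c′-low z≤n) first ; last = trans (c′-high (s≤s t≤n)) last
    ; inn = λ s le → via (λ v → In v ≡ true) s (λ p → inn s (≤-trans p t≤)) (λ _ → inn (s + d) (ℕ.+-monoˡ-≤ d le))
    ; out = λ s le → via (λ v → ¬ (z ∋ φ v)) s (λ p → out s (≤-trans p t≤)) (λ _ → out (s + d) (ℕ.+-monoˡ-≤ d le))
    ; link = links }
    where
    open Walk W
    t≤ : t ≤ n + d
    t≤ = ≤-trans t≤n (ℕ.m≤m+n n d)
    c′ : ℕ → Fin K
    c′ s with s ℕ.≤? t
    ... | yes _ = c s
    ... | no  _ = c (s + d)
    c′-low : ∀ {s} → s ≤ t → c′ s ≡ c s
    c′-low {s} p with s ℕ.≤? t
    ... | yes _ = refl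
    ... | no ¬p = contradiction p ¬p
    c′-high : ∀ {s} → t < s → c′ s ≡ c (s + d)
    c′-high {s} p with s ℕ.≤? t
    ... | yes q = contradiction q (ℕ.<⇒≱ p)
    ... | no  _ = refl
    via : ∀ (P : Fin K → Set) s → (s ≤ t → P (c s)) → (t < s → P (c (s + d))) → P (c′ s)
    via P s low high with s ℕ.≤? t
    ... | yes p = low p
    ... | no ¬p = high (ℕ.≰⇒> ¬p)
    links : ∀ s → s ≤ n → Share (φ (c′ s)) (φ (c′ (suc s)))
    links s le with ℕ.<-cmp s t
    ... | tri< lt _ _ = subst₂ (λ u v → Share (φ u) (φ v)) (sym (c′-low (ℕ.<⇒≤ lt))) (sym (c′-low lt)) (link s (≤-trans le (ℕ.m≤m+n n d)))
    ... | tri≈ _ refl _ = subst₂ (λ u v → Share (φ u) (φ v)) (sym (c′-low ≤-refl)) (sym (c′-high ≤-refl)) sh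
    ... | tri> _ _ gt = subst₂ (λ u v → Share (φ u) (φ v)) (sym (c′-high gt)) (sym (c′-high (ℕ.<-trans gt (ℕ.n<1+n s))))
                          (link (s + d) (ℕ.+-monoˡ-≤ d le))

  entry : ∀ {z s t x u} → Star (Step A In s t) x u → In x ≡ true → ¬ (z ∋ φ x) → z ∋ φ u →
          ∃ λ b → ∃ λ n → Walk z x b n × In b ≡ true × z ∋ φ b × b ≢ s × b ≢ t
  entry ε i o e = contradiction e o
  entry {z} (_◅_ {j = y} (a , iy , ys , yt) rest) i o e with z ∋? φ y
  ... | yes p = y , 0 , single i o (share a) , iy , p , ys , yt
  ... | no ¬p with entry rest iy ¬p e
  ...   | b , n , W , bs = b , suc n , cons i o (share a) W , bs

  Adjacent : List V → Fin K → Set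
  Adjacent as c = All (λ a → Share a (φ c)) as

  -- For each `a` in `as`, the walk from `a` through `W` to `b` is closed by `z`; its `n + 4`
  -- vertices are within the `K + 2` that `triple` admits. A triple inside `W` gives a shortcut. A
  -- triple starting at `a` shows that `a` shares a block with the second vertex of `W`; if this
  -- happens for all of `as`, the walk can start there.
  shorten : ∀ {z x b n} → Good z → (W : Walk z x b (suc n)) → suc n < K → z ∋ φ b → (as : List V) →
            All (z ∋_) as → Adjacent as x → Walk z x b n ⊎ Adjacent as (Walk.c W 1)
  shorten g W lt zb []       []        []          = inj₂ []
  shorten {z} {x} {b} {n} g W lt zb (a ∷ as) (za ∷ zas) (sh ∷ shs)
    with triple (suc n) (s≤s (s≤s lt)) s links (z , g , za , subst (λ v → z ∋ φ v) (sym (Walk.last W)) zb)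
    where
    open Walk W
    s : ℕ → V
    s zero    = a
    s (suc t) = φ (c t)
    links : ∀ l → l < suc (suc (suc n)) → Share (s l) (s (suc l))
    links zero    _        = subst (λ v → Share a (φ v)) (sym first) sh
    links (suc l) (s≤s lt) = link l (ℕ.≤-pred lt)
  ... | suc l , s≤s lt′ , y , gy , p , _ , q =
    inj₁ (splice n 1 (subst (Walk z x b) (ℕ.+-comm 1 n) W) l (ℕ.≤-pred lt′)
      (y , gy , transported p , transported′ q))
    where
    same : ∀ {n n′} (e : n ≡ n′) (W : Walk z x b n) t → Walk.c (subst (Walk z x b) e W) t ≡ Walk.c W t
    same refl W t = refl
    transported : y ∋ φ (Walk.c W l) → y ∋ φ (Walk.c (subst (Walk z x b) (ℕ.+-comm 1 n) W) l)
    transported = subst (λ v → y ∋ φ v) (sym (same (ℕ.+-comm 1 n) W l))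
    transported′ : y ∋ φ (Walk.c W (suc (suc l))) → y ∋ φ (Walk.c (subst (Walk z x b) (ℕ.+-comm 1 n) W) (suc (l + 1)))
    transported′ = subst (λ v → y ∋ φ v) (sym (trans (same (ℕ.+-comm 1 n) W (suc (l + 1))) (cong (λ t → Walk.c W (suc t)) (ℕ.+-comm l 1))))
  ... | zero , _ , y , gy , p , _ , q with shorten g W lt zb as zas shs
  ...   | inj₁ W′  = inj₁ W′
  ...   | inj₂ adj = inj₂ ((y , gy , p , q) ∷ adj)

  -- A shortest walk outside z from x to b, both adjacent to all of as, has length one.
  common : ∀ fuel {z x b} n → Good z → Walk z x b n → n ≤ fuel → z ∋ φ b → (as : List V) →
           All (z ∋_) as → Adjacent as x →
           ∃ λ c → In c ≡ true × ¬ (z ∋ φ c) × Adjacent as c × Share (φ c) (φ b)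
  common fuel {z} {x} {b} zero g W le zb as zas adj =
    x , subst (λ v → In v ≡ true) first (inn 0 z≤n) , subst (λ v → ¬ (z ∋ φ v)) first (out 0 z≤n) , adj ,
    subst₂ (λ u v → Share (φ u) (φ v)) first last (link 0 z≤n)
    where open Walk W
  common (suc fuel) {z} {x} {b} (suc n) g W (s≤s le) zb as zas adj with suc n <? K
  ... | yes lt with shorten g W lt zb as zas adj
  ...   | inj₁ W′   = common fuel n g W′ le zb as zas adj
  ...   | inj₂ adj′ = common fuel n g (tail W) le zb as zas adj′
  common (suc fuel) {z} {x} {b} (suc n) g W (s≤s le) zb as zas adj | no ¬lt
    with F.pigeonhole (ℕ.n<1+n K) (λ i → Walk.c W (toℕ i))
  ... | i , j , i<j , e = common fuel n′ g (splice n′ d W′ t t≤n′ sh) n′≤ zb as zas adj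
    where
    t = toℕ i
    d = toℕ j ∸ t
    j≤n : toℕ j ≤ suc n
    j≤n = ≤-trans (ℕ.≤-pred (F.toℕ<n j)) (ℕ.≮⇒≥ ¬lt)
    t+d : t + d ≡ toℕ j
    t+d = ℕ.m+[n∸m]≡n (ℕ.<⇒≤ i<j)
    n′ = suc n ∸ d
    d≤ : d ≤ suc n
    d≤ = ≤-trans (ℕ.m∸n≤m (toℕ j) t) j≤n
    n′+d : suc n ≡ n′ + d
    n′+d = sym (ℕ.m∸n+n≡m d≤)
    t≤n′ : t ≤ n′
    t≤n′ = ℕ.m+n≤o⇒m≤o∸n t (≤-trans (≤-reflexive t+d) j≤n)
    n′≤ : n′ ≤ fuel
    n′≤ = ≤-trans (ℕ.∸-monoʳ-≤ (suc n) (ℕ.m<n⇒0<n∸m i<j)) le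
    W′ : Walk z x b (n′ + d)
    W′ = subst (Walk z x b) n′+d W
    same : ∀ {n n′} (e : n ≡ n′) (W : Walk z x b n) t → Walk.c (subst (Walk z x b) e W) t ≡ Walk.c W t
    same refl W t = refl
    sh : Share (φ (Walk.c W′ t)) (φ (Walk.c W′ (suc (t + d))))
    sh = subst₂ (λ u v → Share (φ u) (φ v)) (trans (sym e) (sym (same n′+d W t)))
      (trans (cong (λ s → Walk.c W (suc s)) (sym t+d)) (sym (same n′+d W (suc (t + d))))) (Walk.link W (toℕ j) j≤n)

  meet₃ : ∀ {a c b z} → Good z → z ∋ a → z ∋ b → Share a c → Share c b →
          ∃ λ y → Good y × y ∋ a × y ∋ c × y ∋ b
  meet₃ {a} {c} {b} {z} g za zb ac cb with triple 0 (s≤s (s≤s K≥1)) s links (z , g , za , zb)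
    where
    K≥1 : 1 ≤ K
    K≥1 = ≤-trans (s≤s z≤n) (F.toℕ<n (proj₁ big zero))
    s : ℕ → V
    s zero          = a
    s (suc zero)    = c
    s (suc (suc _)) = b
    links : ∀ l → l < 2 → Share (s l) (s (suc l))
    links zero          _ = ac
    links (suc zero)    _ = cb
    links (suc (suc _)) (s≤s (s≤s ()))
  ... | zero  , _      , y , gy , p , q , q′ = y , gy , p , q , q′
  ... | suc _ , s≤s () , _

  record Handle (z : Fin size) : Set where
    constructor handle
    field
      {b₁ b₂ c} : Fin K
      distinct : b₁ ≢ b₂
      in₁      : In b₁ ≡ true
      in₂      : In b₂ ≡ true
      on₁      : z ∋ φ b₁
      on₂      : z ∋ φ b₂
      in-c     : In c ≡ true
      off-c    : ¬ (z ∋ φ c)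
      share₁   : Share (φ b₁) (φ c)
      share₂   : Share (φ c) (φ b₂)

  -- A path from `x` enters `z` at some `b₁`, coming from a vertex `x₀` outside. Deleting `b₁`
  -- leaves a path from `x₀` that enters `z` at another vertex `b₂`, and `common` shrinks it to a
  -- single vertex still sharing a block with `b₁`.
  two : ∀ {z a₁ a₂ x} → Good z → In a₁ ≡ true → In a₂ ≡ true → z ∋ φ a₁ → z ∋ φ a₂ → a₁ ≢ a₂ →
        In x ≡ true → ¬ (z ∋ φ x) → Handle z
  two {z} {a₁} {a₂} {x} g i₁ i₂ z₁ z₂ ne ix ox
    with pick x a₁
  ... | s , _ , s≢x , s≢a₁
    with entry {z = z} (conn s s x a₁ ix i₁ (s≢x ∘ sym) (s≢x ∘ sym) (s≢a₁ ∘ sym) (s≢a₁ ∘ sym)) ix ox z₁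
  ... | b₁ , n , W , ib₁ , zb₁ , _ = second
    where
    open Walk W
    x₀ = c n
    i₀ = inn n ≤-refl
    o₀ = out n ≤-refl
    x₀≢b₁ : x₀ ≢ b₁
    x₀≢b₁ e = o₀ (subst (λ v → z ∋ φ v) (sym e) zb₁)
    sh₀ : Share (φ b₁) (φ x₀)
    sh₀ = share-sym (subst (λ v → Share (φ x₀) (φ v)) last (link n ≤-refl))
    target : ∃ λ u → In u ≡ true × z ∋ φ u × u ≢ b₁
    target with a₁ F.≟ b₁
    ... | no  p = a₁ , i₁ , z₁ , p
    ... | yes p = a₂ , i₂ , z₂ , λ e → ne (trans p (sym e))
    second : Handle z
    second with target
    ... | u , iu , zu , u≢b₁ with entry {z = z} (conn b₁ b₁ x₀ u i₀ iu x₀≢b₁ x₀≢b₁ u≢b₁ u≢b₁) i₀ o₀ zu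
    ...   | b₂ , n₂ , W₂ , ib₂ , zb₂ , b₂≢b₁ , _
      with common n₂ n₂ g W₂ ≤-refl zb₂ (φ b₁ ∷ []) (zb₁ ∷ []) (sh₀ ∷ [])
    ...   | c , ic , oc , sh ∷ [] , sh′ = handle {c = c} (b₂≢b₁ ∘ sym) ib₁ ib₂ zb₁ zb₂ ic oc sh sh′

  -- One block contains `u₁`, `d`, `u₂`, another `u₁`, `d`, `u₃`; `helly` then pulls `d` into `z`.
  three-neighbours : ∀ {z u₁ u₂ u₃ d} → Good z → z ∋ u₁ → z ∋ u₂ → z ∋ u₃ → u₁ ≢ u₂ → u₁ ≢ u₃ → u₂ ≢ u₃ →
                     ¬ (z ∋ φ d) → Share u₁ (φ d) → Share u₂ (φ d) → Share u₃ (φ d) → ⊥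
  three-neighbours {z} {u₁} {u₂} {u₃} {d} g z₁ z₂ z₃ ne₁₂ ne₁₃ ne₂₃ od s₁ s₂ s₃ =
    conclude (meet₃ {u₁} {φ d} {u₂} g z₁ z₂ s₁ (share-sym s₂)) (meet₃ {u₁} {φ d} {u₃} g z₁ z₃ s₁ (share-sym s₃))
    where
    out : ∀ {v} → z ∋ v → φ d ≢ v
    out zv e = od (subst (z ∋_) (sym e) zv)
    conclude : (∃ λ y → Good y × y ∋ u₁ × y ∋ φ d × y ∋ u₂) → (∃ λ y → Good y × y ∋ u₁ × y ∋ φ d × y ∋ u₃) → ⊥
    conclude (y₁ , g₁ , p₁ , p₂ , p₃) (y₂ , g₂ , q₁ , q₂ , q₃) =
      od (helly {z} {y₁} {y₂} {u₁} {u₂} {u₃} {φ d} g z₁ z₂ z₃ p₁ p₃ p₂ q₁ q₃ q₂ g₁ g₂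
        ne₁₂ ne₁₃ ne₂₃ (out z₁) (out z₂) (out z₃))

  -- Here 3-connectivity enters in full: with `b₁` and `b₂` deleted, the outer vertex of the handle
  -- still reaches `z`, at a third vertex, and `common` produces one outer vertex sharing blocks
  -- with all three.
  three-⊥ : ∀ {z a₁ a₂ a₃ x} → Good z → In a₁ ≡ true → In a₂ ≡ true → In a₃ ≡ true →
            z ∋ φ a₁ → z ∋ φ a₂ → z ∋ φ a₃ → a₁ ≢ a₂ → a₁ ≢ a₃ → a₂ ≢ a₃ →
            In x ≡ true → ¬ (z ∋ φ x) → ⊥
  three-⊥ {z} {a₁} {a₂} {a₃} g i₁ i₂ i₃ z₁ z₂ z₃ ne₁₂ ne₁₃ ne₂₃ ix ox
    = from (two {z} g i₁ i₂ z₁ z₂ ne₁₂ ix ox)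
    where
    from : Handle z → ⊥
    from (handle {b₁} {b₂} {c} b₁≢b₂ ib₁ ib₂ zb₁ zb₂ ic oc sh₁ sh₂) =
      finish (third {P = λ u → In u ≡ true × z ∋ φ u} b₁ b₂ ne₁₂ ne₁₃ ne₂₃ (i₁ , z₁) (i₂ , z₂) (i₃ , z₃))
      where
      out≢ : ∀ {v} → z ∋ φ v → c ≢ v
      out≢ zv e = oc (subst (λ v → z ∋ φ v) (sym e) zv)
      last-step : ∀ {b₃ n} → Walk z c b₃ n × In b₃ ≡ true × z ∋ φ b₃ × b₃ ≢ b₁ × b₃ ≢ b₂ → ⊥
      last-step {b₃} {n} (W , _ , zb₃ , b₃≢b₁ , b₃≢b₂) =
        conclude (common n n g W ≤-refl zb₃ (φ b₁ ∷ φ b₂ ∷ []) (zb₁ ∷ zb₂ ∷ []) (sh₁ ∷ share-sym sh₂ ∷ []))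
        where
        conclude : (∃ λ d → In d ≡ true × ¬ (z ∋ φ d) × Adjacent (φ b₁ ∷ φ b₂ ∷ []) d × Share (φ d) (φ b₃)) → ⊥
        conclude (d , _ , od , s₁ ∷ s₂ ∷ [] , s₃) = three-neighbours {z} {φ b₁} {φ b₂} {φ b₃} {d} g zb₁ zb₂ zb₃
          (b₁≢b₂ ∘ φ-inj) (b₃≢b₁ ∘ sym ∘ φ-inj) (b₃≢b₂ ∘ sym ∘ φ-inj) od s₁ s₂ (share-sym s₃)
      finish : (∃ λ u → (In u ≡ true × z ∋ φ u) × u ≢ b₁ × u ≢ b₂) → ⊥
      finish (u , (iu , zu) , u≢b₁ , u≢b₂) = last-step (proj₂ (proj₂
        (entry {z = z} (conn b₁ b₂ c u ic iu (out≢ zb₁) (out≢ zb₂) u≢b₁ u≢b₂) ic oc zu)))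

  edge : ∃ λ x → ∃ λ y → In x ≡ true × In y ≡ true × A x y
  edge with pick (proj₁ big zero) (proj₁ big zero)
  ... | x , ix , x≢h , _ with pick x (proj₁ big zero)
  ...   | s , is , s≢x , s≢h = go (conn s s x h ix (proj₂ (proj₂ big) zero) (s≢x ∘ sym) (s≢x ∘ sym) (s≢h ∘ sym) (s≢h ∘ sym)) x≢h
    where
    h = proj₁ big zero
    go : ∀ {y} → Star (Step A In s s) x y → x ≢ y → ∃ λ x → ∃ λ y → In x ≡ true × In y ≡ true × A x y
    go ε x≢x = contradiction refl x≢x
    go ((a , iy , _) ◅ _) _ = x , _ , ix , iy , a

  -- The three vertices of a handle lie in one block by `meet₃`, and by `three-⊥` a block with three
  -- vertices of the set contains the whole set.
  triangle : ∀ {z x y w} → Good z → In x ≡ true → In y ≡ true → z ∋ φ x → z ∋ φ y → x ≢ y →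
             In w ≡ true → ¬ (z ∋ φ w) → ∃ λ z′ → Good z′ × ∀ x → In x ≡ true → z′ ∋ φ x
  triangle {z} g ix iy zx zy ne iw ow = from (two g ix iy zx zy ne iw ow)
    where
    from : Handle z → ∃ λ z′ → Good z′ × ∀ x → In x ≡ true → z′ ∋ φ x
    from (handle {b₁} {b₂} {c} b₁≢b₂ ib₁ ib₂ zb₁ zb₂ ic oc sh₁ sh₂) = block (meet₃ {φ b₁} {φ c} {φ b₂} g zb₁ zb₂ sh₁ sh₂)
      where
      out≢ : ∀ {v} → z ∋ φ v → c ≢ v
      out≢ zv e = oc (subst (λ v → z ∋ φ v) (sym e) zv)
      block : (∃ λ y → Good y × y ∋ φ b₁ × y ∋ φ c × y ∋ φ b₂) → ∃ λ z′ → Good z′ × ∀ x → In x ≡ true → z′ ∋ φ x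
      block (y , gy , p , q , q′) = y , gy , λ w iw → decidable-stable (y ∋? φ w)
        (three-⊥ gy ib₁ ib₂ ic p q′ q b₁≢b₂ (out≢ zb₁ ∘ sym) (out≢ zb₂ ∘ sym) iw)

  confined : ∃ λ z → Good z × ∀ x → In x ≡ true → z ∋ φ x
  confined = from edge
    where
    from : (∃ λ x → ∃ λ y → In x ≡ true × In y ≡ true × A x y) → ∃ λ z → Good z × ∀ x → In x ≡ true → z ∋ φ x
    from (x , y , ix , iy , a) = start (share a)
      where
      start : Share (φ x) (φ y) → ∃ λ z → Good z × ∀ x → In x ≡ true → z ∋ φ x
      start (z , g , zx , zy) = decide (any? (λ w → (In w Bool.≟ true) ×-dec ¬? (z ∋? φ w)))
        where
        decide : Dec (∃ λ w → In w ≡ true × ¬ (z ∋ φ w)) → ∃ λ z → Good z × ∀ x → In x ≡ true → z ∋ φ x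
        decide (no none)           = z , g , λ w iw → decidable-stable (z ∋? φ w) λ o → none (w , iw , o)
        decide (yes (w , iw , ow)) = triangle g ix iy zx zy (λ e → irr x (subst (A x) (sym e) a)) iw ow

-- The core

eq?-true : ∀ {n} {x y : Fin n} → eq? x y ≡ true → x ≡ y
eq?-true {x = x} {y} p with x F.≟ y
... | yes q = q

eq?-refl : ∀ {n} (x : Fin n) → eq? x x ≡ true
eq?-refl x = dec-true (x F.≟ x) refl

eq?-false : ∀ {n} {x y : Fin n} → x ≢ y → eq? x y ≡ false
eq?-false {x = x} {y} ne = dec-false (x F.≟ y) ne

sameEdge-true : ∀ {n} {a b x y : Fin n} → sameEdge a b x y ≡ true → (x ≡ a × y ≡ b) ⊎ (x ≡ b × y ≡ a)
sameEdge-true {a = a} {b} {x} {y} p with x F.≟ a | y F.≟ b | x F.≟ b | y F.≟ a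
... | yes q | yes q′ | _      | _      = inj₁ (q , q′)
... | yes _ | no  _  | yes q  | yes q′ = inj₂ (q , q′)
... | no  _ | _      | yes q  | yes q′ = inj₂ (q , q′)
... | yes _ | no _   | yes _  | no _   = contradiction p λ ()
... | yes _ | no _   | no _   | _      = contradiction p λ ()
... | no  _ | _      | yes _  | no _   = contradiction p λ ()
... | no  _ | _      | no _   | _      = contradiction p λ ()

sameEdge-intro : ∀ {n} {a b x y : Fin n} → (x ≡ a × y ≡ b) ⊎ (x ≡ b × y ≡ a) → sameEdge a b x y ≡ true
sameEdge-intro {a = a} {b} (inj₁ (refl , refl)) rewrite eq?-refl a | eq?-refl b = refl
sameEdge-intro {a = a} {b} (inj₂ (refl , refl)) rewrite eq?-refl a | eq?-refl b = Bool.∨-zeroʳ _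

side : ∀ {n} → Bool → FinGraph n → FinGraph n
side false H = H
side true  H = complement H

complement-adj : ∀ {n} (H : FinGraph n) {x y} → x ≢ y → adj (complement H) x y ≡ not (adj H x y)
complement-adj H ne rewrite eq?-false ne = refl

side-not : ∀ {n} s (H : FinGraph n) {x y} → x ≢ y → adj (side (not s) H) x y ≡ not (adj (side s H) x y)
side-not false H ne = complement-adj H ne
side-not true  H {x} {y} ne = sym (trans (cong not (complement-adj H ne)) (not-involutive (adj H x y)))

Edge : ∀ {n} → FinGraph n → Fin n → Fin n → Set
Edge J x y = adj J x y ≡ true

edge-irrefl : ∀ {n} (J : FinGraph n) {x y} → Edge J x y → x ≢ y
edge-irrefl J {x} e refl = case trans (sym e) (irrefl J x) of λ ()

flip : ∀ {n} → FinGraph n → (a b : Fin n) → Fin n → Fin n → Bool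
flip J a b x y = if sameEdge a b x y then not (adj J x y) else adj J x y

flip-same : ∀ {n} (J : FinGraph n) a b {x y} → sameEdge a b x y ≡ true → flip J a b x y ≡ not (adj J x y)
flip-same J a b p rewrite p = refl

flip-other : ∀ {n} (J : FinGraph n) a b {x y} → sameEdge a b x y ≡ false → flip J a b x y ≡ adj J x y
flip-other J a b p rewrite p = refl

record Embeds {n} (J : FinGraph n) (In : Fin n → Bool) (B : Fin n → Fin n → Bool) (ψ : Fin n → Fin n) : Set where
  field
    injective : ∀ x y → In x ≡ true → In y ≡ true → ψ x ≡ ψ y → x ≡ y
    preserves : ∀ x y → In x ≡ true → In y ≡ true → adj J x y ≡ B (ψ x) (ψ y)

embeds? : ∀ {n} (J : FinGraph n) In B → Dec (∃ (Embeds J In B))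
embeds? {n} J In B with any? {n = n ^ n} (λ c →
    all? (λ x → all? (λ y → (In x Bool.≟ true) →-dec (In y Bool.≟ true) →-dec
      (finToFun {n} {n} c x F.≟ finToFun {n} {n} c y) →-dec (x F.≟ y)))
    ×-dec
    all? (λ x → all? (λ y → (In x Bool.≟ true) →-dec (In y Bool.≟ true) →-dec
      (adj J x y Bool.≟ B (finToFun {n} {n} c x) (finToFun {n} {n} c y)))))
... | yes (c , i , p) = yes (finToFun {n} {n} c , record { injective = i ; preserves = p })
... | no ¬c = no λ (ψ , e) → ¬c (funToFin {n} {n} ψ ,
      (λ x y ix iy p → Embeds.injective e x y ix iy
        (trans (sym (finToFun-funToFin {n} {n} ψ x)) (trans p (finToFun-funToFin {n} {n} ψ y)))) ,
      (λ x y ix iy → trans (Embeds.preserves e x y ix iy)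
        (sym (cong₂ B (finToFun-funToFin {n} {n} ψ x) (finToFun-funToFin {n} {n} ψ y)))))

-- Flipping the pair a b of side s H gives the block of the construction: flipping
-- it back restores side s H, but the block itself does not even contain In.
record Core {n} (H : FinGraph n) : Set where
  field
    s     : Bool
    In    : Fin n → Bool
    big   : Big 5 In
    conn  : ThreeConn (Edge (side s H)) In
    a b   : Fin n
    a≢b   : a ≢ b
    pair  : adj (side s H) a b ≡ s
    none  : ∀ ψ → ¬ Embeds (side s H) In (flip (side s H) a b) ψ

∨-true : ∀ {p q} → p ∨ q ≡ true → p ≡ true ⊎ q ≡ true
∨-true {true}  _ = inj₁ refl
∨-true {false} p = inj₂ p

∨-left : ∀ {p q} → p ≡ true → p ∨ q ≡ true
∨-left refl = refl

∨-right : ∀ {p q} → q ≡ true → p ∨ q ≡ true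
∨-right {p} refl = Bool.∨-zeroʳ p

∧-true : ∀ {p q} → p ∧ q ≡ true → p ≡ true × q ≡ true
∧-true {true} p = refl , p

∧-intro : ∀ {p q} → p ≡ true → q ≡ true → p ∧ q ≡ true
∧-intro refl refl = refl

big-≤ : ∀ {n p q} {In : Fin n → Bool} → p ≤ q → Big q In → Big p In
big-≤ le (h , inj , sub) = (λ i → h (inject≤ i le)) , (λ e → F.inject≤-injective le le _ _ (inj e)) , λ i → sub _

_∖_ : ∀ {n} → (Fin n → Bool) → Fin n → Fin n → Bool
(In ∖ u) x = In x ∧ not (eq? x u)

∖-in : ∀ {n} {In : Fin n → Bool} {u x} → In x ≡ true → x ≢ u → (In ∖ u) x ≡ true
∖-in p ne = ∧-intro p (cong not (eq?-false ne))

∖-out : ∀ {n} {In : Fin n → Bool} {u x} → (In ∖ u) x ≡ true → In x ≡ true × x ≢ u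
∖-out {In = In} {u} {x} p with ∧-true {In x} p
... | q , r = q , λ e → case trans (sym r) (cong not (trans (cong (λ v → eq? v u) e) (eq?-refl u))) of λ ()

big-∖ : ∀ {n p} {In : Fin n → Bool} u → Big (suc p) In → Big p (In ∖ u)
big-∖ {n} {p} {In} u (h , inj , sub) with any? (λ i → h i F.≟ u)
... | yes (i , e) = (λ j → h (punchIn i j)) , (λ q → punchIn-injective i _ _ (inj q)) ,
      λ j → ∖-in {In = In} (sub _) λ q → punchInᵢ≢i i j (inj (trans q (sym e)))
... | no ¬p = (λ j → h (suc j)) , (λ q → F.suc-injective (inj q)) , λ j → ∖-in {In = In} (sub _) λ q → ¬p (suc j , q)

big-∪ : ∀ {n p q} {In In′ : Fin n → Bool} → Big p In → Big q In′ →
        (∀ x → In x ≡ true → In′ x ≡ true → ⊥) → Big (p + q) (λ x → In x ∨ In′ x)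
big-∪ {n} {p} {q} {In} {In′} (h , inj , sub) (h′ , inj′ , sub′) disj =
  (λ i → g (splitAt p i)) , (λ {i} {j} e → splitAt-injective i j (g-inj (splitAt p i) (splitAt p j) e)) , λ i → g-in (splitAt p i)
  where
  splitAt-injective : ∀ (i j : Fin (p + q)) → splitAt p i ≡ splitAt p j → i ≡ j
  splitAt-injective i j e = trans (sym (F.join-splitAt p q i)) (trans (cong (join p q) e) (F.join-splitAt p q j))
  g : Fin p ⊎ Fin q → Fin n
  g (inj₁ i) = h i
  g (inj₂ j) = h′ j
  g-in : ∀ u → In (g u) ∨ In′ (g u) ≡ true
  g-in (inj₁ i) = ∨-left (sub i)
  g-in (inj₂ j) = ∨-right {In (h′ j)} (sub′ j)
  g-inj : ∀ u v → g u ≡ g v → u ≡ v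
  g-inj (inj₁ i) (inj₁ j) e = cong inj₁ (inj e)
  g-inj (inj₂ i) (inj₂ j) e = cong inj₂ (inj′ e)
  g-inj (inj₁ i) (inj₂ j) e = ⊥-elim (disj (h i) (sub i) (subst (λ x → In′ x ≡ true) (sym e) (sub′ j)))
  g-inj (inj₂ i) (inj₁ j) e = ⊥-elim (disj (h j) (sub j) (subst (λ x → In′ x ≡ true) e (sub′ i)))

module Reembedding {n : ℕ} (J : FinGraph n) (In : Fin n → Bool) (conn : ThreeConn (Edge J) In)
             (big : Big 5 In) (a b : Fin n) (a≢b : a ≢ b) (ia : In a ≡ true) (ib : In b ≡ true)
             (ψ : Fin n → Fin n) (emb : Embeds J In (flip J a b) ψ) where

  open Embeds emb

  W? : ∀ y → Dec (∃ λ x → In x ≡ true × ψ x ≡ y)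
  W? y = any? λ x → (In x Bool.≟ true) ×-dec (ψ x F.≟ y)

  W : Fin n → Bool
  W y = does (W? y)

  W-in : ∀ {x} → In x ≡ true → W (ψ x) ≡ true
  W-in {x} i = dec-true (W? (ψ x)) (x , i , refl)

  W-out : ∀ {y} → W y ≡ true → ∃ λ x → In x ≡ true × ψ x ≡ y
  W-out {y} p with W? y
  ... | yes q = q

  big-W : ∀ {p} → Big p In → Big p W
  big-W (h , inj , sub) = ψ ∘ h , (λ e → inj (injective _ _ (sub _) (sub _) e)) , λ i → W-in (sub i)

  iter-ψ-cancel : (∀ x → In x ≡ true → In (ψ x) ≡ true) → ∀ s {x y} → In x ≡ true → In y ≡ true →
                  iter s ψ x ≡ iter s ψ y → x ≡ y
  iter-ψ-cancel st zero    ix iy e = e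
  iter-ψ-cancel st (suc s) ix iy e = injective _ _ ix iy (iter-ψ-cancel st s (st _ ix) (st _ iy) e)

  -- Iterating ψ on the pair a b would give a periodic orbit of pairs of the same
  -- colour as a b, but no pair of that colour is mapped to a b.
  escapes : ∃ λ y → W y ≡ true × In y ≡ false
  escapes with any? (λ y → (W y Bool.≟ true) ×-dec (In y Bool.≟ false))
  ... | yes p = p
  ... | no none = ⊥-elim contra
    where
    stable : ∀ x → In x ≡ true → In (ψ x) ≡ true
    stable x i with In (ψ x) in e
    ... | true  = refl
    ... | false = contradiction (ψ x , W-in i , e) none
    inn : ∀ s {x} → In x ≡ true → In (iter s ψ x) ≡ true
    inn zero    i = i
    inn (suc s) i = inn s (stable _ i)
    colour : ∀ x y → In x ≡ true → In y ≡ true → adj J x y ≡ adj J a b →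
             sameEdge a b (ψ x) (ψ y) ≡ false × adj J (ψ x) (ψ y) ≡ adj J a b
    colour x y ix iy e = go (sameEdge a b (ψ x) (ψ y)) refl
      where
      go : ∀ t → sameEdge a b (ψ x) (ψ y) ≡ t → sameEdge a b (ψ x) (ψ y) ≡ false × adj J (ψ x) (ψ y) ≡ adj J a b
      go false p = p , trans (sym (flip-other J a b p)) (trans (sym (preserves x y ix iy)) e)
      go true  p = contradiction (trans (trans (sym e) (trans (preserves x y ix iy) (flip-same J a b p))) (cong not same))
                                 (not-¬ refl)
        where
        same : adj J (ψ x) (ψ y) ≡ adj J a b
        same with sameEdge-true {a = a} {b} p
        ... | inj₁ (q , q′) = cong₂ (adj J) q q′
        ... | inj₂ (q , q′) = trans (cong₂ (adj J) q q′) (symm J b a)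
    orbit : ∀ s x y → In x ≡ true → In y ≡ true → adj J x y ≡ adj J a b →
            sameEdge a b (iter (suc s) ψ x) (iter (suc s) ψ y) ≡ false
    orbit zero    x y ix iy e = proj₁ (colour x y ix iy e)
    orbit (suc s) x y ix iy e = orbit s (ψ x) (ψ y) (stable x ix) (stable y iy) (proj₂ (colour x y ix iy e))
    N = n * n
    code : Fin (suc N) → Fin N
    code i = combine (iter (toℕ i) ψ a) (iter (toℕ i) ψ b)
    contra : ⊥
    contra with F.pigeonhole (ℕ.n<1+n N) code
    ... | i , j , i<j , e with F.combine-injective (iter (toℕ i) ψ a) (iter (toℕ i) ψ b) _ _ e
    ...   | ea , eb = final (toℕ j ∸ toℕ i) refl
      where
      back : ∀ {x} → In x ≡ true → ∀ d → toℕ j ∸ toℕ i ≡ d → iter (toℕ i) ψ x ≡ iter (toℕ j) ψ x → x ≡ iter d ψ x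
      back {x} ix d refl p = iter-ψ-cancel stable (toℕ i) ix (inn d ix)
        (trans p (trans (cong (λ s → iter s ψ x) (sym (ℕ.m∸n+n≡m (ℕ.<⇒≤ i<j)))) (iter-+ ψ d (toℕ i) x)))
      final : ∀ d → toℕ j ∸ toℕ i ≡ d → ⊥
      final zero    p = ℕ.<-irrefl refl (subst (0 <_) p (ℕ.m<n⇒0<n∸m i<j))
      final (suc d) p = case trans (sym (orbit d a b ia ib refl))
          (sameEdge-intro {a = a} {b} (inj₁ (sym (back ia (suc d) p ea) , sym (back ib (suc d) p eb)))) of λ ()

  Cross : Fin n → Fin n → Set
  Cross u v = ∃ λ x → ∃ λ y → (In x ≡ true × x ≢ u × x ≢ v) × (W y ≡ true × y ≢ u × y ≢ v) × (x ≡ y ⊎ Edge J x y)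

  cross? : ∀ u v → Dec (Cross u v)
  cross? u v = any? λ x → any? λ y →
    ((In x Bool.≟ true) ×-dec ¬? (x F.≟ u) ×-dec ¬? (x F.≟ v)) ×-dec
    ((W y Bool.≟ true) ×-dec ¬? (y F.≟ u) ×-dec ¬? (y F.≟ v)) ×-dec
    ((x F.≟ y) ⊎-dec (adj J x y Bool.≟ true))

  crossing? : (∀ u v → Cross u v) ⊎ (∃ λ u → ∃ λ v → ¬ Cross u v)
  crossing? with any? (λ u → any? (λ v → ¬? (cross? u v)))
  ... | yes p = inj₂ p
  ... | no ¬p = inj₁ λ u v → case cross? u v of λ where
    (yes q) → q
    (no ¬q) → ⊥-elim (¬p (u , v , ¬q))

  U : Fin n → Bool
  U x = In x ∨ W x

  U-W : ∀ {x} → W x ≡ true → U x ≡ true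
  U-W {x} = ∨-right {In x}

  big-U : ∀ {p} → Big p In → Big (suc p) U
  big-U {p} (h , inj , sub) with escapes
  ... | y , wy , oy = g , g-inj , g-in
    where
    g : Fin (suc p) → Fin n
    g zero    = y
    g (suc i) = h i
    g-in : ∀ i → U (g i) ≡ true
    g-in zero    = U-W wy
    g-in (suc i) = ∨-left (sub i)
    y∉ : ∀ i → y ≢ h i
    y∉ i e = case trans (sym oy) (trans (cong In e) (sub i)) of λ ()
    g-inj : ∀ {i j} → g i ≡ g j → i ≡ j
    g-inj {zero}  {zero}  _ = refl
    g-inj {zero}  {suc j} e = contradiction e (y∉ j)
    g-inj {suc i} {zero}  e = contradiction (sym e) (y∉ i)
    g-inj {suc i} {suc j} e = cong suc (inj e)

  module Union (cross : ∀ u v → Cross u v) where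

    Out : Fin n → Fin n → Fin n → Set
    Out u v x = x ≢ u × x ≢ v

    pathIn : ∀ u v {x y} → In x ≡ true → In y ≡ true → Out u v x → Out u v y → Star (Step (Edge J) U u v) x y
    pathIn u v {x} {y} ix iy (p , p′) (q , q′) =
      Star.map (λ (e , i , o) → e , ∨-left i , o) (conn u v x y ix iy p p′ q q′)

    -- Deleting `u` from the copy means deleting its preimage from `In`; if there is none, any
    -- vertex other than `x` and `y` serves instead.
    preimage : ∀ u {x y} → ψ x ≢ u → ψ y ≢ u → ∃ λ u′ → x ≢ u′ × y ≢ u′ × (∀ z → In z ≡ true → z ≢ u′ → ψ z ≢ u)
    preimage u {x} {y} nx ny with any? (λ z → (In z Bool.≟ true) ×-dec (ψ z F.≟ u))
    ... | yes (z , iz , e) = z , (λ q → nx (trans (cong ψ q) e)) , (λ q → ny (trans (cong ψ q) e)) ,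
          λ z′ iz′ ne e′ → ne (injective z′ z iz′ iz (trans e′ (sym e)))
    ... | no ¬p with avoid {In = In} (s≤s (s≤s (s≤s z≤n))) big f
      where
      f : Fin 2 → Fin n
      f zero    = x
      f (suc _) = y
    ...   | z , _ , ne = z , ne zero ∘ sym , ne (suc zero) ∘ sym , λ z′ iz′ _ e → ¬p (z′ , iz′ , e)

    -- The copy lives in the flipped graph, so an edge landing on the pair `a b` may be missing in
    -- `J`; since `a` and `b` belong to `In`, a path through `In` replaces it.
    stepW : ∀ u v {x y} → In x ≡ true → In y ≡ true → Out u v (ψ x) → Out u v (ψ y) → Edge J x y →
            Star (Step (Edge J) U u v) (ψ x) (ψ y)
    stepW u v {x} {y} ix iy ox oy e = go (sameEdge a b (ψ x) (ψ y)) refl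
      where
      fl : flip J a b (ψ x) (ψ y) ≡ true
      fl = trans (sym (preserves x y ix iy)) e
      go : ∀ t → sameEdge a b (ψ x) (ψ y) ≡ t → Star (Step (Edge J) U u v) (ψ x) (ψ y)
      go false p = (trans (sym (flip-other J a b p)) fl , U-W (W-in iy) , oy) ◅ ε
      go true  p with sameEdge-true {a = a} {b} p
      ... | inj₁ (q , q′) = pathIn u v (subst (λ z → In z ≡ true) (sym q) ia) (subst (λ z → In z ≡ true) (sym q′) ib) ox oy
      ... | inj₂ (q , q′) = pathIn u v (subst (λ z → In z ≡ true) (sym q) ib) (subst (λ z → In z ≡ true) (sym q′) ia) ox oy

    pathW : ∀ u v {x y} → W x ≡ true → W y ≡ true → Out u v x → Out u v y → Star (Step (Edge J) U u v) x y
    pathW u v wx wy ox oy with W-out wx | W-out wy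
    ... | x , ix , refl | y , iy , refl
      with preimage u {x} {y} (proj₁ ox) (proj₁ oy) | preimage v {x} {y} (proj₂ ox) (proj₂ oy)
    ... | u′ , xu , yu , outu | v′ , xv , yv , outv = go ix ox (conn u′ v′ x y ix iy xu xv yu yv)
      where
      go : ∀ {x} → In x ≡ true → Out u v (ψ x) → Star (Step (Edge J) In u′ v′) x y → Star (Step (Edge J) U u v) (ψ x) (ψ y)
      go ix ox ε = ε
      go ix ox ((e , iz , zu , zv) ◅ rest) = stepW u v ix iz ox oz e ◅◅ go iz oz rest
        where
        oz = outu _ iz zu , outv _ iz zv

    union-conn : ThreeConn (Edge J) U
    union-conn u v x y ux uy p p′ q q′ with cross u v
    ... | c , d , (ic , oc) , (wd , od) , cd = go (∨-true ux) (∨-true uy)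
      where
      forth : Star (Step (Edge J) U u v) c d
      forth = case cd of λ where
        (inj₁ refl) → ε
        (inj₂ e)    → (e , U-W wd , od) ◅ ε
      back : Star (Step (Edge J) U u v) d c
      back = case cd of λ where
        (inj₁ refl) → ε
        (inj₂ e)    → (trans (symm J d c) e , ∨-left ic , oc) ◅ ε
      go : In x ≡ true ⊎ W x ≡ true → In y ≡ true ⊎ W y ≡ true → Star (Step (Edge J) U u v) x y
      go (inj₁ ix) (inj₁ iy) = pathIn u v ix iy (p , p′) (q , q′)
      go (inj₂ wx) (inj₂ wy) = pathW u v wx wy (p , p′) (q , q′)
      go (inj₁ ix) (inj₂ wy) = pathIn u v ix ic (p , p′) oc ◅◅ forth ◅◅ pathW u v wd wy od (q , q′)
      go (inj₂ wx) (inj₁ iy) = pathW u v wx wd (p , p′) od ◅◅ back ◅◅ pathIn u v ic iy oc (q , q′)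

  module Join (J′ : FinGraph n) (opposite : ∀ {x y} → x ≢ y → adj J′ x y ≡ not (adj J x y))
              (u v : Fin n) (no-cross : ¬ Cross u v) {p₀ : ℕ} (big-In : Big (suc (suc (suc (suc (suc p₀))))) In) where

    L R U′ : Fin n → Bool
    L = (In ∖ u) ∖ v
    R = (W ∖ u) ∖ v
    U′ x = L x ∨ R x

    L-out : ∀ {x} → L x ≡ true → In x ≡ true × x ≢ u × x ≢ v
    L-out {x} l with ∖-out {In = In ∖ u} l
    ... | q , r with ∖-out {In = In} q
    ...   | q′ , r′ = q′ , r′ , r

    R-out : ∀ {x} → R x ≡ true → W x ≡ true × x ≢ u × x ≢ v
    R-out {x} l with ∖-out {In = W ∖ u} l
    ... | q , r with ∖-out {In = W} q
    ...   | q′ , r′ = q′ , r′ , r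

    apart : ∀ {x y} → L x ≡ true → R y ≡ true → x ≢ y
    apart l r e = no-cross (_ , _ , L-out l , R-out r , inj₁ e)

    joined : ∀ {x y} → L x ≡ true → R y ≡ true → Edge J′ x y
    joined {x} {y} l r = trans (opposite (apart l r)) (cong not (helper (adj J x y) refl))
      where
      helper : ∀ t → adj J x y ≡ t → adj J x y ≡ false
      helper false e = e
      helper true  e = ⊥-elim (no-cross (_ , _ , L-out l , R-out r , inj₂ e))

    big-L : Big (suc (suc (suc p₀))) L
    big-L = big-∖ {In = In ∖ u} v (big-∖ {In = In} u big-In)

    big-R : Big (suc (suc (suc p₀))) R
    big-R = big-∖ {In = W ∖ u} v (big-∖ {In = W} u (big-W big-In))

    -- With `p = 5 + p₀`, each side keeps at least `p - 2` vertices, and `2 (p - 2) ≥ p + 1` because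
    -- `p ≥ 5`.
    big-U′ : Big (suc (suc (suc (suc (suc (suc p₀)))))) U′
    big-U′ = big-≤ {In = U′} (≤-trans (ℕ.m≤n+m (6 + p₀) p₀) (≤-reflexive arith)) (big-∪ {In = L} {R} big-L big-R λ x l r → apart l r refl)
      where
      arith : p₀ + (6 + p₀) ≡ (3 + p₀) + (3 + p₀)
      arith = trans (ℕ.+-suc p₀ (5 + p₀)) (trans (cong suc (trans (ℕ.+-suc p₀ (4 + p₀)) (cong suc (ℕ.+-suc p₀ (3 + p₀))))) refl)

    -- Both sides have at least three vertices, so after two deletions each still offers a middle
    -- vertex for paths of length two.
    conn′ : ThreeConn (Edge J′) U′
    conn′ c d x y ux uy p p′ q q′ = go (∨-true ux) (∨-true uy)
      where
      f : Fin 2 → Fin n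
      f zero    = c
      f (suc _) = d
      free : ∀ {X} → Big (suc (suc (suc p₀))) X → ∃ λ z → X z ≡ true × z ≢ c × z ≢ d
      free {X} bX with avoid {In = X} (s≤s (s≤s (s≤s z≤n))) bX f
      ... | z , iz , ne = z , iz , ne zero , ne (suc zero)
      l = free {L} big-L
      r = free {R} big-R
      lr : ∀ {x y} → L x ≡ true → R y ≡ true → y ≢ c → y ≢ d → Step (Edge J′) U′ c d x y
      lr {x} {y} lx ry yc yd = joined lx ry , ∨-right {L y} ry , yc , yd
      rl : ∀ {x y} → R x ≡ true → L y ≡ true → y ≢ c → y ≢ d → Step (Edge J′) U′ c d x y
      rl {x} {y} rx ly yc yd = trans (symm J′ x y) (joined ly rx) , ∨-left ly , yc , yd
      go : L x ≡ true ⊎ R x ≡ true → L y ≡ true ⊎ R y ≡ true → Star (Step (Edge J′) U′ c d) x y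
      go (inj₁ lx) (inj₂ ry) = lr lx ry q q′ ◅ ε
      go (inj₂ rx) (inj₁ ly) = rl rx ly q q′ ◅ ε
      go (inj₁ lx) (inj₁ ly) = lr lx (proj₁ (proj₂ r)) (proj₁ (proj₂ (proj₂ r))) (proj₂ (proj₂ (proj₂ r))) ◅
                               rl (proj₁ (proj₂ r)) ly q q′ ◅ ε
      go (inj₂ rx) (inj₂ ry) = rl rx (proj₁ (proj₂ l)) (proj₁ (proj₂ (proj₂ l))) (proj₂ (proj₂ (proj₂ l))) ◅
                               lr (proj₁ (proj₂ l)) ry q q′ ◅ ε

    -- `In` stays connected in `J` without `u` and `v`, so `J` has an edge inside `L`. This keeps
    -- the new set non-complete when the search changes sides.
    nonadjacent : ∃ λ x → ∃ λ y → U′ x ≡ true × U′ y ≡ true × x ≢ y × adj J′ x y ≡ false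
    nonadjacent with big-L
    ... | h , inj , sub = go (conn u v (h zero) (h (suc zero)) (proj₁ l₀) (proj₁ l₁)
                              (proj₁ (proj₂ l₀)) (proj₂ (proj₂ l₀)) (proj₁ (proj₂ l₁)) (proj₂ (proj₂ l₁)))
                             λ e → case inj e of λ ()
      where
      l₀ = L-out (sub zero)
      l₁ = L-out (sub (suc zero))
      go : ∀ {y} → Star (Step (Edge J) In u v) (h zero) y → h zero ≢ y → _
      go ε ne = contradiction refl ne
      go (_◅_ {j = y} (e , iy , yu , yv) _) _ = h zero , y , ∨-left (sub zero) ,
        ∨-left (∖-in {In = In ∖ u} (∖-in {In = In} iy yu) yv) , edge-irrefl J e , trans (opposite (edge-irrefl J e)) (cong not e)

-- Take In as large as possible over both sides of H.
core-search : ∀ {n} (H : FinGraph n) fuel p s (In : Fin n → Bool) → n ≤ p + fuel → 5 ≤ p → Big p In →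
              ThreeConn (Edge (side s H)) In →
              (∃ λ x → ∃ λ y → In x ≡ true × In y ≡ true × x ≢ y × adj (side s H) x y ≡ false) → Core H
core-search {n} H fuel p s In le 5≤p big conn nonadj = pick s refl
  where
  J = side s H
  big₅ : Big 5 In
  big₅ = big-≤ {In = In} 5≤p big

  p≤n : ∀ {p} {In : Fin n → Bool} → Big p In → p ≤ n
  p≤n (h , inj , _) = F.injective⇒≤ inj

  proceed : ∀ a b → In a ≡ true → In b ≡ true → a ≢ b → adj J a b ≡ s → Core H
  proceed a b ia ib a≢b e with embeds? J In (flip J a b)
  ... | no none = record { s = s ; In = In ; big = big₅ ; conn = conn ; a = a ; b = b ; a≢b = a≢b ; pair = e
                         ; none = λ ψ em → none (ψ , em) }
  ... | yes (ψ , em) = grow fuel le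
    where
    open Reembedding J In conn big₅ a b a≢b ia ib ψ em
    grow : ∀ fuel → n ≤ p + fuel → Core H
    grow zero le = contradiction (≤-trans (p≤n {In = U} (big-U big)) (≤-trans le (≤-reflexive (ℕ.+-identityʳ p)))) ℕ.1+n≰n
    grow (suc fuel) le with crossing?
    ... | inj₁ cross = core-search H fuel (suc p) s U (≤-trans le (≤-reflexive (ℕ.+-suc p fuel))) (ℕ.m≤n⇒m≤1+n 5≤p)
          (big-U big) (Union.union-conn cross) (let x , y , ix , iy , r = nonadj in x , y , ∨-left ix , ∨-left iy , r)
    ... | inj₂ (u , v , no-cross) with p ∸ 5 | ℕ.m+[n∸m]≡n 5≤p
    ...   | q | refl = core-search H fuel (suc p) (not s) U′ (≤-trans le (≤-reflexive (ℕ.+-suc p fuel))) (ℕ.m≤n⇒m≤1+n 5≤p)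
            big-U′ conn′ nonadjacent
      where
      open Join (side (not s) H) (side-not s H) u v no-cross {q} big

  -- The pair must be a non-edge of `H`: in `H` itself it is the given nonadjacent pair, in the
  -- complement it is any edge, such as the first one of a path in `In`.
  pick : ∀ t → s ≡ t → Core H
  pick false refl = let x , y , ix , iy , ne , e = nonadj in proceed x y ix iy ne e
  pick true  refl with big₅
  ... | h , inj , sub = go (conn z z x y (sub _) (sub _) (ne λ ()) (ne λ ()) (ne λ ()) (ne λ ())) (ne λ ())
    where
    x = h zero
    y = h (suc zero)
    z = h (suc (suc zero))
    ne : ∀ {i j} → i ≢ j → h i ≢ h j
    ne d e = d (inj e)
    go : ∀ {w} → Star (Step (Edge J) In z z) x w → x ≢ w → Core H
    go ε d = contradiction refl d
    go (_◅_ {j = w} (e , iw , _) _) _ = proceed x w (sub _) iw (edge-irrefl J e) e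

-- Greedy deletion of edges

T-true : ∀ {b} → T b → b ≡ true
T-true {true} _ = refl

count : ∀ {N} → (Fin N → Bool) → ℕ
count {zero}  f = 0
count {suc N} f = (if f zero then 1 else 0) + count (f ∘ suc)

count-≤ : ∀ {N} {f g : Fin N → Bool} → (∀ i → f i ≡ true → g i ≡ true) → count f ≤ count g
count-≤ {zero}  le = z≤n
count-≤ {suc N} {f} {g} le = ℕ.+-mono-≤ (go (f zero) (g zero) (le zero)) (count-≤ (le ∘ suc))
  where
  go : ∀ b c → (b ≡ true → c ≡ true) → (if b then 1 else 0) ≤ (if c then 1 else 0)
  go true  true  _ = ≤-refl
  go true  false h = case h refl of λ ()
  go false _     _ = z≤n

count-< : ∀ {N} {f g : Fin N → Bool} → (∀ i → f i ≡ true → g i ≡ true) →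
          ∀ i → f i ≡ false → g i ≡ true → count f < count g
count-< {suc N} {f} {g} le zero    p q rewrite p | q = s≤s (count-≤ (le ∘ suc))
count-< {suc N} {f} {g} le (suc i) p q = ℕ.+-mono-≤-< (go (f zero) (g zero) (le zero)) (count-< (le ∘ suc) i p q)
  where
  go : ∀ b c → (b ≡ true → c ≡ true) → (if b then 1 else 0) ≤ (if c then 1 else 0)
  go true  true  _ = ≤-refl
  go true  false h = case h refl of λ ()
  go false _     _ = z≤n

embedding⊑ : ∀ {k n} {H : FinGraph k} {G : FinGraph n} (φ : Fin k → Fin n) → (∀ {x y} → φ x ≡ φ y → x ≡ y) →
             (∀ x y → adj H x y ≡ adj G (φ x) (φ y)) → H ⊑ G
embedding⊑ φ inj ind = record { embedding = mk↣ inj ; induced = ind }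

⊑? : ∀ {k n} (H : FinGraph k) (G : FinGraph n) → Dec (H ⊑ G)
⊑? {k} {n} H G with any? {n = n ^ k} (λ c →
    all? (λ x → all? (λ y → (finToFun {n} {k} c x F.≟ finToFun {n} {k} c y) →-dec (x F.≟ y)))
    ×-dec all? (λ x → all? (λ y → adj H x y Bool.≟ adj G (finToFun {n} {k} c x) (finToFun {n} {k} c y))))
... | yes (c , inj , ind) = yes (embedding⊑ (finToFun {n} {k} c) (inj _ _) ind)
... | no ¬c = no λ e → let φ = Injection.to (_⊑_.embedding e); eq = finToFun-funToFin {k} {n} φ in
      ¬c (funToFin {k} {n} φ ,
        (λ x y p → Injection.injective (_⊑_.embedding e) (trans (sym (eq x)) (trans p (eq y)))) ,
        (λ x y → trans (_⊑_.induced e x y) (sym (cong₂ (adj G) (eq x) (eq y)))))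

-- A copy of `H` that is complete except for the surplus edge `u v`. Its other edges are protected
-- and its other non-edges already absent from `Γ`, so it survives in every graph between `Q` and
-- `Γ`.
record Template {k n} (H : FinGraph k) (Γ : FinGraph n) (Q : Fin n → Fin n → Set) (u v : Fin n) : Set where
  field
    φ       : Fin k → Fin n
    φ-inj   : ∀ {x y} → φ x ≡ φ y → x ≡ y
    a b     : Fin k
    missing : adj H a b ≡ false
    φa      : φ a ≡ u
    φb      : φ b ≡ v
    present : ∀ i j → i ≢ j → sameEdge a b i j ≡ false → adj H i j ≡ true → Q (φ i) (φ j)
    absent  : ∀ i j → i ≢ j → sameEdge a b i j ≡ false → adj H i j ≡ false → adj Γ (φ i) (φ j) ≡ false

-- Edges are deleted as long as no copy of H appears; a protected edge always
-- survives, since the first deletion of a protected edge completes its template.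
module Greedy {k n : ℕ} (H : FinGraph k) (Γ : FinGraph n) (Q : Fin n → Fin n → Set)
              (Q-edge : ∀ {u v} → Q u v → adj Γ u v ≡ true)
              (template : ∀ {u v} → Q u v → Template H Γ Q u v)
              (some : ∃ λ u → ∃ λ v → Q u v) where

  delete-adj : ∀ (G : FinGraph n) u v {x y} → adj (deleteEdge G u v) x y ≡ true → adj G x y ≡ true
  delete-adj G u v {x} {y} p = proj₁ (∧-true {adj G x y} p)

  record State (G : FinGraph n) : Set where
    field
      below  : ∀ {x y} → adj Γ x y ≡ false → adj G x y ≡ false
      keeps  : ∀ {x y} → Q x y → adj G x y ≡ true
      H-free : ¬ (H ⊑ G)

  completes : ∀ {G} → State G → ∀ u v x y → Q x y → sameEdge u v x y ≡ true → H ⊑ deleteEdge G u v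
  completes {G} st u v x y q same = embedding⊑ φ φ-inj λ i j → go i j (i F.≟ j) (sameEdge a b i j) refl
    where
    open State st
    open Template (template q)
    uv : (φ a ≡ u × φ b ≡ v) ⊎ (φ a ≡ v × φ b ≡ u)
    uv with sameEdge-true {a = u} {v} {x} {y} same
    ... | inj₁ (p , p′) = inj₁ (trans φa p , trans φb p′)
    ... | inj₂ (p , p′) = inj₂ (trans φa p , trans φb p′)
    hits : ∀ {i j} → sameEdge a b i j ≡ true → sameEdge u v (φ i) (φ j) ≡ true
    hits {i} {j} p with sameEdge-true {a = a} {b} {i} {j} p | uv
    ... | inj₁ (refl , refl) | inj₁ (r , r′) = sameEdge-intro {a = u} {v} (inj₁ (r , r′))
    ... | inj₁ (refl , refl) | inj₂ (r , r′) = sameEdge-intro {a = u} {v} (inj₂ (r , r′))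
    ... | inj₂ (refl , refl) | inj₁ (r , r′) = sameEdge-intro {a = u} {v} (inj₂ (r′ , r))
    ... | inj₂ (refl , refl) | inj₂ (r , r′) = sameEdge-intro {a = u} {v} (inj₁ (r′ , r))
    misses : ∀ {i j} → sameEdge a b i j ≡ false → sameEdge u v (φ i) (φ j) ≡ false
    misses {i} {j} p = not-false λ e → case trans (sym p) (sameEdge-intro {a = a} {b} (back (sameEdge-true {a = u} {v} {φ i} {φ j} e) uv)) of λ ()
      where
      back : (φ i ≡ u × φ j ≡ v) ⊎ (φ i ≡ v × φ j ≡ u) → (φ a ≡ u × φ b ≡ v) ⊎ (φ a ≡ v × φ b ≡ u) →
             (i ≡ a × j ≡ b) ⊎ (i ≡ b × j ≡ a)
      back (inj₁ (r , r′)) (inj₁ (s , s′)) = inj₁ (φ-inj (trans r (sym s)) , φ-inj (trans r′ (sym s′)))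
      back (inj₁ (r , r′)) (inj₂ (s , s′)) = inj₂ (φ-inj (trans r (sym s′)) , φ-inj (trans r′ (sym s)))
      back (inj₂ (r , r′)) (inj₁ (s , s′)) = inj₂ (φ-inj (trans r (sym s′)) , φ-inj (trans r′ (sym s)))
      back (inj₂ (r , r′)) (inj₂ (s , s′)) = inj₁ (φ-inj (trans r (sym s)) , φ-inj (trans r′ (sym s′)))
    G′ = deleteEdge G u v
    go : ∀ i j → Dec (i ≡ j) → ∀ t → sameEdge a b i j ≡ t → adj H i j ≡ adj G′ (φ i) (φ j)
    go i .i (yes refl) t p = trans (irrefl H i) (sym (irrefl G′ (φ i)))
    go i j (no ne) true p = trans H-missing
      (sym (trans (cong (λ c → adj G (φ i) (φ j) ∧ not c) (hits p)) (Bool.∧-zeroʳ _)))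
      where
      H-missing : adj H i j ≡ false
      H-missing with sameEdge-true {a = a} {b} {i} {j} p
      ... | inj₁ (refl , refl) = missing
      ... | inj₂ (refl , refl) = trans (symm H b a) missing
    go i j (no ne) false p = trans (same′ (adj H i j) refl)
      (sym (trans (cong (λ c → adj G (φ i) (φ j) ∧ not c) (misses p)) (Bool.∧-identityʳ _)))
      where
      same′ : ∀ t → adj H i j ≡ t → adj H i j ≡ adj G (φ i) (φ j)
      same′ true  e = trans e (sym (keeps (present i j ne p e)))
      same′ false e = trans e (sym (below (absent i j ne p e)))

  deletable? : ∀ (G : FinGraph n) → Dec (∃ λ u → ∃ λ v → adj G u v ≡ true × ¬ (H ⊑ deleteEdge G u v))
  deletable? G = any? λ u → any? λ v → (adj G u v Bool.≟ true) ×-dec ¬? (⊑? H (deleteEdge G u v))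

  edges : FinGraph n → ℕ
  edges G = count {n * n} λ z → let x , y = remQuot {n} n z in adj G x y

  smaller : ∀ G u v → adj G u v ≡ true → edges (deleteEdge G u v) < edges G
  smaller G u v e = count-< (λ z → delete-adj G u v) (combine {n} {n} u v)
    (trans (cong (λ p → adj (deleteEdge G u v) (proj₁ p) (proj₂ p)) (F.remQuot-combine {n} {n} u v))
      (trans (cong (λ c → adj G u v ∧ not c) (sameEdge-intro {a = u} {v} (inj₁ (refl , refl)))) (Bool.∧-zeroʳ _)))
    (trans (cong (λ p → adj G (proj₁ p) (proj₂ p)) (F.remQuot-combine {n} {n} u v)) e)

  greedy : ∀ fuel G → edges G ≤ fuel → State G → HasFiniteDeletionHost H
  greedy fuel G le st = go fuel le (deletable? G)
    where
    go : ∀ fuel → edges G ≤ fuel → Dec (∃ λ u → ∃ λ v → adj G u v ≡ true × ¬ (H ⊑ deleteEdge G u v)) →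
         HasFiniteDeletionHost H
    go _ _ (no none) = n , G , record
      { hasEdge  = let u , v , q = some in u , v , subst T (sym (State.keeps st q)) tt
      ; H-free   = State.H-free st
      ; deletion = λ u v e → decidable-stable (⊑? H (deleteEdge G u v)) λ ¬e → none (u , v , T-true e , ¬e) }
    go zero le (yes (u , v , e , free)) = case ≤-trans (smaller G u v e) le of λ ()
    go (suc fuel) le (yes (u , v , e , free)) = greedy fuel (deleteEdge G u v) (ℕ.≤-pred (≤-trans (smaller G u v e) le)) record
      { below  = λ {x} {y} p → cong (_∧ not (sameEdge u v x y)) (State.below st p)
      ; keeps  = λ {x} {y} q → ∧-intro (State.keeps st q)
          (cong not (not-false λ s → free (completes st u v x y q s)))
      ; H-free = free }

  host : ¬ (H ⊑ Γ) → HasFiniteDeletionHost H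
  host free = greedy (edges Γ) Γ ≤-refl record { below = id ; keeps = Q-edge ; H-free = free }

-- Types of blocks

abstract
  swap : ∀ {n} → Fin n → Fin n → Fin n → Fin n
  swap x y z = if does (z F.≟ x) then y else if does (z F.≟ y) then x else z

  swap-left : ∀ {n} (x y : Fin n) → swap x y x ≡ y
  swap-left x y rewrite dec-true (x F.≟ x) refl = refl

  swap-right : ∀ {n} (x y : Fin n) → swap x y y ≡ x
  swap-right x y with y F.≟ x
  ... | yes refl = refl
  ... | no  _    rewrite dec-true (y F.≟ y) refl = refl

  swap-other : ∀ {n} {x y z : Fin n} → z ≢ x → z ≢ y → swap x y z ≡ z
  swap-other {x = x} {y} {z} p q rewrite dec-false (z F.≟ x) p | dec-false (z F.≟ y) q = refl

  swap-involutive : ∀ {n} (x y z : Fin n) → swap x y (swap x y z) ≡ z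
  swap-involutive x y z with z F.≟ x | z F.≟ y
  ... | yes refl | _        = swap-right x y
  ... | no _     | yes refl = swap-left x y
  ... | no p     | no q     = swap-other p q

  swap-injective : ∀ {n} (x y : Fin n) {z z′} → swap x y z ≡ swap x y z′ → z ≡ z′
  swap-injective x y p = trans (sym (swap-involutive x y _)) (trans (cong (swap x y) p) (swap-involutive x y _))

-- The generator e permutes the types related to it by R, reaching the type e
-- from each of them, and fixes the others.  In phase h it has exchanged the
-- types h and e.
module Types (m′ : ℕ) (R : Fin (suc m′) → Fin (suc m′) → Bool) where

  r : ℕ
  r = suc m′

  open Constructions r m′
  open Actions r m′

  π : E → E → E → E
  π e h τ = if R h e ∧ R e e then swap h e τ else τ

  π-invol : ∀ e h τ → π e h (π e h τ) ≡ τ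
  π-invol e h τ with R h e ∧ R e e
  ... | true  = swap-involutive h e τ
  ... | false = refl

  π-R : ∀ e h τ → R (π e h τ) e ≡ R τ e
  π-R e h τ with R h e in p | R e e in q
  ... | false | _     = refl
  ... | true  | false = refl
  ... | true  | true  with τ F.≟ h | τ F.≟ e
  ...   | yes refl | _        = trans (cong (λ x → R x e) (swap-left h e)) (trans q (sym p))
  ...   | no _     | yes refl = trans (cong (λ x → R x e) (swap-right h e)) (trans p (sym q))
  ...   | no a     | no b     = cong (λ x → R x e) (swap-other a b)

  π-reach : ∀ e τ → R τ e ≡ true → R e e ≡ true → π e τ τ ≡ e
  π-reach e τ p q rewrite p | q = swap-left τ e

  -- The exchange of the old phase is undone before that of the new one is made. Iterates therefore
  -- telescope, and a full round of phases is the identity.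
  turn : E → Fin r × E → Fin r × E
  turn e (h , τ) = rotate h , π e (rotate h) (π e h τ)

  turn-iter : ∀ s e h τ → iter s (turn e) (h , τ) ≡ (iter s rotate h , π e (iter s rotate h) (π e h τ))
  turn-iter zero    e h τ = cong (h ,_) (sym (π-invol e h τ))
  turn-iter (suc s) e h τ = trans (turn-iter s e (rotate h) _)
    (cong (λ u → iter s rotate (rotate h) , π e (iter s rotate (rotate h)) u) (π-invol e (rotate h) (π e h τ)))

  phased : Action (Fin r × E)
  phased .act = turn
  phased .order e (h , τ) = trans (turn-iter m e h τ)
    (cong₂ _,_ (rotate-order h) (trans (cong (λ g → π e g (π e h τ)) (rotate-order h)) (π-invol e h τ)))

  turn-R : ∀ e u → R (proj₂ (turn e u)) e ≡ R (proj₂ u) e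
  turn-R e (h , τ) = trans (π-R e (rotate h) _) (π-R e h τ)

  rotate-reach : ∀ (h g : Fin r) → ∃ λ s → iter s rotate h ≡ g
  rotate-reach h g = (m ∸ toℕ h) + toℕ g , F.toℕ-injective (trans (rotate-iter _ h)
    (trans (cong (_% m) (trans (sym (ℕ.+-assoc (toℕ h) (m ∸ toℕ h) (toℕ g)))
                               (trans (cong (_+ toℕ g) (ℕ.m+[n∸m]≡n (ℕ.<⇒≤ (F.toℕ<n h)))) (ℕ.+-comm m (toℕ g)))))
      (trans ([m+n]%n≡m%n (toℕ g) m) (m<n⇒m%n≡m (F.toℕ<n g)))))

  -- Undoing the current exchange leaves an underlying type; in the phase with that number it is
  -- exchanged with `e`.
  turn-reach : ∀ e u → R (proj₂ u) e ≡ true → R e e ≡ true → ∃ λ s → proj₂ (iter s (turn e) u) ≡ e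
  turn-reach e (h , τ) p q with rotate-reach h (π e h τ)
  ... | s , eq = s , trans (cong proj₂ (turn-iter s e h τ))
        (trans (cong (λ g → π e g (π e h τ)) eq) (π-reach e (π e h τ) (trans (π-R e h τ) p) q))

  T₀ : Action (Fin (r * r))
  T₀ = Coded.coded (remQuot {r} r) (λ u → combine (proj₁ u) (proj₂ u))
         (λ u → F.remQuot-combine (proj₁ u) (proj₂ u)) (F.combine-remQuot {r} r) phased

  kind : Fin (r * r) → E
  kind x = proj₂ (remQuot {r} r x)

  dec-T₀ : ∀ e x → remQuot {r} r (act T₀ e x) ≡ turn e (remQuot {r} r x)
  dec-T₀ e x = F.remQuot-combine {r} {r} _ _

  kind-R : ∀ e x → R (kind (act T₀ e x)) e ≡ R (kind x) e
  kind-R e x = trans (cong (λ u → R (proj₂ u) e) (dec-T₀ e x)) (turn-R e (remQuot {r} r x))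

  kind-reach : ∀ e x → R (kind x) e ≡ true → R e e ≡ true → ∃ λ s → kind (iter s (act T₀ e) x) ≡ e
  kind-reach e x p q with turn-reach e (remQuot {r} r x) p q
  ... | s , eq = s , trans (cong proj₂ (dec-iter s x)) eq
    where
    dec-iter : ∀ s x → remQuot {r} r (iter s (act T₀ e) x) ≡ iter s (turn e) (remQuot {r} r x)
    dec-iter zero    x = refl
    dec-iter (suc s) x = trans (dec-iter s _) (cong (iter s (turn e)) (dec-T₀ e x))

  kind-onto : ∀ e → ∃ λ x → kind x ≡ e
  kind-onto e = combine {r} {r} zero e , cong proj₂ (F.remQuot-combine {r} {r} zero e)

module Pairs (K : ℕ) where

  abstract
    low high : Fin (K * K) → Fin K
    low  e = proj₁ (remQuot {K} K e)
    high e = proj₂ (remQuot {K} K e)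

    edge : Fin K → Fin K → Fin (K * K)
    edge = combine

    low-edge : ∀ i j → low (edge i j) ≡ i
    low-edge i j = cong proj₁ (F.remQuot-combine {K} {K} i j)

    high-edge : ∀ i j → high (edge i j) ≡ j
    high-edge i j = cong proj₂ (F.remQuot-combine {K} {K} i j)

    edge-ends : ∀ e → edge (low e) (high e) ≡ e
    edge-ends = F.combine-remQuot {K} K

  abstract
    -- Only codes with `low e` below `high e` name a pair; the remaining codes are generators in no
    -- star.
    mem : Fin K → Fin (K * K) → Bool
    mem i e = does (low e F.<? high e) ∧ (eq? i (low e) ∨ eq? i (high e))

    ln : Fin K → Fin K → Fin (K * K)
    ln i j = if does (i F.<? j) then edge i j else edge j i

    mem-true : ∀ i e → mem i e ≡ true → low e FB.< high e × (i ≡ low e ⊎ i ≡ high e)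
    mem-true i e p with ∧-true {does (low e F.<? high e)} p
    ... | q , q′ = does-true (low e F.<? high e) q , Sum.map eq?-true eq?-true (∨-true {eq? i (low e)} q′)

    mem-intro : ∀ i e → low e FB.< high e → i ≡ low e ⊎ i ≡ high e → mem i e ≡ true
    mem-intro i e lt (inj₁ refl) = ∧-intro (dec-true (low e F.<? high e) lt) (∨-left (eq?-refl (low e)))
    mem-intro i e lt (inj₂ refl) = ∧-intro (dec-true (low e F.<? high e) lt) (∨-right {eq? (high e) (low e)} (eq?-refl (high e)))

    ln-cases : ∀ {i j} → i ≢ j → (i FB.< j × ln i j ≡ edge i j) ⊎ (j FB.< i × ln i j ≡ edge j i)
    ln-cases {i} {j} ne with F.<-cmp i j
    ... | tri< lt _ _ = inj₁ (lt , cong (if_then edge i j else edge j i) (dec-true (i F.<? j) lt))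
    ... | tri≈ _ e _  = contradiction e ne
    ... | tri> ¬lt _ gt = inj₂ (gt , cong (if_then edge i j else edge j i) (dec-false (i F.<? j) ¬lt))

  mem-edge : ∀ i j l → i FB.< j → l ≡ i ⊎ l ≡ j → mem l (edge i j) ≡ true
  mem-edge i j l lt o = mem-intro l (edge i j)
    (subst₂ FB._<_ (sym (low-edge i j)) (sym (high-edge i j)) lt)
    (Sum.map (λ p → trans p (sym (low-edge i j))) (λ p → trans p (sym (high-edge i j))) o)

  mem-ln : ∀ {i j} l → i ≢ j → l ≡ i ⊎ l ≡ j → mem l (ln i j) ≡ true
  mem-ln {i} {j} l ne o with ln-cases ne
  ... | inj₁ (lt , e) = trans (cong (mem l) e) (mem-edge i j l lt o)
  ... | inj₂ (lt , e) = trans (cong (mem l) e) (mem-edge j i l lt (Sum.swap o))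

  ln-unique : ∀ {i j e} → i ≢ j → mem i e ≡ true → mem j e ≡ true → e ≡ ln i j
  ln-unique {i} {j} {e} ne p q with mem-true i e p | mem-true j e q
  ... | lt , inj₁ a | _ , inj₁ b = contradiction (trans a (sym b)) ne
  ... | lt , inj₂ a | _ , inj₂ b = contradiction (trans a (sym b)) ne
  ... | lt , inj₁ a | _ , inj₂ b with ln-cases ne
  ...   | inj₁ (_ , c)  = trans (sym (edge-ends e)) (trans (sym (cong₂ edge a b)) (sym c))
  ...   | inj₂ (gt , _) = contradiction (subst₂ FB._<_ b a gt) (F.<-asym lt)
  ln-unique {i} {j} {e} ne p q | lt , inj₂ a | _ , inj₁ b with ln-cases ne
  ...   | inj₁ (gt , _) = contradiction (subst₂ FB._<_ a b gt) (F.<-asym lt)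
  ...   | inj₂ (_ , c)  = trans (sym (edge-ends e)) (trans (sym (cong₂ edge b a)) (sym c))

  no-three : ∀ {i j l e} → i ≢ j → i ≢ l → j ≢ l → mem i e ≡ true → mem j e ≡ true → mem l e ≡ true → ⊥
  no-three {i} {j} {l} {e} ij il jl p q s
    with proj₂ (mem-true i e p) | proj₂ (mem-true j e q) | proj₂ (mem-true l e s)
  ... | inj₁ a | inj₁ b | _      = ij (trans a (sym b))
  ... | inj₂ a | inj₂ b | _      = ij (trans a (sym b))
  ... | inj₁ a | inj₂ b | inj₁ c = il (trans a (sym c))
  ... | inj₁ a | inj₂ b | inj₂ c = jl (trans b (sym c))
  ... | inj₂ a | inj₁ b | inj₁ c = jl (trans b (sym c))
  ... | inj₂ a | inj₁ b | inj₂ c = il (trans a (sym c))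

  stars : Stars K (K * K)
  stars = record
    { mem = mem ; ln = ln
    ; ln-∈ˡ = λ {i} ne → mem-ln i ne (inj₁ refl) ; ln-∈ʳ = λ {_} {j} ne → mem-ln j ne (inj₂ refl)
    ; ln-! = ln-unique ; three = λ {_} {_} {_} {e} → no-three {e = e} }

-- The host

bool-ext : ∀ {p q} → (p ≡ true → q ≡ true) → (q ≡ true → p ≡ true) → p ≡ q
bool-ext {true}  f g = sym (f refl)
bool-ext {false} {true}  f g = g refl
bool-ext {false} {false} f g = refl

xor-cancel : ∀ s {p q} → p xor s ≡ q xor s → p ≡ q
xor-cancel false {p} {q} e = trans (sym (Bool.xor-identityʳ p)) (trans e (Bool.xor-identityʳ q))
xor-cancel true {true}  {true}  e = refl
xor-cancel true {false} {false} e = refl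

exchange : {A B : Set} → A × B → B × A
exchange (x , y) = y , x

sameEdge-ends : ∀ {n} (a b : Fin n) {x y} → sameEdge a b x y ≡ sameEdge a b y x
sameEdge-ends a b {x} {y} = bool-ext
  (λ p → sameEdge-intro {a = a} {b} (Sum.swap (Sum.map exchange exchange (sameEdge-true {a = a} {b} {x} {y} p))))
  (λ p → sameEdge-intro {a = a} {b} (Sum.swap (Sum.map exchange exchange (sameEdge-true {a = a} {b} {y} {x} p))))

sameEdge-swap : ∀ {n} (a b : Fin n) {x y} → sameEdge a b x y ≡ sameEdge b a x y
sameEdge-swap a b {x} {y} = bool-ext
  (λ p → sameEdge-intro {a = b} {a} (Sum.swap (sameEdge-true {a = a} {b} {x} {y} p)))
  (λ p → sameEdge-intro {a = a} {b} (Sum.swap (sameEdge-true {a = b} {a} {x} {y} p)))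

flip-sym : ∀ {n} (J : FinGraph n) a b x y → flip J a b x y ≡ flip J a b y x
flip-sym J a b x y = cong₂ (λ c d → if c then not d else d) (sameEdge-ends a b {x} {y}) (symm J x y)

side-xor : ∀ {n} s (H : FinGraph n) {x y} → x ≢ y → adj H x y ≡ adj (side s H) x y xor s
side-xor false H {x} {y} ne = sym (Bool.xor-identityʳ (adj H x y))
side-xor true  H {x} {y} ne = sym (trans (Bool.xor-comm (adj (complement H) x y) true)
  (trans (cong not (complement-adj H ne)) (not-involutive (adj H x y))))

module Roles {K : ℕ} (a b : Fin K) (a≢b : a ≢ b) where

  open Pairs K

  -- A permutation taking `low t` to `a` and `high t` to `b`: after the first transposition the
  -- second moves the image of `high t` to `b`, and it fixes `a` when `low t` and `high t` differ.
  role unrole : Fin (K * K) → Fin K → Fin K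
  role   t i = swap (swap (low t) a (high t)) b (swap (low t) a i)
  unrole t u = swap (low t) a (swap (swap (low t) a (high t)) b u)

  role-unrole : ∀ t u → role t (unrole t u) ≡ u
  role-unrole t u = trans (cong (swap (swap (low t) a (high t)) b) (swap-involutive (low t) a _))
                      (swap-involutive (swap (low t) a (high t)) b u)

  unrole-role : ∀ t i → unrole t (role t i) ≡ i
  unrole-role t i = trans (cong (swap (low t) a) (swap-involutive (swap (low t) a (high t)) b _))
                      (swap-involutive (low t) a i)

  role-injective : ∀ t {i j} → role t i ≡ role t j → i ≡ j
  role-injective t {i} {j} p = trans (sym (unrole-role t i)) (trans (cong (unrole t) p) (unrole-role t j))

  role-low : ∀ t → low t ≢ high t → role t (low t) ≡ a
  role-low t ne = trans (cong (swap (swap (low t) a (high t)) b) (swap-left (low t) a))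
    (swap-other (λ e → ne (swap-injective (low t) a (trans (swap-left (low t) a) e))) a≢b)

  role-high : ∀ t → role t (high t) ≡ b
  role-high t = swap-left (swap (low t) a (high t)) b

  ends-ln : ∀ {i j} → i ≢ j → (low (ln i j) ≡ i × high (ln i j) ≡ j) ⊎ (low (ln i j) ≡ j × high (ln i j) ≡ i)
  ends-ln {i} {j} ne with ln-cases ne
  ... | inj₁ (_ , e) = inj₁ (trans (cong low e) (low-edge i j) , trans (cong high e) (high-edge i j))
  ... | inj₂ (_ , e) = inj₂ (trans (cong low e) (low-edge j i) , trans (cong high e) (high-edge j i))

  low≢high : ∀ {i j} → i ≢ j → low (ln i j) ≢ high (ln i j)
  low≢high ne e with ends-ln ne
  ... | inj₁ (p , q) = ne (trans (sym p) (trans e q))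
  ... | inj₂ (p , q) = ne (trans (sym q) (trans (sym e) p))

  role-ends : ∀ {i j} → i ≢ j → (role (ln i j) i ≡ a × role (ln i j) j ≡ b) ⊎ (role (ln i j) i ≡ b × role (ln i j) j ≡ a)
  role-ends {i} {j} ne with ends-ln ne
  ... | inj₁ (p , q) = inj₁ (trans (cong (role (ln i j)) (sym p)) (role-low (ln i j) (low≢high ne)) ,
                             trans (cong (role (ln i j)) (sym q)) (role-high (ln i j)))
  ... | inj₂ (p , q) = inj₂ (trans (cong (role (ln i j)) (sym q)) (role-high (ln i j)) ,
                             trans (cong (role (ln i j)) (sym p)) (role-low (ln i j) (low≢high ne)))

module HostGraph {k′ : ℕ} (H : FinGraph (suc k′)) (core : Core H) where

  open Core core

  K m′ : ℕ
  K = suc k′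
  -- Makes `suc m′` compute to `K * K`, so generators, types and phases are indexed by the same set
  -- and the order of the generators equals the number of phases.
  m′ = k′ + k′ * K

  open Pairs K using (low; high; stars; ln-cases)
  open Roles a b a≢b

  G₀ : FinGraph K
  G₀ = side s H

  abstract
    B : Fin K → Fin K → Bool
    B = flip G₀ a b

    B-flip : ∀ u v → B u v ≡ flip G₀ a b u v
    B-flip u v = refl

    B-sym : ∀ u v → B u v ≡ B v u
    B-sym = flip-sym G₀ a b

  hb : Fin K → Fin K → Bool
  hb u v = B u v xor s

  hb-sym : ∀ u v → hb u v ≡ hb v u
  hb-sym u v = cong (_xor s) (B-sym u v)

  hb-ab : hb a b ≡ true
  hb-ab = trans (cong (_xor s) (trans (trans (B-flip a b) (flip-same G₀ a b (sameEdge-intro {a = a} {b} (inj₁ (refl , refl))))) (cong not pair)))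
                (not-xor s)
    where
    not-xor : ∀ s → not s xor s ≡ true
    not-xor false = refl
    not-xor true  = refl

  hb-H : ∀ {x y} → x ≢ y → sameEdge a b x y ≡ false → hb x y ≡ adj H x y
  hb-H {x} {y} ne p = trans (cong (_xor s) (trans (B-flip x y) (flip-other G₀ a b p))) (sym (side-xor s H ne))

  missing-ab : adj H a b ≡ false
  missing-ab = trans (side-xor s H a≢b) (trans (cong (_xor s) pair) (Bool.xor-same s))

  -- In a block of type `t`, colour `i` plays the vertex `role t i` of `B`; the relation says that
  -- the pair `e` is an edge there on the side of `H`.
  R : Fin (suc m′) → Fin (suc m′) → Bool
  R t e = hb (role t (low e)) (role t (high e))

  open Types m′ R using (T₀; kind; kind-R; kind-reach; kind-onto)

  module Build (𝔅 : Blocks stars m′ (suc K) T₀) where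

    open Vertices 𝔅

    R-ln : ∀ t {i j} → i ≢ j → R t (ln i j) ≡ hb (role t i) (role t j)
    R-ln t {i} {j} ne with ends-ln ne
    ... | inj₁ (p , q) = cong₂ (λ x y → hb (role t x) (role t y)) p q
    ... | inj₂ (p , q) = trans (cong₂ (λ x y → hb (role t x) (role t y)) p q) (hb-sym _ _)

    R-self : ∀ {i j} → i ≢ j → R (ln i j) (ln i j) ≡ true
    R-self {i} {j} ne = trans (cong₂ hb (role-low (ln i j) (low≢high ne)) (role-high (ln i j))) hb-ab

    ty : Fin size → E
    ty y = kind (type y)

    val : Fin size → Fin K → Fin K → Bool
    val y i j = B (role (ty y) i) (role (ty y) j)

    R-line : ∀ s e y → R (ty (iter s (act Y e) y)) e ≡ R (ty y) e
    R-line zero    e y = refl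
    R-line (suc s) e y = trans (R-line s e (act Y e y))
      (trans (cong (λ τ → R (kind τ) e) (type-act e y)) (kind-R e (type y)))

    val-line : ∀ {i j y y′} → i ≢ j → OnLine Y (ln i j) y y′ → val y′ i j ≡ val y i j
    val-line {i} {j} {y} ne (l , refl) = xor-cancel s
      (trans (sym (R-ln (ty (iter l (act Y (ln i j)) y)) ne)) (trans (R-line l (ln i j) y) (R-ln (ty y) ne)))

    Witness : V → V → Fin size → Set
    Witness u v y = Good y × y ∋ u × y ∋ v × proj₁ u ≢ proj₁ v × val y (proj₁ u) (proj₁ v) ≡ true

    witness? : ∀ u v → Dec (∃ (Witness u v))
    witness? u v = any? λ y → good? y ×-dec (y ∋? u) ×-dec (y ∋? v) ×-dec ¬? (proj₁ u F.≟ proj₁ v) ×-dec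
                              (val y (proj₁ u) (proj₁ v) Bool.≟ true)

    abstract
      AG : V → V → Bool
      AG u v = does (witness? u v)

      AG-true : ∀ {u v} → AG u v ≡ true → ∃ (Witness u v)
      AG-true {u} {v} = does-true (witness? u v)

      AG-intro : ∀ {u v y} → Witness u v y → AG u v ≡ true
      AG-intro {u} {v} w = dec-true (witness? u v) (_ , w)

    AG-sym : ∀ u v → AG u v ≡ AG v u
    AG-sym u v = bool-ext (λ p → AG-intro (rev (proj₂ (AG-true {u} {v} p)))) (λ p → AG-intro (rev (proj₂ (AG-true {v} {u} p))))
      where
      rev : ∀ {u v y} → Witness u v y → Witness v u y
      rev {u} {v} {y} (g , p , q , ne , e) = g , q , p , ne ∘ sym , trans (B-sym _ _) e

    -- Blocks with two common vertices lie on one line, and its generator preserves `R` on exactly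
    -- this pair; hence adjacency in the glued graph is well defined.
    val-meet : ∀ u v {y y′} → proj₁ u ≢ proj₁ v → Good y′ → y ∋ u → y ∋ v → y′ ∋ u → y′ ∋ v →
               val y (proj₁ u) (proj₁ v) ≡ val y′ (proj₁ u) (proj₁ v)
    val-meet u v {y} {y′} ne g p q p′ q′ = sym (val-line {proj₁ u} {proj₁ v} {y} {y′} ne meets)
      where
      meets : OnLine Y (ln (proj₁ u) (proj₁ v)) y y′
      meets = two-meet {y′} {y} {u} {v} ne g p′ q′ p q

    AG-val : ∀ {u v y} → Good y → y ∋ u → y ∋ v → proj₁ u ≢ proj₁ v → AG u v ≡ val y (proj₁ u) (proj₁ v)
    AG-val {u} {v} {y} g p q ne = bool-ext (λ e → from (AG-true {u} {v} e)) (λ e → AG-intro {u} {v} {y} (g , p , q , ne , e))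
      where
      from : ∃ (Witness u v) → val y (proj₁ u) (proj₁ v) ≡ true
      from (y′ , g′ , p′ , q′ , _ , e′) = trans (val-meet u v {y} {y′} ne g′ p q p′ q′) e′

    enc : V → Fin (K * size)
    enc (i , c) = combine i c

    dec : Fin (K * size) → V
    dec = remQuot {K} size

    dec-enc : ∀ v → dec (enc v) ≡ v
    dec-enc (i , c) = F.remQuot-combine {K} {size} i c

    dec-injective : ∀ {x y} → dec x ≡ dec y → x ≡ y
    dec-injective {x} {y} p = trans (sym (F.combine-remQuot {K} size x))
      (trans (cong enc p) (F.combine-remQuot {K} size y))

    -- The glued graph brought back to the side of `H`; for `s` true, distinct vertices without a
    -- common block become adjacent.
    Γ : FinGraph (K * size)
    Γ .adj x y = not (eq? x y) ∧ (AG (dec x) (dec y) xor s)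
    Γ .symm x y = cong₂ (λ c d → not c ∧ (d xor s)) (eq?-sym x y) (AG-sym (dec x) (dec y))
    Γ .irrefl x = cong (λ c → not c ∧ (AG (dec x) (dec x) xor s)) (eq?-refl x)

    Γ-adj : ∀ {x y} → x ≢ y → adj Γ x y ≡ AG (dec x) (dec y) xor s
    Γ-adj {x} {y} ne = cong (λ c → not c ∧ (AG (dec x) (dec y) xor s)) (eq?-false ne)

    module Free (φ : Fin K → V) (φ-inj : ∀ {x y} → φ x ≡ φ y → x ≡ y)
                (same : ∀ {x y} → x ≢ y → AG (φ x) (φ y) ≡ adj G₀ x y) where

      share : ∀ {x y} → Edge G₀ x y → Share (φ x) (φ y)
      share {x} {y} e = shared (AG-true {φ x} {φ y} (trans (same (edge-irrefl G₀ e)) e))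
        where
        shared : ∃ (Witness (φ x) (φ y)) → Share (φ x) (φ y)
        shared (y′ , g , p , q , _) = y′ , g , p , q

      contra : (∃ λ z → Good z × ∀ x → In x ≡ true → z ∋ φ x) → ⊥
      contra (z , g , on) = none ψ record { injective = inj ; preserves = pres }
        where
        ψ : Fin K → Fin K
        -- Within one block the colour determines the vertex, so reading off roles embeds `In` into
        -- `B`, which the core forbids.
        ψ x = role (ty z) (proj₁ (φ x))
        colour-inj : ∀ {x y} → In x ≡ true → In y ≡ true → proj₁ (φ x) ≡ proj₁ (φ y) → x ≡ y
        colour-inj {x} {y} ix iy e = φ-inj (∋-same {z} {φ x} {φ y} (on x ix) (on y iy) e)
        inj : ∀ x y → In x ≡ true → In y ≡ true → ψ x ≡ ψ y → x ≡ y
        inj x y ix iy e = colour-inj ix iy (role-injective (ty z) e)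
        loop : ∀ w → B w w ≡ false
        loop w = trans (trans (B-flip w w) (flip-other G₀ a b (not-false λ e → off (sameEdge-true {a = a} {b} {w} {w} e)))) (irrefl G₀ w)
          where
          off : (w ≡ a × w ≡ b) ⊎ (w ≡ b × w ≡ a) → ⊥
          off (inj₁ (p , q)) = a≢b (trans (sym p) q)
          off (inj₂ (p , q)) = a≢b (trans (sym q) p)
        distinct : ∀ {x y} → In x ≡ true → In y ≡ true → x ≢ y → adj G₀ x y ≡ B (ψ x) (ψ y)
        distinct {x} {y} ix iy ne = trans (sym (same ne))
          (AG-val {φ x} {φ y} {z} g (on x ix) (on y iy) λ e → ne (colour-inj ix iy e))
        pres : ∀ x y → In x ≡ true → In y ≡ true → adj G₀ x y ≡ flip G₀ a b (ψ x) (ψ y)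
        pres x y ix iy = trans (go (x F.≟ y)) (B-flip (ψ x) (ψ y))
          where
          go : Dec (x ≡ y) → adj G₀ x y ≡ B (ψ x) (ψ y)
          go (yes refl) = trans (irrefl G₀ x) (sym (loop (ψ x)))
          go (no ne)    = distinct ix iy ne

      absurd : ⊥
      absurd = contra (Confinement.confined 𝔅 (Edge G₀) (λ x e → edge-irrefl G₀ e refl) In big conn φ φ-inj share)

    Γ-free : ¬ (H ⊑ Γ)
    Γ-free emb = Free.absurd (dec ∘ f) (λ e → f-inj (dec-injective e)) same
      where
      f = Injection.to (_⊑_.embedding emb)
      f-inj = Injection.injective (_⊑_.embedding emb)
      same : ∀ {x y} → x ≢ y → AG (dec (f x)) (dec (f y)) ≡ adj G₀ x y
      same {x} {y} ne = xor-cancel s (trans (sym (Γ-adj (ne ∘ f-inj)))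
        (trans (sym (_⊑_.induced emb x y)) (side-xor s H ne)))

    -- Edges lying in a block. Any other edge of `Γ` is left to the greedy deletion.
    record Protected (x y : Fin (K * size)) : Set where
      field
        block  : Fin size
        good   : Good block
        i j    : Fin K
        i≢j    : i ≢ j
        end₁   : x ≡ enc (vert block i)
        end₂   : y ≡ enc (vert block j)
        colour : hb (role (ty block) i) (role (ty block) j) ≡ true

    enc-vert-injective : ∀ y {i j} → enc (vert y i) ≡ enc (vert y j) → i ≡ j
    enc-vert-injective y {i} {j} e = cong proj₁ (trans (sym (dec-enc (vert y i))) (trans (cong dec e) (dec-enc (vert y j))))

    Γ-vert : ∀ y {i j} → Good y → i ≢ j → adj Γ (enc (vert y i)) (enc (vert y j)) ≡ hb (role (ty y) i) (role (ty y) j)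
    Γ-vert y {i} {j} g ne = trans (Γ-adj (ne ∘ enc-vert-injective y))
      (cong (_xor s) (trans (cong₂ AG (dec-enc (vert y i)) (dec-enc (vert y j))) (AG-val {vert y i} {vert y j} {y} g refl refl ne)))

    protected-edge : ∀ {x y} → Protected x y → adj Γ x y ≡ true
    protected-edge {x} {y} p = trans (cong₂ (adj Γ) end₁ end₂) (trans (Γ-vert block good i≢j) colour)
      where open Protected p

    -- Moving the block along the line of `e` keeps both ends of the edge and reaches type `e`,
    -- where these ends play `a` and `b`; that block is the copy of `H` with the surplus edge.
    template : ∀ {x y} → Protected x y → Template H Γ Protected x y
    template {x} {y} p = oriented (role-ends i≢j)
      where
      open Protected p
      e : E
      e = ln i j
      reach : ∃ λ l → kind (iter l (act T₀ e) (type block)) ≡ e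
      reach = kind-reach e (type block) (trans (R-ln (ty block) i≢j) colour) (R-self i≢j)
      l = proj₁ reach
      z : Fin size
      z = iter l (act Y e) block
      type-iter : ∀ l y → type (iter l (act Y e) y) ≡ iter l (act T₀ e) (type y)
      type-iter zero    y = refl
      type-iter (suc l) y = trans (type-iter l (act Y e y)) (cong (iter l (act T₀ e)) (type-act e y))
      ty-z : ty z ≡ e
      ty-z = trans (cong kind (type-iter l block)) (proj₂ reach)
      good-z : Good z
      good-z = line-good {e} (l , refl) good
      on : ∀ c → mem c e ≡ true → vert z c ≡ vert block c
      on c q = cong (c ,_) (line-∋ {e} {block} {z} {vert block c} q (l , refl) refl)
      φ : Fin K → Fin (K * size)
      φ u = enc (vert z (unrole e u))
      φ-role : ∀ {u c} → role e c ≡ u → mem c e ≡ true → φ u ≡ enc (vert block c)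
      φ-role {u} {c} r q = trans (cong (λ i → enc (vert z i)) (trans (cong (unrole e) (sym r)) (unrole-role e c))) (cong enc (on c q))
      unrole-inj : ∀ {u v} → unrole e u ≡ unrole e v → u ≡ v
      unrole-inj {u} {v} q = trans (sym (role-unrole e u)) (trans (cong (role e) q) (role-unrole e v))
      hb-φ : ∀ u v → hb (role (ty z) (unrole e u)) (role (ty z) (unrole e v)) ≡ hb u v
      hb-φ u v = trans (cong (λ t → hb (role t (unrole e u)) (role t (unrole e v))) ty-z)
                       (cong₂ hb (role-unrole e u) (role-unrole e v))
      build : ∀ a′ b′ → φ a′ ≡ x → φ b′ ≡ y → adj H a′ b′ ≡ false →
              (∀ u v → sameEdge a b u v ≡ sameEdge a′ b′ u v) → Template H Γ Protected x y
      build a′ b′ pa pb miss se = record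
        { φ = φ ; φ-inj = λ q → unrole-inj (enc-vert-injective z q) ; a = a′ ; b = b′ ; missing = miss ; φa = pa ; φb = pb
        ; present = λ u v ne q h → record
            { block = z ; good = good-z ; i = unrole e u ; j = unrole e v ; i≢j = ne ∘ unrole-inj ; end₁ = refl ; end₂ = refl
            ; colour = trans (hb-φ u v) (trans (hb-H ne (trans (se u v) q)) h) }
        ; absent = λ u v ne q h → trans (Γ-vert z good-z (ne ∘ unrole-inj)) (trans (hb-φ u v) (trans (hb-H ne (trans (se u v) q)) h)) }
      oriented : (role e i ≡ a × role e j ≡ b) ⊎ (role e i ≡ b × role e j ≡ a) → Template H Γ Protected x y
      oriented (inj₁ (ra , rb)) = build a b (trans (φ-role ra (ln-∈ˡ i≢j)) (sym end₁)) (trans (φ-role rb (ln-∈ʳ i≢j)) (sym end₂))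
        missing-ab (λ u v → refl)
      oriented (inj₂ (rb , ra)) = build b a (trans (φ-role rb (ln-∈ˡ i≢j)) (sym end₁)) (trans (φ-role ra (ln-∈ʳ i≢j)) (sym end₂))
        (trans (symm H b a) missing-ab) (λ u v → sameEdge-swap a b {u} {v})

    some : ∃ λ x → ∃ λ y → Protected x y
    some = _ , _ , record
      { block = y ; good = good-origin τ ; i = a ; j = b ; i≢j = a≢b ; end₁ = refl ; end₂ = refl
      ; colour = trans (sym (R-ln (ty y) a≢b)) (trans (cong (λ t → R t e) ty-y) (R-self a≢b)) }
      where
      e = ln a b
      τ = proj₁ (kind-onto e)
      y = origin τ
      ty-y : ty y ≡ e
      ty-y = trans (cong kind (type-origin τ)) (proj₂ (kind-onto e))

    host : HasFiniteDeletionHost H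
    host = Greedy.host H Γ Protected protected-edge template some Γ-free

  has-host : HasFiniteDeletionHost H
  has-host = Build.host (blocks stars m′ (suc K) T₀)

-- From the given induced subgraph to the host

∣p∪q∣≤∣p∣+∣q∣ : ∀ {n} (p q : Subset n) → ∣ p ∪ q ∣ ≤ ∣ p ∣ + ∣ q ∣
∣p∪q∣≤∣p∣+∣q∣ []          []          = z≤n
∣p∪q∣≤∣p∣+∣q∣ (true  ∷ p) (true  ∷ q) = s≤s (≤-trans (∣p∪q∣≤∣p∣+∣q∣ p q) (ℕ.+-monoʳ-≤ ∣ p ∣ (ℕ.n≤1+n ∣ q ∣)))
∣p∪q∣≤∣p∣+∣q∣ (true  ∷ p) (false ∷ q) = s≤s (∣p∪q∣≤∣p∣+∣q∣ p q)
∣p∪q∣≤∣p∣+∣q∣ (false ∷ p) (true  ∷ q) = ≤-trans (s≤s (∣p∪q∣≤∣p∣+∣q∣ p q)) (≤-reflexive (sym (ℕ.+-suc ∣ p ∣ ∣ q ∣)))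
∣p∪q∣≤∣p∣+∣q∣ (false ∷ p) (false ∷ q) = ∣p∪q∣≤∣p∣+∣q∣ p q

module Image {k n : ℕ} (F : FinGraph k) (J : FinGraph n) (emb : F ⊑ J) where

  f : Fin k → Fin n
  f = Injection.to (_⊑_.embedding emb)

  f-inj : ∀ {x y} → f x ≡ f y → x ≡ y
  f-inj = Injection.injective (_⊑_.embedding emb)

  In? : ∀ y → Dec (∃ λ x → f x ≡ y)
  In? y = any? λ x → f x F.≟ y

  In : Fin n → Bool
  In y = does (In? y)

  In-f : ∀ x → In (f x) ≡ true
  In-f x = dec-true (In? (f x)) (x , refl)

  In-out : ∀ {y} → In y ≡ true → ∃ λ x → f x ≡ y
  In-out {y} = does-true (In? y)

  big : Big k In
  big = f , f-inj , In-f

  -- Translates the deletion of `s`, which may lie outside the image, into a deletion in `F`; two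
  -- such sets together stay within the two vertices allowed by `ThreeConnected`.
  at-most-one : ∀ s → ∃ λ (S : Subset k) → ∣ S ∣ ≤ 1 × (∀ x → f x ≡ s → x ∈ₛ S) × (∀ x → x ∈ₛ S → f x ≡ s)
  at-most-one s with In? s
  ... | yes (x , refl) = ⁅ x ⁆ , ≤-reflexive (∣⁅x⁆∣≡1 x) ,
        (λ y e → subst (_∈ₛ ⁅ x ⁆) (sym (f-inj e)) (x∈⁅x⁆ x)) , λ y m → cong f (x∈⁅y⁆⇒x≡y x m)
  ... | no ¬p = ∅ , ≤-trans (≤-reflexive (∣⊥∣≡0 k)) z≤n , (λ x e → contradiction (x , e) ¬p) , λ x m → contradiction m ∉⊥

  irrelevant-⊥ : ∀ {x} {S : Subset k} → Irrelevant (x ∉ S) → x ∈ₛ S → ⊥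
  irrelevant-⊥ [ p ] m = ⊥-elim-irr (p m)

  image-conn : ThreeConnected F → ThreeConn (Edge J) In
  image-conn (_ , conn) s t x y ix iy xs xt ys yt with In-out {x} ix | In-out {y} iy | at-most-one s | at-most-one t
  ... | x′ , refl | y′ , refl | S , cS , inS , outS | S′ , cT , inT , outT =
      map-path (conn (S ∪ S′) small (x′ , [ outside xs xt ]) (y′ , [ outside ys yt ]))
    where
    small : ∣ S ∪ S′ ∣ ≤ 2
    small = ≤-trans (∣p∪q∣≤∣p∣+∣q∣ S S′) (ℕ.+-mono-≤ cS cT)
    outside : ∀ {z} → f z ≢ s → f z ≢ t → z ∉ S ∪ S′
    outside zs zt m = [ (λ p → zs (outS _ p)) , (λ p → zt (outT _ p)) ]′ (x∈p∪q⁻ S S′ m)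
    map-path : ∀ {u v} → Star (Adj (deleteVertices F (S ∪ S′))) u v → Star (Step (Edge J) In s t) (f (value u)) (f (value v))
    map-path = Star.gmap (λ u → f (value u)) λ {u} {v} e →
      trans (sym (_⊑_.induced emb (value u) (value v))) (T-true e) , In-f (value v) ,
      (λ p → irrelevant-⊥ (proof v) (x∈p∪q⁺ (inj₁ (inS _ p)))) ,
      (λ p → irrelevant-⊥ (proof v) (x∈p∪q⁺ {p = S} (inj₂ (inT _ p))))

  nonadjacent : ¬ Complete F → ∃ λ x → ∃ λ y → In x ≡ true × In y ≡ true × x ≢ y × adj J x y ≡ false
  nonadjacent ¬c with any? (λ x → any? (λ y → ¬? (x F.≟ y) ×-dec (adj F x y Bool.≟ false)))
  ... | yes (x , y , ne , e) = f x , f y , In-f x , In-f y , (λ p → ne (f-inj p)) , trans (sym (_⊑_.induced emb x y)) e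
  ... | no none = contradiction complete ¬c
    where
    complete : Complete F
    complete x y ne with adj F x y in e
    ... | true  = tt
    ... | false = none (x , y , ne , e)

core-of : ∀ {m} (H : FinGraph m) s → HasNoncomplete3ConnectedInduced≥5 (side s H) → Core H
core-of {m} H s (k , F , 5≤k , ¬c , conn , emb) =
  core-search H m k s In (ℕ.m≤n+m m k) 5≤k big (image-conn conn) (nonadjacent ¬c)
  where
  open Image F (side s H) emb

host-of-core : ∀ {m} (H : FinGraph m) → Core H → HasFiniteDeletionHost H
host-of-core {zero}  H core = case Core.a core of λ ()
host-of-core {suc m} H core = HostGraph.has-host H core

corollary5p3 : ∀ (m : ℕ) (H : FinGraph m) →
    HasNoncomplete3ConnectedInduced≥5 H ⊎ HasNoncomplete3ConnectedInduced≥5 (complement H) →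
    HasFiniteDeletionHost H
corollary5p3 m H (inj₁ h) = host-of-core H (core-of H false h)
corollary5p3 m H (inj₂ h) = host-of-core H (core-of H true h)
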